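{- Let $k$ and $\ell$ be positive integers and write $m:=2^{\mathrm{ord}_2(\gcd(k,\ell))}$. Suppose that $q:=2^k$ and $Q:=2^\ell$ satisfy $\gcd(Q+1,q+1)=1$. Write $A(X):=1+bX^v+cX^u$ where $b,c\in\mathbb{F}_{q^2}$ and $u,v$ are positive integers such that $u(Q+1)\equiv 1\pmod{q+1}$ and $v(Q+1)\equiv Q\pmod{q+1}$. Then $f(X):=XA(X^{q-1})$ permutes $\mathbb{F}_{q^2}$ if and only if all of the following hold: (1) $e:=1+b^{q+1}+c^{q+1}$ is nonzero; (2) $c^Q=e^{Q-1}b$; (3) $\mathrm{Tr}_{\mathbb{F}_q/\mathbb{F}_{2^m}}\bigl(\frac1e\bigr)=\frac{k}{m}$.
   Context: For a positive integer $n$, $\mathrm{ord}_2(n)$ is the largest integer $i\ge0$ with $2^i\mid n$. A polynomial permutes $\mathbb{F}_{q^2}$ if it induces a bijection of $\mathbb{F}_{q^2}$. $\mathrm{Tr}_{\mathbb{F}_q/\mathbb{F}_{2^m}}$ is the trace map (note $m\mid k$), and the integer $k/m$ is viewed as an element of $\mathbb{F}_2\subseteq\mathbb{F}_{2^m}$. -}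

module Defs where

open import Algebra.Apartness.Bundles using (HeytingField)
import Algebra.Apartness.Properties.HeytingCommutativeRing as HCRProperties
open import Algebra.Bundles using (CommutativeRing)
import Algebra.Properties.Monoid.Sum as MonoidSum
import Algebra.Properties.Semiring.Exp as SemiringExp
import Algebra.Properties.Semiring.Mult as SemiringMult
open import Data.Fin.Base using (Fin; toℕ)
open import Data.Nat.Base as ℕ using (ℕ; zero; suc; NonZero; z≤n; s≤s)
open import Data.Nat.Divisibility using (_∣_; _∣?_; quotient; 1∣_; ∣-trans; ∣⇒≤)
open import Data.Nat.GCD using (gcd; gcd[m,n]∣m)
import Data.Nat.Properties as ℕ
open import Data.Product.Base using (proj₁; proj₂)
open import Function.Bundles using (Bijection)
open import Function.Definitions using (Bijective)
open import Level using (Level; _⊔_)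
open import Relation.Binary.PropositionalEquality as ≡ using (refl)
open import Relation.Nullary.Decidable using (yes; no)
open import Relation.Nullary.Negation using (contradiction)

infix 4 _≡_[mod_]

_≡_[mod_] : ℕ → ℕ → ℕ → Set
a ≡ b [mod n ] = n ∣ ℕ.∣ a - b ∣

-- The largest i ≤ bound with 2 ^ i ∣ n.
ord₂-upTo : (bound n : ℕ) → ℕ
ord₂-upTo zero      n = 0
ord₂-upTo (suc i) n with 2 ℕ.^ suc i ∣? n
... | yes _ = suc i
... | no  _ = ord₂-upTo i n

-- For n > 0 the bound n loses nothing, since 2 ^ i ∣ n forces i < 2 ^ i ≤ n;
-- see ord₂-greatest.  (ord₂ 0 is a junk value.)
ord₂ : ℕ → ℕ
ord₂ n = ord₂-upTo n n

2^ord₂-upTo∣ : ∀ bound n → 2 ℕ.^ ord₂-upTo bound n ∣ n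
2^ord₂-upTo∣ zero    n = 1∣ n
2^ord₂-upTo∣ (suc i) n with 2 ℕ.^ suc i ∣? n
... | yes p = p
... | no  _ = 2^ord₂-upTo∣ i n

ord₂-upTo-greatest : ∀ bound n {i} → i ℕ.≤ bound → 2 ℕ.^ i ∣ n →
                     i ℕ.≤ ord₂-upTo bound n
ord₂-upTo-greatest zero    n i≤b 2^i∣n = i≤b
ord₂-upTo-greatest (suc b) n {i} i≤b 2^i∣n with 2 ℕ.^ suc b ∣? n
... | yes _ = i≤b
... | no ¬p with i ℕ.≟ suc b
...   | yes refl = contradiction 2^i∣n ¬p
...   | no  i≢b  = ord₂-upTo-greatest b n (ℕ.≤-pred (ℕ.≤∧≢⇒< i≤b i≢b)) 2^i∣n

2^ord₂∣ : ∀ n → 2 ℕ.^ ord₂ n ∣ n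
2^ord₂∣ n = 2^ord₂-upTo∣ n n

n<2^n : ∀ n → n ℕ.< 2 ℕ.^ n
n<2^n zero    = s≤s z≤n
n<2^n (suc n) = begin-strict
  suc n                     ≤⟨ n<2^n n ⟩
  2 ℕ.^ n                   <⟨ ℕ.m<m+n (2 ℕ.^ n) (ℕ.m^n>0 2 n) ⟩
  2 ℕ.^ n ℕ.+ 2 ℕ.^ n       ≡⟨ ≡.cong (2 ℕ.^ n ℕ.+_) (ℕ.+-identityʳ (2 ℕ.^ n)) ⟨
  2 ℕ.^ suc n               ∎
  where open ℕ.≤-Reasoning

ord₂-greatest : ∀ n .{{_ : NonZero n}} {i} → 2 ℕ.^ i ∣ n → i ℕ.≤ ord₂ n
ord₂-greatest n {i} 2^i∣n =
  ord₂-upTo-greatest n n (ℕ.<⇒≤ (ℕ.<-≤-trans (n<2^n i) (∣⇒≤ 2^i∣n))) 2^i∣n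

2^ord₂[gcd]∣ˡ : ∀ k ℓ → 2 ℕ.^ ord₂ (gcd k ℓ) ∣ k
2^ord₂[gcd]∣ˡ k ℓ = ∣-trans (2^ord₂∣ (gcd k ℓ)) (gcd[m,n]∣m k ℓ)

-- F is the field with n elements when it satisfies HasCardinality F n.  A
-- finite field has decidable equality, and then x # y coincides with ¬ x ≈ y,
-- so "x is nonzero" is written x # 0#.
HasCardinality : ∀ {a r s} → HeytingField a r s → ℕ → Set (a ⊔ r)
HasCardinality F n = Bijection setoid (≡.setoid (Fin n))
  where open HeytingField F using (setoid)

module FieldNotation {a r s : Level} (F : HeytingField a r s) where

  open HeytingField F public
    using (Carrier; _≈_; _#_; _+_; _*_; 0#; 1#; heytingCommutativeRing)
  open HeytingField F
    using (#⇒invertible; trans; sym; *-congʳ; isCommutativeRing)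

  commutativeRing : CommutativeRing a r
  commutativeRing = record { isCommutativeRing = isCommutativeRing }

  open CommutativeRing commutativeRing using (semiring; +-monoid)

  open SemiringExp semiring public using (_^_)
  open SemiringMult semiring public using () renaming (_×_ to _·_)
  open MonoidSum +-monoid using (sum-syntax)

  -- The library inverts x - 0#; 1/-inverse shows that this is an inverse of x.
  1/_ : ∀ {x} → x # 0# → Carrier
  1/ x#0 = proj₁ (#⇒invertible x#0)

  1/-inverse : ∀ {x} (x#0 : x # 0#) → x * 1/ x#0 ≈ 1#
  1/-inverse {x} x#0 =
    trans (*-congʳ (sym (x-0≈x x))) (proj₂ (proj₂ (#⇒invertible x#0)))
    where open HCRProperties heytingCommutativeRing using (x-0≈x)

  -- For n ∣ d, the trace of the extension GF(2ᵈ) / GF(2ⁿ) is the sum of the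
  -- d/n conjugates x ^ (2ⁿ)ⁱ.  It is meant for x in the subfield
  -- GF(2ᵈ) = { x ∣ x ^ 2ᵈ ≈ x } of F, and its value is then in
  -- GF(2ⁿ) = { x ∣ x ^ 2ⁿ ≈ x }.
  Tr : ∀ {n d} → n ∣ d → Carrier → Carrier
  Tr {n} n∣d x = ∑[ i < quotient n∣d ] (x ^ ((2 ℕ.^ n) ℕ.^ toℕ i))

  -- A polynomial enters only through the map Carrier → Carrier it induces.
  Permutes : (Carrier → Carrier) → Set (a ⊔ r)
  Permutes = Bijective _≈_ _≈_

{-# OPTIONS --safe #-}

-- On the group μ of (q + 1)-th roots of unity, f induces a map g satisfying
-- g(x^(Q+1)) = N(x) / D(x), where D(x) = 1 + b x^Q + c x and N = x^(Q+1) D̄ with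
-- the bar for the q-th power.  Hence f permutes the field iff D has no zero on μ
-- and N / D is injective on μ.  The map N / D ramifies exactly at the points x for
-- which x^Q is a root of b t² + e t + b̄, and the fibre through such an x consists
-- of x, taken Q times, and one more point y.
--
-- If a ramification point x lies on μ, then so does y, and injectivity forces
-- y = x.  If not, a Möbius transformation turns N / D into
-- X^Q (A X + C) / (C̄ X + Ā), which cannot permute μ unless A C = 0, because its
-- sum over μ does not vanish.  Either way (1) and (2) follow.
--
-- Given (1) and (2), with ramification points x₁ and x₂, the map N / D is
-- X^(Q+1) or X^(Q-1) in the coordinate X = (x + x₁) / (x + x₂), which takes μ to
-- a circle if x₁, x₂ are not on μ and to a projective line over GF(q) if they are.
-- For the roots t = (e / b) s, where s² + s = b b̄ / e², these alternatives are
-- told apart by δ = 1/e^Q + s^Q + s and ε = s̄ + s, both in GF(2), and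
-- Tr(1/e) = (ℓ/m) ε + (k/m) δ.  As exactly one of k/m and ℓ/m is even, (3) says
-- that the power map in question is injective.

module Submission where

open import Defs
open import Algebra.Apartness.Bundles using (HeytingField)
open import Data.Nat.Base as ℕ using (ℕ; NonZero)
open import Data.Nat.Divisibility using (_∣_; quotient)
open import Data.Nat.GCD using (gcd)
open import Data.Product.Base using (Σ-syntax; _×_)
open import Function.Bundles using (_⇔_)
open import Relation.Binary.PropositionalEquality using (_≡_)

import Algebra.Apartness.Properties.HeytingCommutativeRing as HCRProperties
open import Algebra.Bundles using (CommutativeMonoid; CommutativeRing; RawRing)
import Algebra.Properties.CommutativeMonoid.Sum as CommutativeMonoidSum
import Algebra.Properties.CommutativeSemiring.Exp as Exp
import Algebra.Properties.Semiring.Mult as Mult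
import Algebra.Properties.Semiring.Sum as SemiringSum
import Algebra.Solver.Ring as RingSolver
open import Algebra.Solver.Ring.AlmostCommutativeRing
  using (fromCommutativeRing; _-Raw-AlmostCommutative⟶_)
open import Data.Bool.Base using (Bool; true; false; _xor_; _∧_; if_then_else_)
import Data.Bool.Properties as Bool
open import Data.Empty using (⊥-elim)
open import Data.Fin.Base using (Fin; zero; suc; toℕ; punchIn; punchOut; inject≤)
open import Data.Fin.Permutation using (Permutation′; permutation)
import Data.Fin.Properties as Fin
open import Data.Maybe.Base as Maybe using (Maybe)
open import Data.Nat.Base using (zero; suc; _%_; _/_)
open import Data.Nat.Divisibility
  using (divides; m%n≡0⇒n∣m; ∣m+n∣m⇒∣n; ∣m∣n⇒∣m+n; ∣1⇒≡1; ∣⇒≤; ∣-refl; ∣-reflexive; ∣-trans;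
         n∣m*n; *-cancelˡ-∣; *-monoʳ-∣)
open import Data.Nat.DivMod using (m≡m%n+[m/n]*n; m%n<n)
open import Data.Nat.GCD using (gcd-greatest; gcd[m,n]∣n; gcd[m,n]≢0)
import Data.Nat.Properties as ℕ
open import Data.Nat.Solver using (module +-*-Solver)
open import Data.Product.Base using (∃; ∃-syntax; _,_; proj₁; proj₂)
open import Data.Sum.Base using (_⊎_; inj₁; inj₂; [_,_]′; reduce)
open import Data.Vec.Base as Vec using (Vec; []; _∷_)
open import Function.Base using (id; _∘_)
open import Function.Bundles using (Bijection; mk⇔)
open import Function.Definitions using (Injective; Surjective)
open import Level as Level using (_⊔_)
open import Relation.Binary.Definitions using (Decidable)
open import Relation.Binary.PropositionalEquality as ≡ using (_≢_)
open import Relation.Nullary using (¬_; Dec; yes; no; contradiction; dec⇒maybe)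
open import Relation.Nullary.Decidable using (map′; ¬?; _×-dec_)

-- As x^Q has derivative 0, the derivative of N / D has numerator (x^Q + b̄) D + c N = b x^(2Q) + e
-- x^Q + b̄, a polynomial in x^Q alone: this is the origin of e and the reason why, for e ≠ 0, at
-- most two points ramify. Ramification itself never enters the argument: the explicit factorisation
-- N + l D = (x^Q + t)(x + y) with l = t y takes its place. To keep exponents out of the algebra,
-- x^q and x^Q are abstracted to commuting field endomorphisms `σ` and `φ`; every identity then
-- treats x, x̄, x^Q as independent variables, and each deduction exhibits one equation as a
-- combination of others over GF(2). When A C = 0, the point y is z or 1 / z̄, and comparing its
-- Q-th power with the equations defining y yields (2). The collisions that refute injectivity come
-- from a single ζ ≠ 1 with ζ^(2^m + 1) = 1: `σ` fixes or inverts it according to the parity of k/m,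
-- and `φ` according to that of ℓ/m. Only when the ramification points lie on μ and share a fibre is
-- injectivity refuted without it.

record DiscreteChar2Field c ℓ : Set (Level.suc (c ⊔ ℓ)) where
  field
    commutativeRing : CommutativeRing c ℓ

  open CommutativeRing commutativeRing hiding (zero) public

  field
    1+1≈0   : 1# + 1# ≈ 0#
    1≉0     : ¬ 1# ≈ 0#
    inverse : ∀ {x} → ¬ x ≈ 0# → ∃ λ y → x * y ≈ 1#
    _≟_     : Decidable _≈_

module Char2Solver {c ℓ} (K : DiscreteChar2Field c ℓ) where

  open DiscreteChar2Field K

  -- With coefficients in GF(2), the normal forms of the solver know that 1 + 1 = 0.
  private
    𝔽₂ : RawRing _ _
    𝔽₂ = record { Carrier = Bool ; _≈_ = _≡_ ; _+_ = _xor_ ; _*_ = _∧_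
                ; -_ = id ; 0# = false ; 1# = true }

    open import Algebra.Properties.Ring ring using (-0#≈0#)
    open import Algebra.Properties.AbelianGroup +-abelianGroup using (inverseʳ-unique)

    ⟦_⟧ : Bool → Carrier
    ⟦ x ⟧ = if x then 1# else 0#

    morphism : 𝔽₂ -Raw-AlmostCommutative⟶ fromCommutativeRing commutativeRing
    morphism = record
      { ⟦_⟧    = ⟦_⟧
      ; +-homo = λ { true true → sym 1+1≈0 ; true false → sym (+-identityʳ 1#)
                   ; false y → sym (+-identityˡ ⟦ y ⟧) }
      ; *-homo = λ { true y → sym (*-identityˡ ⟦ y ⟧) ; false y → sym (zeroˡ ⟦ y ⟧) }
      ; -‿homo = λ { true → inverseʳ-unique 1# 1# 1+1≈0 ; false → sym -0#≈0# }
      ; 0-homo = refl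
      ; 1-homo = refl
      }

    ⟦⟧-≟ : ∀ x y → Maybe (⟦ x ⟧ ≈ ⟦ y ⟧)
    ⟦⟧-≟ x y = Maybe.map (λ { ≡.refl → refl }) (dec⇒maybe (x Bool.≟ y))

  open RingSolver 𝔽₂ (fromCommutativeRing commutativeRing) morphism ⟦⟧-≟
    public using (solve; _:=_; _:+_; _:*_; con; Polynomial)

  :0 :1 : ∀ {n} → Polynomial n
  :0 = con false
  :1 = con true

-- Characteristic 2 algebra, field endomorphisms, roots of polynomials.

module Char2Field {c₀ ℓ} (K : DiscreteChar2Field c₀ ℓ) where

  open DiscreteChar2Field K
  open Char2Solver K
  open import Relation.Binary.Reasoning.Setoid setoid

  x+x≈0 : ∀ x → x + x ≈ 0#
  x+x≈0 = solve 1 (λ x → x :+ x := :0) refl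

  +≈0⇒≈ : ∀ {x y} → x + y ≈ 0# → x ≈ y
  +≈0⇒≈ {x} {y} h = begin
    x           ≈⟨ solve 2 (λ x y → x := x :+ y :+ y) refl x y ⟩
    x + y + y   ≈⟨ +-congʳ h ⟩
    0# + y      ≈⟨ +-identityˡ y ⟩
    y           ∎

  ≈⇒+≈0 : ∀ {x y} → x ≈ y → x + y ≈ 0#
  ≈⇒+≈0 {x} {y} h = trans (+-congʳ h) (x+x≈0 y)

  private
    term≈0 : ∀ k {l r} → l ≈ r → k * (l + r) ≈ 0#
    term≈0 k h = trans (*-congˡ (≈⇒+≈0 h)) (zeroʳ k)

  -- An equation follows from others when the sum of its two sides is a
  -- combination of the sums of theirs.
  combine₁ : ∀ {x y} k {l r} → l ≈ r → x + y ≈ k * (l + r) → x ≈ y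
  combine₁ k h eq = +≈0⇒≈ (trans eq (term≈0 k h))

  combine₂ : ∀ {x y} k₁ {l₁ r₁} → l₁ ≈ r₁ → ∀ k₂ {l₂ r₂} → l₂ ≈ r₂ →
             x + y ≈ k₁ * (l₁ + r₁) + k₂ * (l₂ + r₂) → x ≈ y
  combine₂ k₁ h₁ k₂ h₂ eq = +≈0⇒≈ (trans eq
    (trans (+-cong (term≈0 k₁ h₁) (term≈0 k₂ h₂)) (+-identityˡ 0#)))

  combine₃ : ∀ {x y} k₁ {l₁ r₁} → l₁ ≈ r₁ → ∀ k₂ {l₂ r₂} → l₂ ≈ r₂ →
             ∀ k₃ {l₃ r₃} → l₃ ≈ r₃ →
             x + y ≈ k₁ * (l₁ + r₁) + k₂ * (l₂ + r₂) + k₃ * (l₃ + r₃) → x ≈ y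
  combine₃ k₁ h₁ k₂ h₂ k₃ h₃ eq = +≈0⇒≈ (trans eq
    (trans (+-cong (trans (+-cong (term≈0 k₁ h₁) (term≈0 k₂ h₂)) (+-identityˡ 0#))
                   (term≈0 k₃ h₃)) (+-identityˡ 0#)))

  x*y≈0⇒y≈0 : ∀ {x y} → ¬ x ≈ 0# → x * y ≈ 0# → y ≈ 0#
  x*y≈0⇒y≈0 {x} {y} x≉0 xy≈0 with x⁻¹ , xx⁻¹≈1 ← inverse x≉0 = combine₂
    y xx⁻¹≈1 x⁻¹ xy≈0
    (solve 3 (λ x y z → y :+ :0 := y :* (x :* z :+ :1) :+ z :* (x :* y :+ :0)) refl x y x⁻¹)

  *-≉0 : ∀ {x y} → ¬ x ≈ 0# → ¬ y ≈ 0# → ¬ x * y ≈ 0#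
  *-≉0 x≉0 y≉0 xy≈0 = y≉0 (x*y≈0⇒y≈0 x≉0 xy≈0)

  *-≉0ˡ : ∀ {x y} → ¬ x * y ≈ 0# → ¬ x ≈ 0#
  *-≉0ˡ {y = y} xy≉0 x≈0 = xy≉0 (trans (*-congʳ x≈0) (zeroˡ y))

  ≉0-resp : ∀ {x y} → x ≈ y → ¬ x ≈ 0# → ¬ y ≈ 0#
  ≉0-resp x≈y x≉0 y≈0 = x≉0 (trans x≈y y≈0)

  *-cancelˡ : ∀ {x y z} → ¬ x ≈ 0# → x * y ≈ x * z → y ≈ z
  *-cancelˡ {x} {y} {z} x≉0 h = +≈0⇒≈ (x*y≈0⇒y≈0 x≉0 (trans (distribˡ x y z) (≈⇒+≈0 h)))

  ≈0⊎≈0 : ∀ {x y} → x * y ≈ 0# → x ≈ 0# ⊎ y ≈ 0#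
  ≈0⊎≈0 {x} h with x ≟ 0#
  ... | yes x≈0 = inj₁ x≈0
  ... | no  x≉0 = inj₂ (x*y≈0⇒y≈0 x≉0 h)

  x²≈0⇒x≈0 : ∀ {x} → x * x ≈ 0# → x ≈ 0#
  x²≈0⇒x≈0 {x} h with x ≟ 0#
  ... | yes x≈0 = x≈0
  ... | no  x≉0 = x*y≈0⇒y≈0 x≉0 h

  x²≈1⇒x≈1 : ∀ {x} → x * x ≈ 1# → x ≈ 1#
  x²≈1⇒x≈1 {x} h = +≈0⇒≈ (x²≈0⇒x≈0 (trans
    (solve 1 (λ x → (x :+ :1) :* (x :+ :1) := x :* x :+ :1) refl x) (≈⇒+≈0 h)))

  x²+x≈0⇒x∈𝔽₂ : ∀ {x} → x * x + x ≈ 0# → ¬ x ≈ 1# → x ≈ 0#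
  x²+x≈0⇒x∈𝔽₂ {x} h x≉1 = x*y≈0⇒y≈0 (x≉1 ∘ +≈0⇒≈)
    (trans (solve 1 (λ x → (x :+ :1) :* x := x :* x :+ x) refl x) h)

  -- Abstracts the power maps x ↦ x^(2^i). Preservation of 0 follows from additivity because 0 = 0 +
  -- 0 and any y + y vanishes; injectivity follows because images of units are units.
  record Endomorphism : Set (c₀ ⊔ ℓ) where
    field
      ⟦_⟧    : Carrier → Carrier
      cong   : ∀ {x y} → x ≈ y → ⟦ x ⟧ ≈ ⟦ y ⟧
      +-homo : ∀ x y → ⟦ x + y ⟧ ≈ ⟦ x ⟧ + ⟦ y ⟧
      *-homo : ∀ x y → ⟦ x * y ⟧ ≈ ⟦ x ⟧ * ⟦ y ⟧
      1-homo : ⟦ 1# ⟧ ≈ 1#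

    0-homo : ⟦ 0# ⟧ ≈ 0#
    0-homo = trans (cong (sym (x+x≈0 0#))) (trans (+-homo 0# 0#) (x+x≈0 _))

    ≉0 : ∀ {x} → ¬ x ≈ 0# → ¬ ⟦ x ⟧ ≈ 0#
    ≉0 {x} x≉0 with x⁻¹ , xx⁻¹≈1 ← inverse x≉0 = *-≉0ˡ
      (≉0-resp (trans (sym 1-homo) (trans (cong (sym xx⁻¹≈1)) (*-homo x x⁻¹))) 1≉0)

    ≈0 : ∀ {x} → ⟦ x ⟧ ≈ 0# → x ≈ 0#
    ≈0 {x} h with x ≟ 0#
    ... | yes x≈0 = x≈0
    ... | no  x≉0 = contradiction h (≉0 x≉0)

    injective : ∀ {x y} → ⟦ x ⟧ ≈ ⟦ y ⟧ → x ≈ y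
    injective {x} {y} h = +≈0⇒≈ (≈0 (trans (+-homo x y) (≈⇒+≈0 h)))

  Involutive : Endomorphism → Set (c₀ ⊔ ℓ)
  Involutive f = ∀ x → ⟦ ⟦ x ⟧ ⟧ ≈ x
    where open Endomorphism f

  Commute : Endomorphism → Endomorphism → Set (c₀ ⊔ ℓ)
  Commute f g = ∀ x → f.⟦ g.⟦ x ⟧ ⟧ ≈ g.⟦ f.⟦ x ⟧ ⟧
    where
    module f = Endomorphism f
    module g = Endomorphism g

  -- A vector of length d stands for the monic polynomial of degree d with
  -- these lower coefficients, constant coefficient first.
  eval : ∀ {d} → Vec Carrier d → Carrier → Carrier
  eval []      x = 1#
  eval (a ∷ p) x = a + x * eval p x

  add-multiple : ∀ {d} → Vec Carrier (suc d) → Carrier → Vec Carrier d → Vec Carrier (suc d)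
  add-multiple (a ∷ [])     y []      = a + y ∷ []
  add-multiple (a ∷ a′ ∷ p) y (b ∷ q) = a + y * b ∷ add-multiple (a′ ∷ p) y q

  -- Synthetic division by X + y. For p = a + X p′ one has X p′ = (X + y) p′ + y p′, so the quotient
  -- of p is p′ plus y times the quotient of p′.
  quotient-by : ∀ {d} → Vec Carrier (suc d) → Carrier → Vec Carrier d
  quotient-by (a ∷ [])     y = []
  quotient-by (a ∷ a′ ∷ p) y = add-multiple (a′ ∷ p) y (quotient-by (a′ ∷ p) y)

  eval-add-multiple : ∀ {d} (p : Vec Carrier (suc d)) y q x →
    eval (add-multiple p y q) x ≈ eval p x + y * eval q x
  eval-add-multiple (a ∷ []) y [] x =
    solve 3 (λ a x y → a :+ y :+ x :* :1 := a :+ x :* :1 :+ y :* :1) refl a x y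
  eval-add-multiple (a ∷ a′ ∷ p) y (b ∷ q) x = trans (+-congˡ (*-congˡ (eval-add-multiple (a′ ∷ p) y q x)))
    (solve 6 (λ a b x y u v → a :+ y :* b :+ x :* (u :+ y :* v) := a :+ x :* u :+ y :* (b :+ x :* v))
      refl a b x y (eval (a′ ∷ p) x) (eval q x))

  eval-quotient-by : ∀ {d} (p : Vec Carrier (suc d)) y x →
    eval p x ≈ (x + y) * eval (quotient-by p y) x + eval p y
  eval-quotient-by (a ∷ []) y x =
    solve 3 (λ a x y → a :+ x :* :1 := (x :+ y) :* :1 :+ (a :+ y :* :1)) refl a x y
  eval-quotient-by (a ∷ a′ ∷ p) y x = begin
    a + x * u                                  ≈⟨ solve 4 (λ a x y u → a :+ x :* u := (x :+ y) :* u :+ (a :+ y :* u)) refl a x y u ⟩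
    (x + y) * u + (a + y * u)                  ≈⟨ +-congˡ (+-congˡ (*-congˡ (eval-quotient-by (a′ ∷ p) y x))) ⟩
    (x + y) * u + (a + y * ((x + y) * v + w))
      ≈⟨ solve 6 (λ a x y u v w → (x :+ y) :* u :+ (a :+ y :* ((x :+ y) :* v :+ w)) :=
                   (x :+ y) :* (u :+ y :* v) :+ (a :+ y :* w)) refl a x y u v w ⟩
    (x + y) * (u + y * v) + (a + y * w)        ≈⟨ +-congʳ (*-congˡ (eval-add-multiple (a′ ∷ p) y (quotient-by (a′ ∷ p) y) x)) ⟨
    (x + y) * eval (quotient-by (a ∷ a′ ∷ p) y) x + (a + y * w) ∎
    where
    u = eval (a′ ∷ p) x
    v = eval (quotient-by (a′ ∷ p) y) x
    w = eval (a′ ∷ p) y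

  -- Dividing by the linear factor of `r zero` keeps the other roots and lowers the degree; in
  -- degree 0 the monic polynomial is the constant 1.
  too-many-roots : ∀ {d} (p : Vec Carrier d) (r : Fin (suc d) → Carrier) →
    (∀ {i i′} → r i ≈ r i′ → i ≡ i′) → ¬ (∀ i → eval p (r i) ≈ 0#)
  too-many-roots []      r r-inj roots = 1≉0 (roots zero)
  too-many-roots (a ∷ p) r r-inj roots = too-many-roots (quotient-by (a ∷ p) (r zero)) (r ∘ suc)
    (Fin.suc-injective ∘ r-inj)
    (λ i → x*y≈0⇒y≈0 (λ h → Fin.0≢1+n (≡.sym (r-inj (+≈0⇒≈ h)))) (begin
      (r (suc i) + r zero) * v i                                     ≈⟨ +-identityʳ _ ⟨
      (r (suc i) + r zero) * v i + 0#                                ≈⟨ +-congˡ (roots zero) ⟨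
      (r (suc i) + r zero) * v i + eval (a ∷ p) (r zero)             ≈⟨ eval-quotient-by (a ∷ p) (r zero) (r (suc i)) ⟨
      eval (a ∷ p) (r (suc i))                                       ≈⟨ roots (suc i) ⟩
      0#                                                             ∎))
    where
    v : Fin _ → Carrier
    v i = eval (quotient-by (a ∷ p) (r zero)) (r (suc i))

-- The unit circle of norm-1 elements and its Möbius maps.

module UnitCircle {c₀ ℓ} (K : DiscreteChar2Field c₀ ℓ) (conj frob : Char2Field.Endomorphism K)
  (σσ : Char2Field.Involutive K conj) (σφ : Char2Field.Commute K conj frob) where

  open DiscreteChar2Field K
  open Char2Solver K
  open Char2Field K
  open import Relation.Binary.Reasoning.Setoid setoid

  private
    module σ = Endomorphism conj
    module φ = Endomorphism frob

  open σ using () renaming (⟦_⟧ to σ)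
  open φ using () renaming (⟦_⟧ to φ)

  -- In the application σ x = x^q and φ x = x^Q, so this is the group μ of
  -- (q + 1)-th roots of unity.
  Norm1 : Carrier → Set ℓ
  Norm1 x = x * σ x ≈ 1#

  Norm1⇒≉0 : ∀ {x} → Norm1 x → ¬ x ≈ 0#
  Norm1⇒≉0 h = *-≉0ˡ (≉0-resp (sym h) 1≉0)

  Norm1-σ : ∀ {x} → Norm1 x → Norm1 (σ x)
  Norm1-σ {x} h = trans (*-congˡ (σσ x)) (trans (*-comm _ _) h)

  Norm1-* : ∀ {x y} → Norm1 x → Norm1 y → Norm1 (x * y)
  Norm1-* {x} {y} h₁ h₂ = trans (*-congˡ (σ.*-homo x y)) (combine₂ (y * σ y) h₁ 1# h₂
    (solve 4 (λ x x̄ y ȳ → x :* y :* (x̄ :* ȳ) :+ :1 :=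
       y :* ȳ :* (x :* x̄ :+ :1) :+ :1 :* (y :* ȳ :+ :1)) refl x (σ x) y (σ y)))

  Norm1-1 : Norm1 1#
  Norm1-1 = trans (*-identityˡ _) σ.1-homo

  Norm1-φ : ∀ {x} → Norm1 x → Norm1 (φ x)
  Norm1-φ {x} h = begin
    φ x * σ (φ x)  ≈⟨ *-congˡ (σφ x) ⟩
    φ x * φ (σ x)  ≈⟨ φ.*-homo _ _ ⟨
    φ (x * σ x)    ≈⟨ φ.cong h ⟩
    φ 1#           ≈⟨ φ.1-homo ⟩
    1#             ∎

  Norm1-φ⁻¹ : ∀ {x} → Norm1 (φ x) → Norm1 x
  Norm1-φ⁻¹ {x} h = φ.injective (begin
    φ (x * σ x)    ≈⟨ φ.*-homo _ _ ⟩
    φ x * φ (σ x)  ≈⟨ *-congˡ (σφ x) ⟨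
    φ x * σ (φ x)  ≈⟨ h ⟩
    1#             ≈⟨ φ.1-homo ⟨
    φ 1#           ∎)

  σ-1+xy : ∀ x y → σ (1# + x * y) ≈ 1# + σ x * σ y
  σ-1+xy x y = trans (σ.+-homo _ _) (+-cong σ.1-homo (σ.*-homo _ _))

  φ-1+xy : ∀ x y → φ (1# + x * y) ≈ 1# + φ x * φ y
  φ-1+xy x y = trans (φ.+-homo _ _) (+-cong φ.1-homo (φ.*-homo _ _))

  -- X ↦ x = (X + z) / (1 + z̄ X) maps the unit circle to itself.
  module Möbius {z} (z∉μ : ¬ Norm1 z) {X} (X∈μ : Norm1 X) where
    H : Carrier
    H = 1# + σ z * X

    private
      σ[z̄]X̄ : σ (σ z * X) ≈ z * σ X
      σ[z̄]X̄ = trans (σ.*-homo _ _) (*-congʳ (σσ z))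

    H≉0 : ¬ H ≈ 0#
    H≉0 h = z∉μ (combine₂ 1# z̄X∈μ (z * σ z) X∈μ
      (solve 4 (λ z z̄ X X̄ → z :* z̄ :+ :1 := :1 :* (z̄ :* X :* (z :* X̄) :+ :1) :+ z :* z̄ :* (X :* X̄ :+ :1))
       refl z (σ z) X (σ X)))
      where
      z̄X≈1 : σ z * X ≈ 1#
      z̄X≈1 = sym (+≈0⇒≈ h)
      z̄X∈μ : σ z * X * (z * σ X) ≈ 1#
      z̄X∈μ = trans (*-cong z̄X≈1 (trans (sym σ[z̄]X̄) (trans (σ.cong z̄X≈1) σ.1-homo))) (*-identityˡ 1#)

    x : Carrier
    x = (X + z) * proj₁ (inverse H≉0)

    xH≈X+z : x * H ≈ X + z
    xH≈X+z = combine₁ (X + z) (proj₂ (inverse H≉0))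
      (solve 3 (λ a i h → a :* i :* h :+ a := a :* (h :* i :+ :1)) refl (X + z) (proj₁ (inverse H≉0)) H)

    -- The norms of X + z and 1 + z̄ X differ by (1 + z z̄)(X X̄ + 1), which vanishes on the circle.
    x∈μ : Norm1 x
    x∈μ = *-cancelˡ (*-≉0 H≉0 (σ.≉0 H≉0)) (begin
      H * σ H * (x * σ x)        ≈⟨ solve 4 (λ h h̄ x x̄ → h :* h̄ :* (x :* x̄) := x :* h :* (x̄ :* h̄)) refl H (σ H) x (σ x) ⟩
      x * H * (σ x * σ H)        ≈⟨ *-cong xH≈X+z (trans (sym (σ.*-homo _ _)) (trans (σ.cong xH≈X+z) (σ.+-homo _ _))) ⟩
      (X + z) * (σ X + σ z)      ≈⟨ combine₁ (1# + z * σ z) X∈μ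
        (solve 4 (λ z z̄ X X̄ → (X :+ z) :* (X̄ :+ z̄) :+ (:1 :+ z̄ :* X) :* (:1 :+ z :* X̄) :=
           (:1 :+ z :* z̄) :* (X :* X̄ :+ :1)) refl z (σ z) X (σ X)) ⟩
      H * (1# + z * σ X)         ≈⟨ *-congˡ (trans (σ.+-homo _ _) (+-cong σ.1-homo σ[z̄]X̄)) ⟨
      H * σ H                    ≈⟨ *-identityʳ _ ⟨
      H * σ H * 1#               ∎)

  -- Cross-multiplied form of the claim that X^Q (A X + C) / (C̄ X + Ā) is not injective on the
  -- circle. It is a parameter of the algebraic part, since its proof sums over a finite field.
  PowerSumObstruction : Set (c₀ ⊔ ℓ)
  PowerSumObstruction = ∀ {A C} → ¬ A ≈ 0# → ¬ C ≈ 0# → ¬ A * σ A ≈ C * σ C →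
    ¬ (∀ {X Y} → Norm1 X → Norm1 Y →
       φ X * (A * X + C) * (σ C * Y + σ A) ≈ φ Y * (A * Y + C) * (σ C * X + σ A) → X ≈ Y)

-- The fraction N / D, its fibres and its ramification points.

module Trinomial {c₀ ℓ} (K : DiscreteChar2Field c₀ ℓ) (conj frob : Char2Field.Endomorphism K)
  (σσ : Char2Field.Involutive K conj) (σφ : Char2Field.Commute K conj frob)
  (b c : DiscreteChar2Field.Carrier K) where

  open DiscreteChar2Field K
  open Char2Solver K
  open Char2Field K
  open UnitCircle K conj frob σσ σφ
  open import Relation.Binary.Reasoning.Setoid setoid

  private
    module σ = Endomorphism conj
    module φ = Endomorphism frob

  open σ using () renaming (⟦_⟧ to σ)
  open φ using () renaming (⟦_⟧ to φ)

  e : Carrier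
  e = 1# + b * σ b + c * σ c

  D N : Carrier → Carrier
  D x = 1# + b * φ x + c * x
  N x = x * φ x + σ b * x + σ c * φ x

  -- The derivative of N / D vanishes at x exactly when φ x is a root.
  Root : Carrier → Set ℓ
  Root t = b * (t * t) + e * t + σ b ≈ 0#

  σ-e : σ e ≈ e
  σ-e = begin
    σ (1# + b * σ b + c * σ c)                ≈⟨ σ.+-homo _ _ ⟩
    σ (1# + b * σ b) + σ (c * σ c)            ≈⟨ +-cong (σ.+-homo _ _) (σ.*-homo _ _) ⟩
    σ 1# + σ (b * σ b) + σ c * σ (σ c)        ≈⟨ +-cong (+-cong σ.1-homo (σ.*-homo _ _)) (*-congˡ (σσ c)) ⟩
    1# + σ b * σ (σ b) + σ c * c              ≈⟨ +-cong (+-congˡ (trans (*-congˡ (σσ b)) (*-comm _ _))) (*-comm _ _) ⟩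
    1# + b * σ b + c * σ c                    ∎

  σD : ∀ x → σ (D x) ≈ 1# + σ b * φ (σ x) + σ c * σ x
  σD x = trans (σ.+-homo _ _) (+-cong (trans (σ-1+xy _ _) (+-congˡ (*-congˡ (σφ x)))) (σ.*-homo _ _))

  N≈xφxσD : ∀ {x} → Norm1 x → N x ≈ x * φ x * σ (D x)
  N≈xφxσD {x} h = trans (combine₂ (σ c * φ x) (sym h) (σ b * x) (trans (sym φ.1-homo) (trans (φ.cong (sym h)) (φ.*-homo _ _)))
    (solve 6 (λ x x̄ X X̄ b̄ c̄ → x :* X :+ b̄ :* x :+ c̄ :* X :+ x :* X :* (:1 :+ b̄ :* X̄ :+ c̄ :* x̄)
       := c̄ :* X :* (:1 :+ x :* x̄) :+ b̄ :* x :* (:1 :+ X :* X̄))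
      refl x (σ x) (φ x) (φ (σ x)) (σ b) (σ c)))
    (*-congˡ (sym (σD x)))

  -- Comparing coefficients, N + l D = (φ x + t)(x + y) with l = t y amounts to y = c̄ + l b and t =
  -- b̄ + l c. The first equation is y (1 + b t) = c̄; given it, the second is the root equation for
  -- t.
  module Factorisation {t y} (root : Root t) (1+bt≉0 : ¬ 1# + b * t ≈ 0#)
                       (y[1+bt]≈c̄ : y * (1# + b * t) ≈ σ c) where

    y≈c̄+tyb : y ≈ σ c + t * y * b
    y≈c̄+tyb = combine₁ 1# y[1+bt]≈c̄ (solve 4 (λ b c̄ t y →
      y :+ (c̄ :+ t :* y :* b) := :1 :* (y :* (:1 :+ b :* t) :+ c̄)) refl b (σ c) t y)

    tyc+b̄≈t : t * y * c + σ b ≈ t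
    tyc+b̄≈t = *-cancelˡ 1+bt≉0 (combine₂ (t * c) y[1+bt]≈c̄ 1# root
      (solve 6 (λ b b̄ c c̄ t y → (:1 :+ b :* t) :* (t :* y :* c :+ b̄) :+ (:1 :+ b :* t) :* t :=
         t :* c :* (y :* (:1 :+ b :* t) :+ c̄) :+
         :1 :* (b :* (t :* t) :+ (:1 :+ b :* b̄ :+ c :* c̄) :* t :+ b̄ :+ :0))
        refl b (σ b) c (σ c) t y))

    factor : ∀ x → N x + t * y * D x ≈ (φ x + t) * (x + y)
    factor x = combine₂ x tyc+b̄≈t (φ x) y≈c̄+tyb
      (solve 8 (λ b b̄ c c̄ t y x X →
        x :* X :+ b̄ :* x :+ c̄ :* X :+ t :* y :* (:1 :+ b :* X :+ c :* x) :+ (X :+ t) :* (x :+ y)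
        := x :* (t :* y :* c :+ b̄ :+ t) :+ X :* (y :+ (c̄ :+ t :* y :* b)))
        refl b (σ b) c (σ c) t y x (φ x))

    -- Divides t y c + b̄ = t by t after eliminating b̄ with the root equation. Unlike y (1 + b t) =
    -- c̄, this equation for y contains no conjugate, so `φ` of it involves only φ b, φ c, φ t and φ
    -- e.
    yc≈1+bt+e : ¬ t ≈ 0# → y * c ≈ 1# + b * t + e
    yc≈1+bt+e t≉0 = *-cancelˡ t≉0 (combine₂ 1# tyc+b̄≈t 1# root
      (solve 6 (λ b b̄ c t y e → t :* (y :* c) :+ t :* (:1 :+ b :* t :+ e) :=
        :1 :* (t :* y :* c :+ b̄ :+ t) :+ :1 :* (b :* (t :* t) :+ e :* t :+ b̄ :+ :0))
        refl b (σ b) c t y e))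

  -- Injectivity of N / D on the circle in cross-multiplied form. On the circle a zero of D is also
  -- a zero of N, so `D≉0` rules out the indeterminate value 0 / 0.
  record Injective-μ : Set (c₀ ⊔ ℓ) where
    field
      D≉0       : ∀ {x} → Norm1 x → ¬ D x ≈ 0#
      injective : ∀ {x y} → Norm1 x → Norm1 y → N x * D y ≈ N y * D x → x ≈ y

    collision : ∀ {x y} l → Norm1 x → Norm1 y →
                N x + l * D x ≈ 0# → N y + l * D y ≈ 0# → x ≈ y
    collision {x} {y} l x∈μ y∈μ hx hy = injective x∈μ y∈μ (combine₂ (D y) hx (D x) hy
      (solve 5 (λ nx dx ny dy l → nx :* dy :+ ny :* dx :=
         dy :* (nx :+ l :* dx :+ :0) :+ dx :* (ny :+ l :* dy :+ :0)) refl (N x) (D x) (N y) (D y) l))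

  -- With b t = 1 the root equation collapses to c c̄ t = 0.
  1+bt≈0⇒c≈0 : ∀ {t} → ¬ t ≈ 0# → Root t → 1# + b * t ≈ 0# → c ≈ 0#
  1+bt≈0⇒c≈0 {t} t≉0 root h with c ≟ 0#
  ... | yes c≈0 = c≈0
  ... | no  c≉0 = contradiction
    (x*y≈0⇒y≈0 t≉0 (combine₂ 1# root (t + σ b) h
      (solve 5 (λ b b̄ c c̄ t → t :* (c :* c̄) :+ :0 :=
         :1 :* (b :* (t :* t) :+ (:1 :+ b :* b̄ :+ c :* c̄) :* t :+ b̄ :+ :0) :+
         (t :+ b̄) :* (:1 :+ b :* t :+ :0)) refl b (σ b) c (σ c) t)))
    (*-≉0 c≉0 (σ.≉0 c≉0))

  bt≈e+b̄t̄ : ∀ {t} → Norm1 t → Root t → b * t ≈ e + σ b * σ t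
  bt≈e+b̄t̄ {t} h root = combine₂ (σ t) root (b * t + e) h
    (solve 5 (λ b b̄ e t t̄ → b :* t :+ (e :+ b̄ :* t̄) :=
       t̄ :* (b :* (t :* t) :+ e :* t :+ b̄ :+ :0) :+ (b :* t :+ e) :* (t :* t̄ :+ :1))
     refl b (σ b) e t (σ t))

  -- A ramification point x of N / D on the unit circle would share its value
  -- with a second point y of the unit circle, so y has to be x itself.
  module Ramified (inj : Injective-μ) {t x} (t∈μ : Norm1 t) (root : Root t) (φx≈t : φ x ≈ t) where
    open Injective-μ inj

    x∈μ : Norm1 x
    x∈μ = Norm1-φ⁻¹ (trans (*-cong φx≈t (σ.cong φx≈t)) t∈μ)

    1+bt≉0 : ¬ 1# + b * t ≈ 0#
    1+bt≉0 h = D≉0 x∈μ (begin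
      1# + b * φ x + c * x  ≈⟨ +-cong (+-congˡ (*-congˡ φx≈t)) (*-congʳ (1+bt≈0⇒c≈0 (Norm1⇒≉0 t∈μ) root h)) ⟩
      1# + b * t + 0# * x   ≈⟨ +-cong h (zeroˡ x) ⟩
      0# + 0#               ≈⟨ +-identityˡ 0# ⟩
      0#                    ∎)

    x[1+bt]≈c̄ : x * (1# + b * t) ≈ σ c
    x[1+bt]≈c̄ with i , hi ← inverse 1+bt≉0 = trans (*-congʳ x≈y) y[1+bt]≈c̄
      where
      y = σ c * i
      y[1+bt]≈c̄ : y * (1# + b * t) ≈ σ c
      y[1+bt]≈c̄ = combine₁ (σ c) hi (solve 3 (λ c̄ i z → c̄ :* i :* z :+ c̄ := c̄ :* (z :* i :+ :1))
        refl (σ c) i (1# + b * t))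
      open Factorisation {t} {y} root 1+bt≉0 y[1+bt]≈c̄
      ȳ[1+b̄t̄]≈c : σ y * (1# + σ b * σ t) ≈ c
      ȳ[1+b̄t̄]≈c = begin
        σ y * (1# + σ b * σ t)  ≈⟨ *-congˡ (σ-1+xy b t) ⟨
        σ y * σ (1# + b * t)    ≈⟨ σ.*-homo _ _ ⟨
        σ (y * (1# + b * t))    ≈⟨ σ.cong y[1+bt]≈c̄ ⟩
        σ (σ c)                 ≈⟨ σσ c ⟩
        c                       ∎
      1+b̄t̄≉0 : ¬ 1# + σ b * σ t ≈ 0#
      1+b̄t̄≉0 = ≉0-resp (σ-1+xy b t) (σ.≉0 1+bt≉0)
      y∈μ : Norm1 y
      -- Inserting c = ȳ (1 + b̄ t̄) and b̄ = b̄ t t̄ into t y c + b̄ = t leaves t (1 + b̄ t̄) y ȳ =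
      -- t (1 + b̄ t̄).
      y∈μ = *-cancelˡ 1+b̄t̄≉0 (*-cancelˡ (Norm1⇒≉0 t∈μ) (combine₃
        (t * y) ȳ[1+b̄t̄]≈c 1# tyc+b̄≈t (σ b) t∈μ
        (solve 6 (λ b̄ c t t̄ y ȳ →
           t :* ((:1 :+ b̄ :* t̄) :* (y :* ȳ)) :+ t :* ((:1 :+ b̄ :* t̄) :* :1) :=
           t :* y :* (ȳ :* (:1 :+ b̄ :* t̄) :+ c) :+ :1 :* (t :* y :* c :+ b̄ :+ t) :+ b̄ :* (t :* t̄ :+ :1))
          refl (σ b) c t (σ t) y (σ y))))
      x≈y : x ≈ y
      x≈y = collision (t * y) x∈μ y∈μ
        (trans (factor x) (trans (*-congʳ (≈⇒+≈0 φx≈t)) (zeroˡ _)))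
        (trans (factor y) (trans (*-congˡ (x+x≈0 y)) (zeroʳ _)))

    x̄[1+b̄t̄]≈c : σ x * (1# + σ b * σ t) ≈ c
    x̄[1+b̄t̄]≈c = begin
      σ x * (1# + σ b * σ t)  ≈⟨ *-congˡ (σ-1+xy b t) ⟨
      σ x * σ (1# + b * t)    ≈⟨ σ.*-homo _ _ ⟨
      σ (x * (1# + b * t))    ≈⟨ σ.cong x[1+bt]≈c̄ ⟩
      σ (σ c)                 ≈⟨ σσ c ⟩
      c                       ∎

    -- Here c x = x x̄ (1 + b̄ t̄) = 1 + b̄ t̄, so D x = b t + b̄ t̄ = e. Thus e = 0 would make D
    -- vanish on the circle.
    Dx≈e : D x ≈ e
    Dx≈e = trans (+-congʳ (+-congˡ (*-congˡ φx≈t))) (combine₃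
      x x̄[1+b̄t̄]≈c 1# (bt≈e+b̄t̄ t∈μ root) (1# + σ b * σ t) x∈μ
      (solve 8 (λ b b̄ c t t̄ x x̄ e → :1 :+ b :* t :+ c :* x :+ e :=
         x :* (x̄ :* (:1 :+ b̄ :* t̄) :+ c) :+ :1 :* (b :* t :+ (e :+ b̄ :* t̄)) :+ (:1 :+ b̄ :* t̄) :* (x :* x̄ :+ :1))
        refl b (σ b) c t (σ t) x (σ x) e))

    -- Apply `φ` to c = x̄ (1 + b̄ t̄), using φ x̄ = t̄ and b̄ t̄ = b t + e, then multiply by t. Two
    -- roots give two such relations for the same φ c.
    tφc≈1+φbφt+φe : t * φ c ≈ 1# + φ b * φ t + φ e
    tφc≈1+φbφt+φe = combine₃ t φc-eq (1# + φ (σ b) * φ (σ t)) t∈μ 1# φ-eq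
      (solve 8 (λ t t̄ C B̄ T̄ B T E → t :* C :+ (:1 :+ B :* T :+ E) :=
        t :* (C :+ t̄ :* (:1 :+ B̄ :* T̄)) :+ (:1 :+ B̄ :* T̄) :* (t :* t̄ :+ :1) :+ :1 :* (B :* T :+ (E :+ B̄ :* T̄)))
        refl t (σ t) (φ c) (φ (σ b)) (φ (σ t)) (φ b) (φ t) (φ e))
      where
      φc-eq : φ c ≈ σ t * (1# + φ (σ b) * φ (σ t))
      φc-eq = begin
        φ c                                   ≈⟨ φ.cong x̄[1+b̄t̄]≈c ⟨
        φ (σ x * (1# + σ b * σ t))            ≈⟨ φ.*-homo _ _ ⟩
        φ (σ x) * φ (1# + σ b * σ t)          ≈⟨ *-cong (trans (sym (σφ x)) (σ.cong φx≈t)) (φ-1+xy _ _) ⟩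
        σ t * (1# + φ (σ b) * φ (σ t))        ∎
      φ-eq : φ b * φ t ≈ φ e + φ (σ b) * φ (σ t)
      φ-eq = begin
        φ b * φ t                    ≈⟨ φ.*-homo _ _ ⟨
        φ (b * t)                    ≈⟨ φ.cong (bt≈e+b̄t̄ t∈μ root) ⟩
        φ (e + σ b * σ t)            ≈⟨ trans (φ.+-homo _ _) (+-congˡ (φ.*-homo _ _)) ⟩
        φ e + φ (σ b) * φ (σ t)      ∎

  -- For e = 0 the root equation is b t² = b̄, whose double root has norm 1, and D takes the value e
  -- = 0 at the ramification point over it. If b = 0 as well, every t is a root and t = 1 serves.
  injective⇒e≉0 : (∀ y → ∃[ x ] φ x ≈ y) → (∀ y → ∃[ x ] x * x ≈ y) → Injective-μ → ¬ e ≈ 0#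
  injective⇒e≉0 φ-onto sqrt inj e≈0 with b ≟ 0#
  ... | yes b≈0 = Injective-μ.D≉0 inj x∈μ (trans Dx≈e e≈0)
    where
    open Ramified inj Norm1-1 (combine₃ 1# b≈0 1# e≈0 1# (trans (σ.cong b≈0) σ.0-homo)
      (solve 3 (λ b b̄ e → b :* (:1 :* :1) :+ e :* :1 :+ b̄ :+ :0 :=
         :1 :* (b :+ :0) :+ :1 :* (e :+ :0) :+ :1 :* (b̄ :+ :0)) refl b (σ b) e))
      (proj₂ (φ-onto 1#))
  ... | no b≉0 = Injective-μ.D≉0 inj x∈μ (trans Dx≈e e≈0)
    where
    b⁻¹ = proj₁ (inverse b≉0)
    t = proj₁ (sqrt (σ b * b⁻¹))
    bt²≈b̄ : b * (t * t) ≈ σ b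
    bt²≈b̄ = combine₂ b (proj₂ (sqrt (σ b * b⁻¹))) (σ b) (proj₂ (inverse b≉0))
      (solve 4 (λ b b̄ t i → b :* (t :* t) :+ b̄ := b :* (t :* t :+ b̄ :* i) :+ b̄ :* (b :* i :+ :1)) refl b (σ b) t b⁻¹)
    t∈μ : Norm1 t
    t∈μ = x²≈1⇒x≈1 (*-cancelˡ (*-≉0 b≉0 (σ.≉0 b≉0)) (combine₂ (σ b * (σ t * σ t)) bt²≈b̄ (σ b) b̄t̄²≈b
      (solve 4 (λ b b̄ t t̄ → b :* b̄ :* (t :* t̄ :* (t :* t̄)) :+ b :* b̄ :* :1 :=
         b̄ :* (t̄ :* t̄) :* (b :* (t :* t) :+ b̄) :+ b̄ :* (b̄ :* (t̄ :* t̄) :+ b)) refl b (σ b) t (σ t))))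
      where
      b̄t̄²≈b : σ b * (σ t * σ t) ≈ b
      b̄t̄²≈b = begin
        σ b * (σ t * σ t)  ≈⟨ *-congˡ (σ.*-homo _ _) ⟨
        σ b * σ (t * t)    ≈⟨ σ.*-homo _ _ ⟨
        σ (b * (t * t))    ≈⟨ σ.cong bt²≈b̄ ⟩
        σ (σ b)            ≈⟨ σσ b ⟩
        b                  ∎
    open Ramified inj t∈μ (combine₂ 1# bt²≈b̄ t e≈0
      (solve 4 (λ b b̄ t e → b :* (t :* t) :+ e :* t :+ b̄ :+ :0 := :1 :* (b :* (t :* t) :+ b̄) :+ t :* (e :+ :0))
        refl b (σ b) t e))
      (proj₂ (φ-onto t))

  -- Condition (2), cleared of the truncated exponent Q ∸ 1.
  Balanced : Set ℓ
  Balanced = φ c * e ≈ φ e * b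

  -- Adding the relations for both roots cancels 1 + φ e and leaves (t + t′) φ c = φ b (φ t + φ t′).
  -- Multiplied by b, the sum of the roots becomes e on the left and φ e on the right.
  ramified²⇒balanced : Injective-μ → (∀ y → ∃[ x ] φ x ≈ y) → ¬ e ≈ 0# →
    ∀ {t t′} → Norm1 t → Norm1 t′ → Root t → Root t′ → b * (t + t′) ≈ e → Balanced
  ramified²⇒balanced inj φ-onto e≉0 {t} {t′} t∈μ t′∈μ root root′ bt+bt′≈e =
    begin
      φ c * e                        ≈⟨ combine₃ (φ c) (sym bt+bt′≈e) b R₁.tφc≈1+φbφt+φe b R₂.tφc≈1+φbφt+φe
        (solve 9 (λ b t t′ e C B T T′ E → C :* e :+ B :* (T :+ T′) :* b :=
           C :* (e :+ b :* (t :+ t′)) :+ b :* (t :* C :+ (:1 :+ B :* T :+ E)) :+ b :* (t′ :* C :+ (:1 :+ B :* T′ :+ E)))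
          refl b t t′ e (φ c) (φ b) (φ t) (φ t′) (φ e)) ⟩
      φ b * (φ t + φ t′) * b         ≈⟨ *-congʳ (*-congˡ (φ.+-homo _ _)) ⟨
      φ b * φ (t + t′) * b           ≈⟨ *-congʳ (φ.*-homo _ _) ⟨
      φ (b * (t + t′)) * b           ≈⟨ *-congʳ (φ.cong bt+bt′≈e) ⟩
      φ e * b                        ∎
    where
    module R₁ = Ramified inj t∈μ root (proj₂ (φ-onto t))
    module R₂ = Ramified inj t′∈μ root′ (proj₂ (φ-onto t′))

  -- In the coordinate X with x = (X + z) / (1 + z̄ X), and up to a Möbius
  -- transformation of its values, N / D is φ X (A X + C) / (C̄ X + Ā).
  module Unramified (inj : Injective-μ) {t y z} (root : Root t) (1+bt≉0 : ¬ 1# + b * t ≈ 0#)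
                    (y[1+bt]≈c̄ : y * (1# + b * t) ≈ σ c) (φz≈t : φ z ≈ t) (t∉μ : ¬ Norm1 t) where
    open Injective-μ inj
    open Factorisation root 1+bt≉0 y[1+bt]≈c̄

    l : Carrier
    l = t * y

    l̄c̄+b≈t̄ : σ t * σ y * σ c + b ≈ σ t
    l̄c̄+b≈t̄ = begin
      σ t * σ y * σ c + b        ≈⟨ +-cong (trans (σ.*-homo _ _) (*-congʳ (σ.*-homo _ _))) (σσ b) ⟨
      σ (t * y * c) + σ (σ b)    ≈⟨ σ.+-homo _ _ ⟨
      σ (t * y * c + σ b)        ≈⟨ σ.cong tyc+b̄≈t ⟩
      σ t                        ∎

    ȳ≈c+l̄b̄ : σ y ≈ c + σ t * σ y * σ b
    ȳ≈c+l̄b̄ = begin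
      σ y                        ≈⟨ σ.cong y≈c̄+tyb ⟩
      σ (σ c + t * y * b)        ≈⟨ σ.+-homo _ _ ⟩
      σ (σ c) + σ (t * y * b)    ≈⟨ +-cong (σσ c) (trans (σ.*-homo _ _) (*-congʳ (σ.*-homo _ _))) ⟩
      c + σ t * σ y * σ b        ∎

    -- The identity t t̄ + 1 = (1 + b t)(l l̄ + 1). It makes 1 + l l̄, the determinant of the change
    -- of values from N / D to (N + l D) / (D + l̄ N), invertible.
    l∉μ : ¬ l * (σ t * σ y) ≈ 1#
    l∉μ h = t∉μ (combine₃ (1# + b * t) h (σ t * σ y * t) y[1+bt]≈c̄ t l̄c̄+b≈t̄
      (solve 6 (λ b c̄ t t̄ y ȳ → t :* t̄ :+ :1 :=
         (:1 :+ b :* t) :* (t :* y :* (t̄ :* ȳ) :+ :1) :+ t̄ :* ȳ :* t :* (y :* (:1 :+ b :* t) :+ c̄)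
         :+ t :* (t̄ :* ȳ :* c̄ :+ b :+ t̄)) refl b (σ c) t (σ t) y (σ y)))

    -- The reciprocal of `factor`: on the circle it is the conjugate of that identity multiplied by
    -- x φ x, but it holds for every x.
    cofactor : ∀ x → D x + σ t * σ y * N x ≈ (1# + σ t * φ x) * (1# + σ y * x)
    cofactor x = combine₂ (φ x) l̄c̄+b≈t̄ x ȳ≈c+l̄b̄
      (solve 8 (λ b b̄ c c̄ t̄ ȳ x X → :1 :+ b :* X :+ c :* x :+ t̄ :* ȳ :* (x :* X :+ b̄ :* x :+ c̄ :* X)
         :+ (:1 :+ t̄ :* X) :* (:1 :+ ȳ :* x) :=
         X :* (t̄ :* ȳ :* c̄ :+ b :+ t̄) :+ x :* (ȳ :+ (c :+ t̄ :* ȳ :* b̄)))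
        refl b (σ b) c (σ c) (σ t) (σ y) x (φ x))

    -- If y had norm 1, the right sides of both `factor` and `cofactor` would vanish at y, whence (1
    -- + l l̄) D y = 0.
    y∉μ : ¬ Norm1 y
    y∉μ y∈μ = *-≉0 (l∉μ ∘ sym ∘ +≈0⇒≈) (D≉0 y∈μ) (combine₃
      (σ t * σ y) (factor y) 1# (cofactor y) (1# + σ t * φ y) y∈μ
      (solve 7 (λ n d t t̄ y ȳ Y → (:1 :+ t :* y :* (t̄ :* ȳ)) :* d :+ :0 :=
         t̄ :* ȳ :* (n :+ t :* y :* d :+ (Y :+ t) :* (y :+ y))
         :+ :1 :* (d :+ t̄ :* ȳ :* n :+ (:1 :+ t̄ :* Y) :* (:1 :+ ȳ :* y))
         :+ (:1 :+ t̄ :* Y) :* (y :* ȳ :+ :1)) refl (N y) (D y) t (σ t) y (σ y) (φ y)))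

    z∉μ : ¬ Norm1 z
    z∉μ z∈μ = t∉μ (trans (*-cong (sym φz≈t) (σ.cong (sym φz≈t))) (Norm1-φ z∈μ))

    -- Under x = (X + z) / (1 + z̄ X) the factor x + y becomes A X + C over 1 + z̄ X, while φ z = t
    -- turns φ x + t into (1 + t t̄) φ X over 1 + t̄ φ X.
    A C : Carrier
    A = 1# + σ z * y
    C = z + y

    σA : σ A ≈ 1# + z * σ y
    σA = trans (σ-1+xy _ _) (+-congˡ (*-congʳ (σσ z)))

    -- A Ā + C C̄ = (1 + z z̄)(1 + y ȳ), and neither z nor y has norm 1.
    AĀ≉CC̄ : ¬ A * σ A ≈ C * σ C
    AĀ≉CC̄ h = *-≉0 (z∉μ ∘ sym ∘ +≈0⇒≈) (y∉μ ∘ sym ∘ +≈0⇒≈) (combine₃ 1# h A σA C (σ.+-homo z y)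
      (solve 6 (λ z z̄ y ȳ ā c̄ → (:1 :+ z :* z̄) :* (:1 :+ y :* ȳ) :+ :0 :=
         :1 :* ((:1 :+ z̄ :* y) :* ā :+ (z :+ y) :* c̄) :+ (:1 :+ z̄ :* y) :* (ā :+ (:1 :+ z :* ȳ))
         :+ (z :+ y) :* (c̄ :+ (z̄ :+ ȳ))) refl z (σ z) y (σ y) (σ A) (σ C)))

    module _ {X} (X∈μ : Norm1 X) where
      open Möbius z∉μ X∈μ

      φxφH≈φX+t : φ x * (1# + σ t * φ X) ≈ φ X + t
      φxφH≈φX+t = begin
        φ x * (1# + σ t * φ X)   ≈⟨ *-congˡ (+-congˡ (*-congʳ (σ.cong φz≈t))) ⟨
        φ x * (1# + σ (φ z) * φ X) ≈⟨ *-congˡ (+-congˡ (*-congʳ (σφ z))) ⟩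
        φ x * (1# + φ (σ z) * φ X) ≈⟨ *-congˡ (φ-1+xy _ _) ⟨
        φ x * φ H                ≈⟨ φ.*-homo _ _ ⟨
        φ (x * H)                ≈⟨ φ.cong xH≈X+z ⟩
        φ (X + z)                ≈⟨ trans (φ.+-homo _ _) (+-congˡ φz≈t) ⟩
        φ X + t                  ∎

      1+t̄φX≉0 : ¬ 1# + σ t * φ X ≈ 0#
      1+t̄φX≉0 = ≉0-resp (trans (φ-1+xy _ _) (+-congˡ (*-congʳ (trans (sym (σφ z)) (σ.cong φz≈t))))) (φ.≉0 H≉0)

      numerator : (N x + l * D x) * ((1# + σ t * φ X) * H) ≈ (1# + t * σ t) * (φ X * (A * X + C))
      numerator = trans (*-congʳ (factor x)) (combine₂
        ((x + y) * H) φxφH≈φX+t (φ X * (1# + t * σ t)) xH≈X+z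
        (solve 9 (λ t t̄ z z̄ y x P X Q → (P :+ t) :* (x :+ y) :* ((:1 :+ t̄ :* Q) :* (:1 :+ z̄ :* X))
           :+ (:1 :+ t :* t̄) :* (Q :* ((:1 :+ z̄ :* y) :* X :+ (z :+ y))) :=
           (x :+ y) :* (:1 :+ z̄ :* X) :* (P :* (:1 :+ t̄ :* Q) :+ (Q :+ t))
           :+ Q :* (:1 :+ t :* t̄) :* (x :* (:1 :+ z̄ :* X) :+ (X :+ z)))
          refl t (σ t) z (σ z) y x (φ x) X (φ X)))

      denominator : (D x + σ t * σ y * N x) * ((1# + σ t * φ X) * H) ≈ (1# + t * σ t) * (σ C * X + σ A)
      denominator = trans (*-congʳ (cofactor x)) (trans (combine₂
        (σ t * (1# + σ y * x) * H) φxφH≈φX+t (σ y * (1# + t * σ t)) xH≈X+z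
        (solve 9 (λ t t̄ z z̄ ȳ x P X Q → (:1 :+ t̄ :* P) :* (:1 :+ ȳ :* x) :* ((:1 :+ t̄ :* Q) :* (:1 :+ z̄ :* X))
           :+ (:1 :+ t :* t̄) :* ((z̄ :+ ȳ) :* X :+ (:1 :+ z :* ȳ)) :=
           t̄ :* (:1 :+ ȳ :* x) :* (:1 :+ z̄ :* X) :* (P :* (:1 :+ t̄ :* Q) :+ (Q :+ t))
           :+ ȳ :* (:1 :+ t :* t̄) :* (x :* (:1 :+ z̄ :* X) :+ (X :+ z)))
          refl t (σ t) z (σ z) (σ y) x (φ x) X (φ X)))
        (*-congˡ (+-cong (*-congʳ (sym (σ.+-homo z y))) (sym σA))))

    transformed-injective : ∀ {X Y} → Norm1 X → Norm1 Y →
      φ X * (A * X + C) * (σ C * Y + σ A) ≈ φ Y * (A * Y + C) * (σ C * X + σ A) → X ≈ Y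
    transformed-injective {X} {Y} X∈μ Y∈μ h = +≈0⇒≈ (x*y≈0⇒y≈0 (z∉μ ∘ sym ∘ +≈0⇒≈) (combine₃
      MY.H (sym MX.xH≈X+z) MX.H (MY.xH≈X+z) (MX.H * MY.H) x≈y
      (solve 6 (λ z z̄ X Y x y → (:1 :+ z :* z̄) :* (X :+ Y) :+ :0 :=
         (:1 :+ z̄ :* Y) :* (X :+ z :+ x :* (:1 :+ z̄ :* X)) :+ (:1 :+ z̄ :* X) :* (y :* (:1 :+ z̄ :* Y) :+ (Y :+ z))
         :+ (:1 :+ z̄ :* X) :* (:1 :+ z̄ :* Y) :* (x :+ y)) refl z (σ z) X Y MX.x MY.x)))
      where
      module MX = Möbius z∉μ X∈μ
      module MY = Möbius z∉μ Y∈μ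
      W = (1# + σ t * φ X) * MX.H * ((1# + σ t * φ Y) * MY.H)
      k = 1# + t * σ t
      uX = N MX.x + l * D MX.x
      uY = N MY.x + l * D MY.x
      vX = D MX.x + σ t * σ y * N MX.x
      vY = D MY.x + σ t * σ y * N MY.x
      uv≈vu : uX * vY ≈ uY * vX
      uv≈vu = *-cancelˡ (*-≉0 (*-≉0 (1+t̄φX≉0 X∈μ) MX.H≉0) (*-≉0 (1+t̄φX≉0 Y∈μ) MY.H≉0)) (begin
        W * (uX * vY)
          ≈⟨ solve 4 (λ w w′ u v → w :* w′ :* (u :* v) := u :* w :* (v :* w′)) refl _ _ uX vY ⟩
        uX * ((1# + σ t * φ X) * MX.H) * (vY * ((1# + σ t * φ Y) * MY.H))
          ≈⟨ *-cong (numerator X∈μ) (denominator Y∈μ) ⟩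
        k * (φ X * (A * X + C)) * (k * (σ C * Y + σ A))
          ≈⟨ solve 3 (λ k a b → k :* a :* (k :* b) := k :* k :* (a :* b)) refl k _ _ ⟩
        k * k * (φ X * (A * X + C) * (σ C * Y + σ A))
          ≈⟨ *-congˡ h ⟩
        k * k * (φ Y * (A * Y + C) * (σ C * X + σ A))
          ≈⟨ solve 3 (λ k a b → k :* k :* (a :* b) := k :* a :* (k :* b)) refl k _ _ ⟩
        k * (φ Y * (A * Y + C)) * (k * (σ C * X + σ A))
          ≈⟨ *-cong (numerator Y∈μ) (denominator X∈μ) ⟨
        uY * ((1# + σ t * φ Y) * MY.H) * (vX * ((1# + σ t * φ X) * MX.H))
          ≈⟨ solve 4 (λ w w′ u v → u :* w :* (v :* w′) := w′ :* w :* (u :* v)) refl _ _ uY vX ⟩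
        W * (uY * vX) ∎)
      x≈y : MX.x ≈ MY.x
      x≈y = Injective-μ.injective inj MX.x∈μ MY.x∈μ (*-cancelˡ (l∉μ ∘ sym ∘ +≈0⇒≈) (combine₁ 1# uv≈vu
        (solve 6 (λ l l̄ n d n′ d′ → (:1 :+ l :* l̄) :* (n :* d′) :+ (:1 :+ l :* l̄) :* (n′ :* d) :=
           :1 :* ((n :+ l :* d) :* (d′ :+ l̄ :* n′) :+ (n′ :+ l :* d′) :* (d :+ l̄ :* n)))
          refl l (σ t * σ y) (N MX.x) (D MX.x) (N MY.x) (D MY.x))))

  module Balancing (inj : Injective-μ) (φ-onto : ∀ y → ∃[ x ] φ x ≈ y) (obstruction : PowerSumObstruction) where

    degenerate : ∀ {t y z} → Root t → ¬ 1# + b * t ≈ 0# → y * (1# + b * t) ≈ σ c → φ z ≈ t → ¬ Norm1 t →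
                 σ z * y ≈ 1# ⊎ z ≈ y
    degenerate root 1+bt≉0 y[1+bt]≈c̄ φz≈t t∉μ = dec (A ≟ 0#) (C ≟ 0#)
      where
      open Unramified inj root 1+bt≉0 y[1+bt]≈c̄ φz≈t t∉μ
      dec : Dec (A ≈ 0#) → Dec (C ≈ 0#) → _ ⊎ _
      dec (yes A≈0) _         = inj₁ (sym (+≈0⇒≈ A≈0))
      dec (no  _)   (yes C≈0) = inj₂ (+≈0⇒≈ C≈0)
      dec (no  A≉0) (no  C≉0) = ⊥-elim (obstruction A≉0 C≉0 AĀ≉CC̄ transformed-injective)

    z≈0⇒t≈0 : ∀ {z t} → φ z ≈ t → z ≈ 0# → t ≈ 0#
    z≈0⇒t≈0 φz≈t z≈0 = trans (sym φz≈t) (trans (φ.cong z≈0) φ.0-homo)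

    -- For c = 0 the root t = b̄ has y = 0 as second fibre point. As z̄ · 0 = 1 is absurd, only z =
    -- y = 0 is left, that is b̄ = 0.
    c≈0⇒b≈0 : ¬ e ≈ 0# → c ≈ 0# → b ≈ 0#
    c≈0⇒b≈0 e≉0 c≈0 with z , φz≈b̄ ← φ-onto (σ b) = σ.≈0 (z≈0⇒t≈0 φz≈b̄ (z≈0 (degenerate root
        (≉0-resp e≈1+bb̄ e≉0) (trans (zeroˡ _) (sym c̄≈0)) φz≈b̄
        (λ h → e≉0 (trans e≈1+bb̄ (trans (+-congˡ (trans (sym (trans (*-congˡ (σσ b)) (*-comm _ _))) h)) 1+1≈0))))))
      where
      c̄≈0 : σ c ≈ 0#
      c̄≈0 = trans (σ.cong c≈0) σ.0-homo
      e≈1+bb̄ : e ≈ 1# + b * σ b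
      e≈1+bb̄ = combine₁ (σ c) c≈0 (solve 4 (λ b b̄ c c̄ → :1 :+ b :* b̄ :+ c :* c̄ :+ (:1 :+ b :* b̄) := c̄ :* (c :+ :0))
        refl b (σ b) c (σ c))
      root : Root (σ b)
      root = combine₁ (σ b) e≈1+bb̄ (solve 3 (λ b b̄ e → b :* (b̄ :* b̄) :+ e :* b̄ :+ b̄ :+ :0 := b̄ :* (e :+ (:1 :+ b :* b̄)))
        refl b (σ b) e)
      z≈0 : ∀ {z} → σ z * 0# ≈ 1# ⊎ z ≈ 0# → z ≈ 0#
      z≈0 (inj₁ h) = contradiction (trans (sym h) (zeroʳ _)) 1≉0
      z≈0 (inj₂ h) = h

    -- For b = 0 the root t = 0 has z = 0 and y = c̄, so the surviving alternative z = y says c̄ =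
    -- 0.
    b≈0⇒c≈0 : b ≈ 0# → c ≈ 0#
    b≈0⇒c≈0 b≈0 = σ.≈0 (c̄≈0 (degenerate root (λ h → 1≉0 (trans (sym 1+b0≈1) h))
        (trans (*-congˡ 1+b0≈1) (*-identityʳ _)) φ.0-homo (λ h → 1≉0 (trans (sym h) (zeroˡ _)))))
      where
      1+b0≈1 : 1# + b * 0# ≈ 1#
      1+b0≈1 = trans (+-congˡ (zeroʳ b)) (+-identityʳ 1#)
      root : Root 0#
      root = combine₁ 1# (trans (σ.cong b≈0) σ.0-homo) (solve 3 (λ b b̄ e →
        b :* (:0 :* :0) :+ e :* :0 :+ b̄ :+ :0 := :1 :* (b̄ :+ :0)) refl b (σ b) e)
      c̄≈0 : σ 0# * σ c ≈ 1# ⊎ 0# ≈ σ c → σ c ≈ 0#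
      c̄≈0 (inj₁ h) = contradiction (trans (sym h) (trans (*-congʳ σ.0-homo) (zeroˡ _))) 1≉0
      c̄≈0 (inj₂ h) = sym h

    -- In both alternatives φ y is known: it is t if y = z, and 1 / t̄ if y = 1 / z̄. Applying `φ`
    -- to y c = 1 + b t + e and to ȳ (1 + b t) = c then gives two linear equations in φ c and P = φ
    -- (b t); eliminating P yields (2).
    unramified⇒balanced : ∀ {t} → Root t → ¬ t ≈ 0# → ¬ Norm1 t → ¬ c ≈ 0# → Balanced
    unramified⇒balanced {t} root t≉0 t∉μ c≉0 = finish (degenerate root 1+bt≉0 y[1+bt]≈c̄ φz≈t t∉μ)
      where
      z = proj₁ (φ-onto t)
      φz≈t = proj₂ (φ-onto t)
      1+bt≉0 : ¬ 1# + b * t ≈ 0#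
      1+bt≉0 h = c≉0 (1+bt≈0⇒c≈0 t≉0 root h)
      i = proj₁ (inverse 1+bt≉0)
      y = σ c * i
      y[1+bt]≈c̄ : y * (1# + b * t) ≈ σ c
      y[1+bt]≈c̄ = combine₁ (σ c) (proj₂ (inverse 1+bt≉0))
        (solve 3 (λ c̄ i z → c̄ :* i :* z :+ c̄ := c̄ :* (z :* i :+ :1)) refl (σ c) i (1# + b * t))
      open Factorisation {t} {y} root 1+bt≉0 y[1+bt]≈c̄
      tt̄+1≉0 : ¬ t * σ t + 1# ≈ 0#
      tt̄+1≉0 = t∉μ ∘ +≈0⇒≈
      rootσ : σ b * (σ t * σ t) + e * σ t + b ≈ 0#
      rootσ = begin
        σ b * (σ t * σ t) + e * σ t + b
          ≈⟨ +-cong (+-cong (trans (σ.*-homo _ _) (*-congˡ (σ.*-homo _ _))) (trans (σ.*-homo _ _) (*-congʳ σ-e))) (σσ b) ⟨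
        σ (b * (t * t)) + σ (e * t) + σ (σ b)
          ≈⟨ trans (σ.+-homo _ _) (+-congʳ (σ.+-homo _ _)) ⟨
        σ (b * (t * t) + e * t + σ b)
          ≈⟨ trans (σ.cong root) σ.0-homo ⟩
        0# ∎
      -- The root equation times t̄ plus its conjugate times t is (t t̄ + 1)(b̄ t̄ + b t), and t is
      -- off the circle.
      b̄t̄≈bt : σ b * σ t ≈ b * t
      b̄t̄≈bt = *-cancelˡ tt̄+1≉0 (combine₂ (σ t) root t rootσ
        (solve 5 (λ b b̄ t t̄ e → (t :* t̄ :+ :1) :* (b̄ :* t̄) :+ (t :* t̄ :+ :1) :* (b :* t) :=
           t̄ :* (b :* (t :* t) :+ e :* t :+ b̄ :+ :0) :+ t :* (b̄ :* (t̄ :* t̄) :+ e :* t̄ :+ b :+ :0))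
          refl b (σ b) t (σ t) e))
      et̄-eq : b * t * (t * σ t) + e * (t * σ t) ≈ b * t
      et̄-eq = combine₂ (σ t) root 1# b̄t̄≈bt
        (solve 5 (λ b b̄ t t̄ e → b :* t :* (t :* t̄) :+ e :* (t :* t̄) :+ b :* t :=
          t̄ :* (b :* (t :* t) :+ e :* t :+ b̄ :+ :0) :+ :1 :* (b̄ :* t̄ :+ b :* t)) refl b (σ b) t (σ t) e)
      P E : Carrier
      P = φ b * φ t
      E = φ e
      φyφc : φ y * φ c ≈ 1# + P + E
      φyφc = trans (sym (φ.*-homo _ _)) (trans (φ.cong (yc≈1+bt+e t≉0)) (trans (φ.+-homo _ _) (+-congʳ (φ-1+xy _ _))))
      φc : φ (σ y) * (1# + P) ≈ φ c
      φc = begin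
        φ (σ y) * (1# + φ b * φ t)   ≈⟨ *-congˡ (φ-1+xy _ _) ⟨
        φ (σ y) * φ (1# + b * t)     ≈⟨ *-congˡ (φ.cong (+-congˡ b̄t̄≈bt)) ⟨
        φ (σ y) * φ (1# + σ b * σ t) ≈⟨ φ.*-homo _ _ ⟨
        φ (σ y * (1# + σ b * σ t))   ≈⟨ φ.cong (*-congˡ (σ-1+xy _ _)) ⟨
        φ (σ y * σ (1# + b * t))     ≈⟨ φ.cong (σ.*-homo _ _) ⟨
        φ (σ (y * (1# + b * t)))     ≈⟨ φ.cong (trans (σ.cong y[1+bt]≈c̄) (σσ c)) ⟩
        φ c                          ∎
      φσz≈t̄ : φ (σ z) ≈ σ t
      φσz≈t̄ = trans (sym (σφ z)) (σ.cong φz≈t)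
      cancel : t * (t * σ t + 1#) * (φ c * e) ≈ t * (t * σ t + 1#) * (E * b) → Balanced
      cancel = *-cancelˡ (*-≉0 t≉0 tt̄+1≉0)
      finish : σ z * y ≈ 1# ⊎ z ≈ y → Balanced
      finish (inj₂ z≈y) = cancel (combine₃ (t * e) h₁ (e * (t * σ t)) h₂ E et̄-eq
        (solve 7 (λ b t t̄ e C P E → t :* (t :* t̄ :+ :1) :* (C :* e) :+ t :* (t :* t̄ :+ :1) :* (E :* b) :=
           t :* e :* (C :+ t̄ :* (:1 :+ P)) :+ e :* (t :* t̄) :* (t :* C :+ (:1 :+ P :+ E))
           :+ E :* (b :* t :* (t :* t̄) :+ e :* (t :* t̄) :+ b :* t)) refl b t (σ t) e (φ c) P E))
        where
        h₁ : φ c ≈ σ t * (1# + P)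
        h₁ = trans (sym φc) (*-congʳ (trans (φ.cong (σ.cong (sym z≈y))) φσz≈t̄))
        h₂ : t * φ c ≈ 1# + P + E
        h₂ = trans (*-congʳ (trans (sym φz≈t) (φ.cong z≈y))) φyφc
      finish (inj₁ z̄y≈1) = cancel (combine₃ (t * e) h₁ (e * (t * σ t)) h₂ E et̄-eq
        (solve 7 (λ b t t̄ e C P E → t :* (t :* t̄ :+ :1) :* (C :* e) :+ t :* (t :* t̄ :+ :1) :* (E :* b) :=
           t :* e :* (C :+ t̄ :* (:1 :+ P :+ E)) :+ e :* (t :* t̄) :* (t :* C :+ (:1 :+ P))
           :+ E :* (b :* t :* (t :* t̄) :+ e :* (t :* t̄) :+ b :* t)) refl b t (σ t) e (φ c) P E))
        where
        t̄φy≈1 : σ t * φ y ≈ 1#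
        t̄φy≈1 = trans (*-congʳ (sym φσz≈t̄)) (trans (sym (φ.*-homo _ _)) (trans (φ.cong z̄y≈1) φ.1-homo))
        tφȳ≈1 : t * φ (σ y) ≈ 1#
        tφȳ≈1 = begin
          t * φ (σ y)       ≈⟨ *-cong (sym (σσ t)) (sym (σφ y)) ⟩
          σ (σ t) * σ (φ y) ≈⟨ σ.*-homo _ _ ⟨
          σ (σ t * φ y)     ≈⟨ trans (σ.cong t̄φy≈1) σ.1-homo ⟩
          1#                ∎
        h₁ : φ c ≈ σ t * (1# + P + E)
        h₁ = combine₂ (φ c) t̄φy≈1 (σ t) φyφc (solve 4 (λ C t̄ y r → C :+ t̄ :* r := C :* (t̄ :* y :+ :1) :+ t̄ :* (y :* C :+ r))
          refl (φ c) (σ t) (φ y) (1# + P + E))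
        h₂ : t * φ c ≈ 1# + P
        h₂ = combine₂ t φc (1# + P) tφȳ≈1 (solve 4 (λ C t y r → t :* C :+ r := t :* (y :* r :+ C) :+ r :* (t :* y :+ :1))
          refl (φ c) t (φ (σ y)) (1# + P))

  -- The two roots in the Artin-Schreier coordinate s.

  module RamificationPoints (b≉0 : ¬ b ≈ 0#) {w} (ew≈1 : e * w ≈ 1#) where

    ArtinSchreier : Carrier → Set ℓ
    ArtinSchreier s = s * s + s ≈ b * σ b * (w * w)

    private
      u : Carrier
      u = proj₁ (inverse b≉0)

      bu≈1 : b * u ≈ 1#
      bu≈1 = proj₂ (inverse b≉0)

    e≉0 : ¬ e ≈ 0#
    e≉0 = *-≉0ˡ (≉0-resp (sym ew≈1) 1≉0)

    bb̄≉0 : ¬ b * σ b ≈ 0#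
    bb̄≉0 = *-≉0 b≉0 (σ.≉0 b≉0)

    artinSchreier-+1 : ∀ {s} → ArtinSchreier s → ArtinSchreier (s + 1#)
    artinSchreier-+1 {s} = trans (solve 1 (λ s → (s :+ :1) :* (s :+ :1) :+ (s :+ :1) := s :* s :+ s) refl s)

    artinSchreier-≉0 : ∀ {s} → ArtinSchreier s → ¬ s ≈ 0#
    artinSchreier-≉0 {s} as s≈0 = *-≉0 bb̄≉0 (*-≉0 w≉0 w≉0)
      (trans (sym as) (trans (+-cong (trans (*-congʳ s≈0) (zeroˡ s)) s≈0) (+-identityˡ 0#)))
      where
      w≉0 : ¬ w ≈ 0#
      w≉0 = *-≉0ˡ (≉0-resp (trans (sym ew≈1) (*-comm e w)) 1≉0)

    e²[s²+s]≈bb̄ : ∀ {s} → ArtinSchreier s → e * e * (s * s + s) ≈ b * σ b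
    e²[s²+s]≈bb̄ {s} as = combine₂ (e * e) as (b * σ b * (e * w + 1#)) ew≈1
      (solve 5 (λ b b̄ e w s → e :* e :* (s :* s :+ s) :+ b :* b̄ :=
         e :* e :* (s :* s :+ s :+ b :* b̄ :* (w :* w)) :+ b :* b̄ :* (e :* w :+ :1) :* (e :* w :+ :1))
        refl b (σ b) e w s)

    root : Carrier → Carrier
    root s = e * u * s

    root-cong : ∀ {s s′} → s ≈ s′ → root s ≈ root s′
    root-cong = *-congˡ

    b*root≈es : ∀ s → b * root s ≈ e * s
    b*root≈es s = combine₁ (e * s) bu≈1 (solve 4 (λ b u e s → b :* (e :* u :* s) :+ e :* s := e :* s :* (b :* u :+ :1))
      refl b u e s)

    isRoot : ∀ {s} → ArtinSchreier s → Root (root s)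
    isRoot {s} as = *-cancelˡ b≉0 (combine₂ (b * root s + e * s + e) (b*root≈es s) 1# (e²[s²+s]≈bb̄ as)
      (solve 5 (λ b b̄ e s t → b :* (b :* (t :* t) :+ e :* t :+ b̄) :+ b :* :0 :=
         (b :* t :+ e :* s :+ e) :* (b :* t :+ e :* s) :+ :1 :* (e :* e :* (s :* s :+ s) :+ b :* b̄))
        refl b (σ b) e s (root s)))

    bb̄tt̄′≈e²ss̄′ : ∀ s s′ → b * σ b * (root s * σ (root s′)) ≈ e * e * (s * σ s′)
    bb̄tt̄′≈e²ss̄′ s s′ = combine₂ (σ b * σ (root s′)) (b*root≈es s) (e * s) b̄t̄≈es̄
      (solve 7 (λ b b̄ e s s̄ t t̄ → b :* b̄ :* (t :* t̄) :+ e :* e :* (s :* s̄) :=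
         b̄ :* t̄ :* (b :* t :+ e :* s) :+ e :* s :* (b̄ :* t̄ :+ e :* s̄))
        refl b (σ b) e s (σ s′) (root s) (σ (root s′)))
      where
      b̄t̄≈es̄ : σ b * σ (root s′) ≈ e * σ s′
      b̄t̄≈es̄ = begin
        σ b * σ (root s′)  ≈⟨ σ.*-homo _ _ ⟨
        σ (b * root s′)    ≈⟨ σ.cong (b*root≈es s′) ⟩
        σ (e * s′)         ≈⟨ σ.*-homo _ _ ⟩
        σ e * σ s′         ≈⟨ *-congʳ σ-e ⟩
        e * σ s′           ∎

    -- Multiplied by b b̄, the left side is e² s σ s′ = e² (s² + s) = b b̄. For s′ = s this puts a
    -- root on the circle; for s′ = s + 1 and σ s = s it makes the two roots mirror images in the
    -- circle.
    conjugate-roots : ∀ {s s′} → ArtinSchreier s → σ s′ ≈ s + 1# → root s * σ (root s′) ≈ 1#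
    conjugate-roots {s} {s′} as s̄≈s+1 = *-cancelˡ bb̄≉0 (combine₃ 1# (bb̄tt̄′≈e²ss̄′ s s′) 1# (e²[s²+s]≈bb̄ as) (e * e * s) s̄≈s+1
      (solve 5 (λ B e s s̄ r → B :* r :+ B :* :1 :=
         :1 :* (B :* r :+ e :* e :* (s :* s̄)) :+ :1 :* (e :* e :* (s :* s :+ s) :+ B) :+ e :* e :* s :* (s̄ :+ (s :+ :1)))
        refl (b * σ b) e s (σ s′) (root s * σ (root s′))))

    -- Norm 1 would give e² s² = b b̄ = e² (s² + s), hence s = 0, whereas s² + s = b b̄ / e² is
    -- nonzero.
    rational-root : ∀ {s} → ArtinSchreier s → σ s ≈ s → ¬ Norm1 (root s)
    rational-root {s} as s̄≈s h = *-≉0 (*-≉0 e≉0 e≉0) (artinSchreier-≉0 as) (combine₃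
      (b * σ b) h 1# (bb̄tt̄′≈e²ss̄′ s s) 1# e²s²+bb̄
      (solve 5 (λ B e s s̄ r → e :* e :* s :+ :0 :=
         B :* (r :+ :1) :+ :1 :* (B :* r :+ e :* e :* (s :* s̄)) :+ :1 :* (e :* e :* (s :* s̄) :+ e :* e :* s :+ B))
        refl (b * σ b) e s (σ s) (root s * σ (root s))))
      where
      e²s²+bb̄ : e * e * (s * σ s) + e * e * s ≈ b * σ b
      e²s²+bb̄ = trans (+-congʳ (*-congˡ (*-congˡ s̄≈s))) (trans (sym (distribˡ _ _ _)) (e²[s²+s]≈bb̄ as))

    root+root : ∀ s → b * (root s + root (s + 1#)) ≈ e
    root+root s = combine₁ e bu≈1 (solve 4 (λ b u e s → b :* (e :* u :* s :+ e :* u :* (s :+ :1)) :+ e := e :* (b :* u :+ :1))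
      refl b u e s)

    root≉root+1 : ∀ s → ¬ root s ≈ root (s + 1#)
    root≉root+1 s h = e≉0 (trans (sym (root+root s)) (trans (*-congˡ (≈⇒+≈0 h)) (zeroʳ b)))

    module _ (balanced : Balanced) where

      c≉0 : ¬ c ≈ 0#
      c≉0 c≈0 = *-≉0 (φ.≉0 e≉0) b≉0
        (trans (sym balanced) (trans (*-congʳ (trans (φ.cong c≈0) φ.0-homo)) (zeroˡ e)))

      φeφw≈1 : φ e * φ w ≈ 1#
      φeφw≈1 = trans (sym (φ.*-homo e w)) (trans (φ.cong ew≈1) φ.1-homo)

      private
        balanced-σ : φ (σ c) * e ≈ φ e * σ b
        balanced-σ = begin
          φ (σ c) * e      ≈⟨ *-cong (sym (σφ c)) (sym σ-e) ⟩
          σ (φ c) * σ e    ≈⟨ σ.*-homo _ _ ⟨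
          σ (φ c * e)      ≈⟨ σ.cong balanced ⟩
          σ (φ e * b)      ≈⟨ σ.*-homo _ _ ⟩
          σ (φ e) * σ b    ≈⟨ *-congʳ (trans (σφ e) (φ.cong σ-e)) ⟩
          φ e * σ b        ∎

        φe≈ : φ e ≈ 1# + φ (b * σ b) + φ (c * σ c)
        φe≈ = trans (φ.+-homo _ _) (+-congʳ (trans (φ.+-homo _ _) (+-congʳ φ.1-homo)))

        e²φ[cc̄]≈φe²bb̄ : e * e * φ (c * σ c) ≈ φ e * φ e * (b * σ b)
        e²φ[cc̄]≈φe²bb̄ = trans (*-congˡ (φ.*-homo _ _)) (combine₂ (φ (σ c) * e) balanced (φ e * b) balanced-σ
          (solve 6 (λ b b̄ e C C̄ E → e :* e :* (C :* C̄) :+ E :* E :* (b :* b̄) :=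
             C̄ :* e :* (C :* e :+ E :* b) :+ E :* b :* (C̄ :* e :+ E :* b̄)) refl b (σ b) e (φ c) (φ (σ c)) (φ e)))

        φ[e²[s²+s]] : ∀ {s} → ArtinSchreier s → φ e * φ e * (φ s * φ s + φ s) ≈ φ (b * σ b)
        φ[e²[s²+s]] {s} as = begin
          φ e * φ e * (φ s * φ s + φ s)      ≈⟨ *-congˡ (+-congʳ (φ.*-homo _ _)) ⟨
          φ e * φ e * (φ (s * s) + φ s)      ≈⟨ *-cong (φ.*-homo _ _) (φ.+-homo _ _) ⟨
          φ (e * e) * φ (s * s + s)          ≈⟨ φ.*-homo _ _ ⟨
          φ (e * e * (s * s + s))            ≈⟨ φ.cong (e²[s²+s]≈bb̄ as) ⟩
          φ (b * σ b)                        ∎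

      -- This is δ: it is 1 if the ramification point over s is the whole of its
      -- fibre, and 0 if the fibre also contains the other ramification point.
      shift : Carrier → Carrier
      shift s = φ w + φ s + s

      -- Since s ↦ s² + s is additive, δ² + δ is the sum of φ w² (1 + φ e), φ w² φ (b b̄) and b b̄
      -- w². The first two add up to φ w² φ (c c̄), which the norm of (2) identifies with the third.
      shift²+shift≈0 : ∀ {s} → ArtinSchreier s → shift s * shift s + shift s ≈ 0#
      shift²+shift≈0 {s} as = x*y≈0⇒y≈0 (*-≉0 (*-≉0 (φ.≉0 e≉0) (φ.≉0 e≉0)) (*-≉0 e≉0 e≉0))
        (trans expand (combine₂ (e * e) (sym φe≈) 1# (sym e²φ[cc̄]≈φe²bb̄)
          (solve 5 (λ e E B BB CC → e :* e :* (:1 :+ E :+ BB) :+ E :* E :* B :+ :0 :=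
            e :* e :* (:1 :+ BB :+ CC :+ E) :+ :1 :* (E :* E :* B :+ e :* e :* CC)) refl e (φ e) (b * σ b) (φ (b * σ b)) (φ (c * σ c)))))
        where
        expand : φ e * φ e * (e * e) * (shift s * shift s + shift s) ≈ e * e * (1# + φ e + φ (b * σ b)) + φ e * φ e * (b * σ b)
        expand = combine₃ (e * e * (φ e * φ w + 1# + φ e)) φeφw≈1 (e * e) (φ[e²[s²+s]] as) (φ e * φ e) (e²[s²+s]≈bb̄ as)
          (solve 7 (λ e E W s S B BB → E :* E :* (e :* e) :* ((W :+ S :+ s) :* (W :+ S :+ s) :+ (W :+ S :+ s))
            :+ (e :* e :* (:1 :+ E :+ BB) :+ E :* E :* B) :=
            e :* e :* (E :* W :+ :1 :+ E) :* (E :* W :+ :1) :+ e :* e :* (E :* E :* (S :* S :+ S) :+ BB)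
            :+ E :* E :* (e :* e :* (s :* s :+ s) :+ B)) refl e (φ e) (φ w) s (φ s) (b * σ b) (φ (b * σ b)))

      shift-+1 : ∀ s → shift (s + 1#) ≈ shift s
      shift-+1 s = trans (+-congʳ (+-congˡ (trans (φ.+-homo _ _) (+-congˡ φ.1-homo))))
        (solve 3 (λ w s S → w :+ (S :+ :1) :+ (s :+ :1) := w :+ S :+ s) refl (φ w) s (φ s))

      -- Computes the second fibre point over t = root s: φ y is φ (y c) / φ c, and φ c = φ e b / e
      -- by (2), so φ y = (e / b)(φ w + φ s + 1) = root (s + 1 + δ). This is the origin of δ.
      module Value {s} (as : ArtinSchreier s) where

        1+bt≉0 : ¬ 1# + b * root s ≈ 0#
        1+bt≉0 h = c≉0 (1+bt≈0⇒c≈0 (*-≉0 (*-≉0 e≉0 (*-≉0ˡ (≉0-resp (trans (sym bu≈1) (*-comm b u)) 1≉0))) (artinSchreier-≉0 as)) (isRoot as) h)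

        module _ {y} (φy≈ : φ y ≈ root (s + 1# + shift s)) where

          private
            y′ : Carrier
            y′ = σ c * proj₁ (inverse 1+bt≉0)

            y′[1+bt]≈c̄ : y′ * (1# + b * root s) ≈ σ c
            y′[1+bt]≈c̄ = combine₁ (σ c) (proj₂ (inverse 1+bt≉0))
              (solve 3 (λ c̄ i z → c̄ :* i :* z :+ c̄ := c̄ :* (z :* i :+ :1)) refl (σ c) (proj₁ (inverse 1+bt≉0)) (1# + b * root s))

            t≉0 : ¬ root s ≈ 0#
            t≉0 t≈0 = *-≉0 e≉0 (artinSchreier-≉0 as) (trans (sym (b*root≈es s)) (trans (*-congˡ t≈0) (zeroʳ b)))

            φy′φc : φ y′ * φ c ≈ 1# + φ e * φ s + φ e
            φy′φc = begin
              φ y′ * φ c                  ≈⟨ φ.*-homo _ _ ⟨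
              φ (y′ * c)                  ≈⟨ φ.cong (Factorisation.yc≈1+bt+e (isRoot as) 1+bt≉0 y′[1+bt]≈c̄ t≉0) ⟩
              φ (1# + b * root s + e)     ≈⟨ φ.cong (+-congʳ (+-congˡ (b*root≈es s))) ⟩
              φ (1# + e * s + e)          ≈⟨ trans (φ.+-homo _ _) (+-congʳ (φ-1+xy _ _)) ⟩
              1# + φ e * φ s + φ e        ∎

            φy′≈φy : φ y′ ≈ φ y
            φy′≈φy = *-cancelˡ b≉0 (*-cancelˡ (φ.≉0 e≉0) (begin
              φ e * (b * φ y′)
                ≈⟨ combine₃ (φ y′) balanced e φy′φc e φeφw≈1
                  (solve 8 (λ b e E C W S y s → E :* (b :* y) :+ E :* (e :* (s :+ :1 :+ (W :+ S :+ s))) :=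
                    y :* (C :* e :+ E :* b) :+ e :* (y :* C :+ (:1 :+ E :* S :+ E)) :+ e :* (E :* W :+ :1))
                    refl b e (φ e) (φ c) (φ w) (φ s) (φ y′) s) ⟩
              φ e * (e * (s + 1# + shift s))  ≈⟨ *-congˡ (b*root≈es _) ⟨
              φ e * (b * root (s + 1# + shift s)) ≈⟨ *-congˡ (*-congˡ φy≈) ⟨
              φ e * (b * φ y) ∎))

          y[1+bt]≈c̄ : y * (1# + b * root s) ≈ σ c
          y[1+bt]≈c̄ = trans (*-congʳ (φ.injective (sym φy′≈φy))) y′[1+bt]≈c̄

          open Factorisation (isRoot as) 1+bt≉0 y[1+bt]≈c̄ public using (factor; y≈c̄+tyb)

  -- N / D as a power map, and pairs of points that collide under it.

  D≈0⇒N≈0 : ∀ {x} → Norm1 x → D x ≈ 0# → N x ≈ 0#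
  D≈0⇒N≈0 x∈μ h = trans (N≈xφxσD x∈μ) (trans (*-congˡ (trans (σ.cong h) σ.0-homo)) (zeroʳ _))

  [φx+φz][x+y]≈0 : ∀ {x y z} → (φ x + φ z) * (x + y) ≈ 0# → x ≈ z ⊎ x ≈ y
  [φx+φz][x+y]≈0 h with ≈0⊎≈0 h
  ... | inj₁ p = inj₁ (φ.injective (+≈0⇒≈ p))
  ... | inj₂ p = inj₂ (+≈0⇒≈ p)

  -- The two factorisations put N / D in the form X ^ (Q + 1) or X ^ (Q - 1),
  -- in the coordinate X = (x + x₁) / (x + x₂).
  module TwoFibres {x₁ x₂ y₁ y₂ l₁ l₂}
    (factor₁ : ∀ X → N X + l₁ * D X ≈ (φ X + φ x₁) * (X + y₁))
    (factor₂ : ∀ X → N X + l₂ * D X ≈ (φ X + φ x₂) * (X + y₂)) where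

    -- Compares the values of (N + l₁ D) / (N + l₂ D) at X and Y. The comparison differs from that
    -- for N / D by the factor l₁ + l₂, so the two are equivalent once the levels differ.
    Cross : Carrier → Carrier → Carrier
    Cross X Y = (φ X + φ x₁) * (X + y₁) * ((φ Y + φ x₂) * (Y + y₂))

    private
      [l₁+l₂][ND+ND] : ∀ X Y → Cross X Y + Cross Y X ≈ (l₁ + l₂) * (N X * D Y + N Y * D X)
      [l₁+l₂][ND+ND] X Y = begin
        Cross X Y + Cross Y X
          ≈⟨ +-cong (*-cong (factor₁ X) (factor₂ Y)) (*-cong (factor₁ Y) (factor₂ X)) ⟨
        (N X + l₁ * D X) * (N Y + l₂ * D Y) + (N Y + l₁ * D Y) * (N X + l₂ * D X)
          ≈⟨ solve 6 (λ n d n′ d′ l l′ → (n :+ l :* d) :* (n′ :+ l′ :* d′) :+ (n′ :+ l :* d′) :* (n :+ l′ :* d)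
               := (l :+ l′) :* (n :* d′ :+ n′ :* d)) refl (N X) (D X) (N Y) (D Y) l₁ l₂ ⟩
        (l₁ + l₂) * (N X * D Y + N Y * D X) ∎

    cross-sym : ∀ {X Y} → N X * D Y ≈ N Y * D X → Cross X Y ≈ Cross Y X
    cross-sym {X} {Y} h = +≈0⇒≈ (trans ([l₁+l₂][ND+ND] X Y) (trans (*-congˡ (≈⇒+≈0 h)) (zeroʳ _)))

    cross-sym⁻¹ : ¬ l₁ ≈ l₂ → ∀ {X Y} → Cross X Y ≈ Cross Y X → N X * D Y ≈ N Y * D X
    cross-sym⁻¹ l₁≉l₂ {X} {Y} h = +≈0⇒≈ (x*y≈0⇒y≈0 (l₁≉l₂ ∘ +≈0⇒≈)
      (trans (sym ([l₁+l₂][ND+ND] X Y)) (≈⇒+≈0 h)))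

    D≈0⇒ : ∀ {X} → Norm1 X → D X ≈ 0# → (X ≈ x₁ ⊎ X ≈ y₁) × (X ≈ x₂ ⊎ X ≈ y₂)
    D≈0⇒ {X} X∈μ DX≈0 = [φx+φz][x+y]≈0 (trans (sym (factor₁ X)) (N+lD≈0 l₁))
                      , [φx+φz][x+y]≈0 (trans (sym (factor₂ X)) (N+lD≈0 l₂))
      where
      N+lD≈0 : ∀ l → N X + l * D X ≈ 0#
      N+lD≈0 l = trans (+-cong (D≈0⇒N≈0 X∈μ DX≈0) (trans (*-congˡ DX≈0) (zeroʳ l))) (+-identityˡ 0#)

  module _ (x₁ x₂ : Carrier) where

    -- The coordinate (X + x₁) / (X + x₂) at X over the same at Y is `Ratio X Y` over `Ratio Y X`.
    -- Keeping the two products apart also covers the points where the coordinate is 0 or infinite.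
    Ratio : Carrier → Carrier → Carrier
    Ratio X Y = (X + x₁) * (Y + x₂)

    φ-Ratio : ∀ X Y → φ (Ratio X Y) ≈ (φ X + φ x₁) * (φ Y + φ x₂)
    φ-Ratio X Y = trans (φ.*-homo _ _) (*-cong (φ.+-homo _ _) (φ.+-homo _ _))

    Ratio-injective : ¬ x₁ ≈ x₂ → ∀ {X Y} → Ratio X Y ≈ Ratio Y X → X ≈ Y
    Ratio-injective x₁≉x₂ {X} {Y} h = +≈0⇒≈ (x*y≈0⇒y≈0 (x₁≉x₂ ∘ +≈0⇒≈) (trans
      (solve 4 (λ X Y x y → (x :+ y) :* (X :+ Y) := (X :+ x) :* (Y :+ y) :+ (Y :+ x) :* (X :+ y)) refl X Y x₁ x₂)
      (≈⇒+≈0 h)))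

    -- For mirror images x₁ and x₂, conjugation turns X + x₁ into a multiple of X + x₂ and
    -- conversely, so the coordinate has constant norm on the circle.
    Ratio-norm : x₂ * σ x₁ ≈ 1# → x₁ * σ x₂ ≈ 1# → ∀ {X Y} → Norm1 X → Norm1 Y →
                 Ratio X Y * σ (Ratio X Y) ≈ Ratio Y X * σ (Ratio Y X)
    Ratio-norm h₁ h₂ {X} {Y} X∈μ Y∈μ = begin
      Ratio X Y * σ (Ratio X Y)     ≈⟨ *-congˡ (flip X∈μ Y∈μ) ⟩
      Ratio X Y * (κ X Y * Ratio Y X)
        ≈⟨ solve 8 (λ X Y X̄ Ȳ x y r s → r :* (X̄ :* x :* (Ȳ :* y) :* s) := s :* (Ȳ :* x :* (X̄ :* y) :* r))
             refl X Y (σ X) (σ Y) (σ x₁) (σ x₂) (Ratio X Y) (Ratio Y X) ⟩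
      Ratio Y X * (κ Y X * Ratio X Y) ≈⟨ *-congˡ (flip Y∈μ X∈μ) ⟨
      Ratio Y X * σ (Ratio Y X)     ∎
      where
      κ : Carrier → Carrier → Carrier
      κ X Y = σ X * σ x₁ * (σ Y * σ x₂)
      reflect : ∀ {z z′ X} → z * σ z′ ≈ 1# → Norm1 X → σ (X + z′) ≈ σ X * σ z′ * (X + z)
      reflect {z} {z′} {X} h X∈μ = trans (σ.+-homo _ _) (combine₂ (σ z′) X∈μ (σ X) h
        (solve 4 (λ z w X X̄ → X̄ :+ w :+ X̄ :* w :* (X :+ z) := w :* (X :* X̄ :+ :1) :+ X̄ :* (z :* w :+ :1)) refl z (σ z′) X (σ X)))
      flip : ∀ {X Y} → Norm1 X → Norm1 Y → σ (Ratio X Y) ≈ κ X Y * Ratio Y X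
      flip {X} {Y} X∈μ Y∈μ = begin
        σ (Ratio X Y)                 ≈⟨ σ.*-homo _ _ ⟩
        σ (X + x₁) * σ (Y + x₂)       ≈⟨ *-cong (reflect h₁ X∈μ) (reflect h₂ Y∈μ) ⟩
        σ X * σ x₁ * (X + x₂) * (σ Y * σ x₂ * (Y + x₁))
          ≈⟨ solve 4 (λ a b p q → a :* p :* (b :* q) := a :* b :* (q :* p)) refl _ _ _ _ ⟩
        κ X Y * Ratio Y X             ∎

    module _ (x₁≉x₂ : ¬ x₁ ≈ x₂) {l₁ l₂}
      (factor₁ : ∀ X → N X + l₁ * D X ≈ (φ X + φ x₁) * (X + x₁))
      (factor₂ : ∀ X → N X + l₂ * D X ≈ (φ X + φ x₂) * (X + x₂)) where

      private
        open TwoFibres factor₁ factor₂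

        cross : ∀ X Y → Cross X Y ≈ Ratio X Y * φ (Ratio X Y)
        cross X Y = trans
          (solve 4 (λ a b c d → a :* b :* (c :* d) := b :* d :* (a :* c)) refl _ _ _ _)
          (*-congˡ (sym (φ-Ratio X Y)))

      power-map⇒injective :
        (∀ {X Y} → Norm1 X → Norm1 Y → ¬ Ratio X Y ≈ 0# → ¬ Ratio Y X ≈ 0# →
          Ratio X Y * φ (Ratio X Y) ≈ Ratio Y X * φ (Ratio Y X) → Ratio X Y ≈ Ratio Y X) →
        Injective-μ
      power-map⇒injective cancel = record { D≉0 = D≉0 ; injective = injective }
        where
        D≉0 : ∀ {X} → Norm1 X → ¬ D X ≈ 0#
        D≉0 X∈μ h = x₁≉x₂ (trans (sym (reduce (proj₁ (D≈0⇒ X∈μ h)))) (reduce (proj₂ (D≈0⇒ X∈μ h))))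
        *φ≈0⇒≈0 : ∀ {x} → x * φ x ≈ 0# → x ≈ 0#
        *φ≈0⇒≈0 h with ≈0⊎≈0 h
        ... | inj₁ p = p
        ... | inj₂ p = φ.≈0 p
        injective : ∀ {X Y} → Norm1 X → Norm1 Y → N X * D Y ≈ N Y * D X → X ≈ Y
        injective {X} {Y} X∈μ Y∈μ h = Ratio-injective x₁≉x₂ (ratio≈ (Ratio X Y ≟ 0#) (Ratio Y X ≟ 0#))
          where
          powers : Ratio X Y * φ (Ratio X Y) ≈ Ratio Y X * φ (Ratio Y X)
          powers = trans (sym (cross X Y)) (trans (cross-sym h) (cross Y X))
          ratio≈ : Dec (Ratio X Y ≈ 0#) → Dec (Ratio Y X ≈ 0#) → Ratio X Y ≈ Ratio Y X
          ratio≈ (yes p) _       = trans p (sym (*φ≈0⇒≈0 (trans (sym powers) (trans (*-congʳ p) (zeroˡ _)))))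
          ratio≈ (no _)  (yes q) = trans (*φ≈0⇒≈0 (trans powers (trans (*-congʳ q) (zeroˡ _)))) (sym q)
          ratio≈ (no p)  (no q)  = cancel X∈μ Y∈μ p q powers

      -- Coordinates in ratio r with r^(Q+1) = 1 have the same (Q + 1)-th power. Distinct levels
      -- carry this back to N / D, so X = Y, and then the ratio is 1.
      power-map-collision : ¬ l₁ ≈ l₂ → Injective-μ → ∀ {X Y r} → Norm1 X → Norm1 Y →
        Ratio Y X ≈ r * Ratio X Y → r * φ r ≈ 1# → ¬ Ratio X Y ≈ 0# → r ≈ 1#
      power-map-collision l₁≉l₂ inj {X} {Y} {r} X∈μ Y∈μ h rφr≈1 ratio≉0 = *-cancelˡ ratio≉0 (begin
        Ratio X Y * r      ≈⟨ *-comm _ _ ⟩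
        r * Ratio X Y      ≈⟨ h ⟨
        Ratio Y X          ≈⟨ *-cong (+-congʳ (sym X≈Y)) (+-congʳ X≈Y) ⟩
        Ratio X Y          ≈⟨ *-identityʳ _ ⟨
        Ratio X Y * 1#     ∎)
        where
        crosses : Cross X Y ≈ Cross Y X
        crosses = begin
          Cross X Y                                 ≈⟨ cross X Y ⟩
          Ratio X Y * φ (Ratio X Y)                 ≈⟨ combine₁ (Ratio X Y * φ (Ratio X Y)) rφr≈1
            (solve 4 (λ r r′ a a′ → a :* a′ :+ r :* a :* (r′ :* a′) := a :* a′ :* (r :* r′ :+ :1)) refl r (φ r) _ _) ⟩
          r * Ratio X Y * (φ r * φ (Ratio X Y))     ≈⟨ *-cong h (trans (φ.cong h) (φ.*-homo _ _)) ⟨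
          Ratio Y X * φ (Ratio Y X)                 ≈⟨ cross Y X ⟨
          Cross Y X                                 ∎
        X≈Y : X ≈ Y
        X≈Y = Injective-μ.injective inj X∈μ Y∈μ (cross-sym⁻¹ l₁≉l₂ crosses)

    module _ (x₁≉x₂ : ¬ x₁ ≈ x₂) {l₁ l₂}
      (factor₁ : ∀ X → N X + l₁ * D X ≈ (φ X + φ x₁) * (X + x₂))
      (factor₂ : ∀ X → N X + l₂ * D X ≈ (φ X + φ x₂) * (X + x₁)) where

      private
        open TwoFibres factor₁ factor₂

        cross : ∀ X Y → Cross X Y ≈ φ (Ratio X Y) * Ratio Y X
        cross X Y = trans
          (solve 4 (λ a b c d → a :* b :* (c :* d) := a :* c :* (d :* b)) refl _ _ _ _)
          (*-congʳ (sym (φ-Ratio X Y)))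

      -- At x₁ and x₂ both cross products vanish and their equality says nothing; having these
      -- points off the circle keeps every `Ratio` nonzero.
      quotient-map⇒injective : ¬ Norm1 x₁ → ¬ Norm1 x₂ →
        (∀ {X Y} → Norm1 X → Norm1 Y → ¬ Ratio X Y ≈ 0# → ¬ Ratio Y X ≈ 0# →
          φ (Ratio X Y) * Ratio Y X ≈ φ (Ratio Y X) * Ratio X Y → Ratio X Y ≈ Ratio Y X) →
        Injective-μ
      quotient-map⇒injective x₁∉μ x₂∉μ cancel = record { D≉0 = D≉0 ; injective = injective }
        where
        ≉ : ∀ {X z} → Norm1 X → ¬ Norm1 z → ¬ X ≈ z
        ≉ X∈μ z∉μ X≈z = z∉μ (trans (*-cong (sym X≈z) (σ.cong (sym X≈z))) X∈μ)
        D≉0 : ∀ {X} → Norm1 X → ¬ D X ≈ 0#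
        D≉0 X∈μ h = [ ≉ X∈μ x₁∉μ , ≉ X∈μ x₂∉μ ]′ (proj₁ (D≈0⇒ X∈μ h))
        ratio≉0 : ∀ {X Y} → Norm1 X → Norm1 Y → ¬ Ratio X Y ≈ 0#
        ratio≉0 X∈μ Y∈μ = *-≉0 (≉ X∈μ x₁∉μ ∘ +≈0⇒≈) (≉ Y∈μ x₂∉μ ∘ +≈0⇒≈)
        injective : ∀ {X Y} → Norm1 X → Norm1 Y → N X * D Y ≈ N Y * D X → X ≈ Y
        injective {X} {Y} X∈μ Y∈μ h = Ratio-injective x₁≉x₂ (cancel X∈μ Y∈μ (ratio≉0 X∈μ Y∈μ) (ratio≉0 Y∈μ X∈μ)
          (trans (sym (cross X Y)) (trans (cross-sym h) (cross Y X))))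

      quotient-map-collision : ¬ l₁ ≈ l₂ → Injective-μ → ∀ {X Y r} → Norm1 X → Norm1 Y →
        Ratio Y X ≈ r * Ratio X Y → φ r ≈ r → ¬ Ratio X Y ≈ 0# → r ≈ 1#
      quotient-map-collision l₁≉l₂ inj {X} {Y} {r} X∈μ Y∈μ h φr≈r ratio≉0 = *-cancelˡ ratio≉0 (begin
        Ratio X Y * r      ≈⟨ *-comm _ _ ⟩
        r * Ratio X Y      ≈⟨ h ⟨
        Ratio Y X          ≈⟨ *-cong (+-congʳ (sym X≈Y)) (+-congʳ X≈Y) ⟩
        Ratio X Y          ≈⟨ *-identityʳ _ ⟨
        Ratio X Y * 1#     ∎)
        where
        crosses : Cross X Y ≈ Cross Y X
        crosses = begin
          Cross X Y                          ≈⟨ cross X Y ⟩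
          φ (Ratio X Y) * Ratio Y X          ≈⟨ *-congˡ h ⟩
          φ (Ratio X Y) * (r * Ratio X Y)    ≈⟨ solve 3 (λ a b r → a :* (r :* b) := r :* a :* b) refl _ _ r ⟩
          r * φ (Ratio X Y) * Ratio X Y      ≈⟨ *-congʳ (*-congʳ φr≈r) ⟨
          φ r * φ (Ratio X Y) * Ratio X Y    ≈⟨ *-congʳ (trans (φ.cong h) (φ.*-homo _ _)) ⟨
          φ (Ratio Y X) * Ratio X Y          ≈⟨ cross Y X ⟨
          Cross Y X                          ∎
        X≈Y : X ≈ Y
        X≈Y = Injective-μ.injective inj X∈μ Y∈μ (cross-sym⁻¹ l₁≉l₂ crosses)

  -- For x₁, x₂ on the circle the coordinate satisfies κ̄ = (x₂ / x₁) κ there, so its values form a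
  -- line over GF(q), which a factor r with σ r = r preserves.
  ratio-between-circle-points : ∀ {x₁ x₂ r} → Norm1 x₁ → Norm1 x₂ → ¬ x₁ ≈ x₂ → σ r ≈ r →
    ∃[ X ] ∃[ Y ] Norm1 X × Norm1 Y × Ratio x₁ x₂ Y X ≈ r * Ratio x₁ x₂ X Y × ¬ Ratio x₁ x₂ X Y ≈ 0#
  ratio-between-circle-points {x₁} {x₂} {r} x₁∈μ x₂∈μ x₁≉x₂ r̄≈r =
    X , Y , Norm1-* (Norm1-* x₂∈μ x₂∈μ) (Norm1-σ x₁∈μ) , Y∈μ , ratio-eq , ratio≉0
    where
    d G G′ X Y : Carrier
    d  = x₁ + x₂
    G  = d * r + x₂
    G′ = d * r + x₁
    d≉0 : ¬ d ≈ 0#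
    d≉0 = x₁≉x₂ ∘ +≈0⇒≈
    σ[dr+x] : ∀ x → σ (d * r + x) ≈ (σ x₁ + σ x₂) * r + σ x
    σ[dr+x] x = trans (σ.+-homo _ _) (+-congʳ (trans (σ.*-homo _ _) (*-cong (σ.+-homo _ _) r̄≈r)))
    Ḡ≈ : σ G ≈ σ x₁ * σ x₂ * G′
    Ḡ≈ = trans (σ[dr+x] x₂) (combine₂ (σ x₂ * r + σ x₂) x₁∈μ (σ x₁ * r) x₂∈μ
      (solve 5 (λ x x̄ y ȳ r → (x̄ :+ ȳ) :* r :+ ȳ :+ x̄ :* ȳ :* ((x :+ y) :* r :+ x) :=
        (ȳ :* r :+ ȳ) :* (x :* x̄ :+ :1) :+ x̄ :* r :* (y :* ȳ :+ :1)) refl x₁ (σ x₁) x₂ (σ x₂) r))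
    Ḡ′≈ : σ G′ ≈ σ x₁ * σ x₂ * G
    Ḡ′≈ = trans (σ[dr+x] x₁) (combine₂ (σ x₂ * r) x₁∈μ (σ x₁ * r + σ x₁) x₂∈μ
      (solve 5 (λ x x̄ y ȳ r → (x̄ :+ ȳ) :* r :+ x̄ :+ x̄ :* ȳ :* ((x :+ y) :* r :+ y) :=
        ȳ :* r :* (x :* x̄ :+ :1) :+ (x̄ :* r :+ x̄) :* (y :* ȳ :+ :1)) refl x₁ (σ x₁) x₂ (σ x₂) r))
    G≉0 : ¬ G ≈ 0#
    G≉0 G≈0 = d≉0 (combine₂ 1# G≈0 1# G′≈0
      (solve 3 (λ x y r → x :+ y :+ :0 := :1 :* ((x :+ y) :* r :+ y :+ :0) :+ :1 :* ((x :+ y) :* r :+ x :+ :0)) refl x₁ x₂ r))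
      where
      G′≈0 : G′ ≈ 0#
      G′≈0 = x*y≈0⇒y≈0 (*-≉0 (Norm1⇒≉0 (Norm1-σ x₁∈μ)) (Norm1⇒≉0 (Norm1-σ x₂∈μ)))
        (trans (sym Ḡ≈) (trans (σ.cong G≈0) σ.0-homo))
    i = proj₁ (inverse G≉0)
    -- X = x₂² / x₁ has coordinate d / x₂; solving for the point with coordinate r d / x₂ gives Y =
    -- x₂ G′ / G.
    X = x₂ * x₂ * σ x₁
    Y = G′ * x₂ * i
    YG≈ : Y * G ≈ G′ * x₂
    YG≈ = combine₁ (G′ * x₂) (proj₂ (inverse G≉0)) (solve 3 (λ a i g → a :* i :* g :+ a := a :* (g :* i :+ :1)) refl (G′ * x₂) i G)
    Y∈μ : Norm1 Y
    Y∈μ = *-cancelˡ (*-≉0 G≉0 (σ.≉0 G≉0)) (begin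
      G * σ G * (Y * σ Y)                  ≈⟨ solve 4 (λ g ḡ y ȳ → g :* ḡ :* (y :* ȳ) := y :* g :* (ȳ :* ḡ)) refl G (σ G) Y (σ Y) ⟩
      Y * G * (σ Y * σ G)                  ≈⟨ *-cong YG≈ (trans (sym (σ.*-homo _ _)) (trans (σ.cong YG≈) (σ.*-homo _ _))) ⟩
      G′ * x₂ * (σ G′ * σ x₂)              ≈⟨ *-congˡ (*-congʳ Ḡ′≈) ⟩
      G′ * x₂ * (σ x₁ * σ x₂ * G * σ x₂)   ≈⟨ combine₁ (G′ * G * σ x₁ * σ x₂) x₂∈μ
        (solve 5 (λ x̄ y ȳ g g′ → g′ :* y :* (x̄ :* ȳ :* g :* ȳ) :+ g :* (x̄ :* ȳ :* g′) :=
           g′ :* g :* x̄ :* ȳ :* (y :* ȳ :+ :1)) refl (σ x₁) x₂ (σ x₂) G G′) ⟩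
      G * (σ x₁ * σ x₂ * G′)               ≈⟨ *-congˡ Ḡ≈ ⟨
      G * σ G                              ≈⟨ *-identityʳ _ ⟨
      G * σ G * 1#                         ∎)
    ratio₁ : G * Ratio x₁ x₂ X Y ≈ d * d * d * (x₂ * σ x₁)
    ratio₁ = combine₂ (X + x₁) YG≈ (d * (x₂ * x₁)) x₁∈μ
      (solve 5 (λ x x̄ y r Y → ((x :+ y) :* r :+ y) :* ((y :* y :* x̄ :+ x) :* (Y :+ y)) :+ (x :+ y) :* (x :+ y) :* (x :+ y) :* (y :* x̄) :=
         (y :* y :* x̄ :+ x) :* (Y :* ((x :+ y) :* r :+ y) :+ ((x :+ y) :* r :+ x) :* y) :+ (x :+ y) :* (y :* x) :* (x :* x̄ :+ :1))
        refl x₁ (σ x₁) x₂ r Y)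
    ratio₂ : G * Ratio x₁ x₂ Y X ≈ r * (d * d * d * (x₂ * σ x₁))
    ratio₂ = combine₂ (X + x₂) YG≈ (d * d * r * x₂) x₁∈μ
      (solve 5 (λ x x̄ y r Y → ((x :+ y) :* r :+ y) :* ((Y :+ x) :* (y :* y :* x̄ :+ y)) :+ r :* ((x :+ y) :* (x :+ y) :* (x :+ y) :* (y :* x̄)) :=
         (y :* y :* x̄ :+ y) :* (Y :* ((x :+ y) :* r :+ y) :+ ((x :+ y) :* r :+ x) :* y) :+ (x :+ y) :* (x :+ y) :* r :* y :* (x :* x̄ :+ :1))
        refl x₁ (σ x₁) x₂ r Y)
    ratio-eq : Ratio x₁ x₂ Y X ≈ r * Ratio x₁ x₂ X Y
    ratio-eq = *-cancelˡ G≉0 (trans ratio₂ (trans (*-congˡ (sym ratio₁))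
      (solve 3 (λ g r a → r :* (g :* a) := g :* (r :* a)) refl G r (Ratio x₁ x₂ X Y))))
    ratio≉0 : ¬ Ratio x₁ x₂ X Y ≈ 0#
    ratio≉0 h = *-≉0 (*-≉0 (*-≉0 d≉0 d≉0) d≉0) (*-≉0 (Norm1⇒≉0 x₂∈μ) (Norm1⇒≉0 (Norm1-σ x₁∈μ)))
      (trans (sym ratio₁) (trans (*-congˡ h) (zeroʳ G)))

  -- As x₂ = 1 / x̄₁, the coordinate is a constant multiple of the Möbius parameter X with z = x₁.
  -- The parameters 1 and r therefore give the wanted pair.
  ratio-between-conjugate-points : ∀ {x₁ x₂ r} → ¬ Norm1 x₁ → x₂ * σ x₁ ≈ 1# → ¬ x₁ ≈ x₂ → Norm1 r →
    ∃[ X ] ∃[ Y ] Norm1 X × Norm1 Y × Ratio x₁ x₂ Y X ≈ r * Ratio x₁ x₂ X Y × ¬ Ratio x₁ x₂ X Y ≈ 0#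
  ratio-between-conjugate-points {x₁} {x₂} {r} x₁∉μ x₂x̄₁≈1 x₁≉x₂ r∈μ =
    M₁.x , M₂.x , M₁.x∈μ , M₂.x∈μ , ratio-eq , ratio≉0
    where
    module M₁ = Möbius x₁∉μ Norm1-1
    module M₂ = Möbius x₁∉μ r∈μ
    k : Carrier
    k = (1# + x₁ * σ x₁) * (x₁ + x₂)
    near : ∀ X x H → H ≈ 1# + σ x₁ * X → x * H ≈ X + x₁ → H * (x + x₁) ≈ X * (1# + x₁ * σ x₁)
    near X x H H≈ xH≈ = combine₂ 1# xH≈ x₁ H≈ (solve 5 (λ z z̄ X x h → h :* (x :+ z) :+ X :* (:1 :+ z :* z̄) :=
      :1 :* (x :* h :+ (X :+ z)) :+ z :* (h :+ (:1 :+ z̄ :* X))) refl x₁ (σ x₁) X x H)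
    far : ∀ X x H → H ≈ 1# + σ x₁ * X → x * H ≈ X + x₁ → H * (x + x₂) ≈ x₁ + x₂
    far X x H H≈ xH≈ = combine₃ 1# xH≈ x₂ H≈ X x₂x̄₁≈1 (solve 6 (λ z z̄ y X x h → h :* (x :+ y) :+ (z :+ y) :=
      :1 :* (x :* h :+ (X :+ z)) :+ y :* (h :+ (:1 :+ z̄ :* X)) :+ X :* (y :* z̄ :+ :1)) refl x₁ (σ x₁) x₂ X x H)
    HH≉0 : ¬ M₁.H * M₂.H ≈ 0#
    HH≉0 = *-≉0 M₁.H≉0 M₂.H≉0
    ratio₁ : M₁.H * M₂.H * Ratio x₁ x₂ M₁.x M₂.x ≈ k
    ratio₁ = begin
      M₁.H * M₂.H * ((M₁.x + x₁) * (M₂.x + x₂))   ≈⟨ solve 4 (λ a b p q → a :* b :* (p :* q) := a :* p :* (b :* q)) refl M₁.H M₂.H _ _ ⟩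
      M₁.H * (M₁.x + x₁) * (M₂.H * (M₂.x + x₂))   ≈⟨ *-cong (near 1# M₁.x M₁.H refl M₁.xH≈X+z) (far r M₂.x M₂.H refl M₂.xH≈X+z) ⟩
      1# * (1# + x₁ * σ x₁) * (x₁ + x₂)           ≈⟨ *-congʳ (*-identityˡ _) ⟩
      k                                           ∎
    ratio₂ : M₁.H * M₂.H * Ratio x₁ x₂ M₂.x M₁.x ≈ r * k
    ratio₂ = begin
      M₁.H * M₂.H * ((M₂.x + x₁) * (M₁.x + x₂))   ≈⟨ solve 4 (λ a b p q → a :* b :* (p :* q) := b :* p :* (a :* q)) refl M₁.H M₂.H _ _ ⟩
      M₂.H * (M₂.x + x₁) * (M₁.H * (M₁.x + x₂))   ≈⟨ *-cong (near r M₂.x M₂.H refl M₂.xH≈X+z) (far 1# M₁.x M₁.H refl M₁.xH≈X+z) ⟩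
      r * (1# + x₁ * σ x₁) * (x₁ + x₂)            ≈⟨ *-assoc _ _ _ ⟩
      r * k                                       ∎
    ratio-eq : Ratio x₁ x₂ M₂.x M₁.x ≈ r * Ratio x₁ x₂ M₁.x M₂.x
    ratio-eq = *-cancelˡ HH≉0 (trans ratio₂ (trans (*-congˡ (sym ratio₁))
      (solve 3 (λ g r a → r :* (g :* a) := g :* (r :* a)) refl _ r _)))
    ratio≉0 : ¬ Ratio x₁ x₂ M₁.x M₂.x ≈ 0#
    ratio≉0 h = *-≉0 (x₁∉μ ∘ sym ∘ +≈0⇒≈) (x₁≉x₂ ∘ +≈0⇒≈) (trans (sym ratio₁) (trans (*-congˡ h) (zeroʳ _)))

  module Criterion (b≉0 : ¬ b ≈ 0#) {w} (ew≈1 : e * w ≈ 1#) (balanced : Balanced)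
                   (φ-onto : ∀ y → ∃[ x ] φ x ≈ y) where
    open RamificationPoints b≉0 ew≈1 public

    δ : Carrier → Carrier
    δ = shift balanced

    module _ {s} (as : ArtinSchreier s) where

      private
        x₁ x₂ : Carrier
        x₁ = proj₁ (φ-onto (root s))
        x₂ = proj₁ (φ-onto (root (s + 1#)))

        φx₁≈ : φ x₁ ≈ root s
        φx₁≈ = proj₂ (φ-onto (root s))

        φx₂≈ : φ x₂ ≈ root (s + 1#)
        φx₂≈ = proj₂ (φ-onto (root (s + 1#)))

        as₂ : ArtinSchreier (s + 1#)
        as₂ = artinSchreier-+1 as

        x₁≉x₂ : ¬ x₁ ≈ x₂
        x₁≉x₂ h = root≉root+1 s (trans (sym φx₁≈) (trans (φ.cong h) φx₂≈))

        module V₁ = Value balanced as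
        module V₂ = Value balanced as₂

        refactor : ∀ {t z l y} → φ z ≈ t → (∀ X → N X + l * D X ≈ (φ X + t) * (X + y)) →
                   ∀ X → N X + l * D X ≈ (φ X + φ z) * (X + y)
        refactor φz≈t f X = trans (f X) (*-congʳ (+-congˡ (sym φz≈t)))

        -- The relation y = c̄ + l b recovers y from its level l = t y.
        levels-differ : ∀ {y y′ t t′} → ¬ y ≈ y′ → y ≈ σ c + t * y * b → y′ ≈ σ c + t′ * y′ * b → ¬ t * y ≈ t′ * y′
        levels-differ y≉y′ h h′ ty≈t′y′ = y≉y′ (trans h (trans (+-congˡ (*-congʳ ty≈t′y′)) (sym h′)))

        rational-conjugates : σ s ≈ s → x₂ * σ x₁ ≈ 1# × x₁ * σ x₂ ≈ 1#
        rational-conjugates s̄≈s = swap-conj x₁x̄₂≈1 , x₁x̄₂≈1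
          where
          swap-conj : ∀ {x y} → x * σ y ≈ 1# → y * σ x ≈ 1#
          swap-conj {x} {y} h = begin
            y * σ x          ≈⟨ *-congʳ (σσ y) ⟨
            σ (σ y) * σ x    ≈⟨ σ.*-homo _ _ ⟨
            σ (σ y * x)      ≈⟨ trans (σ.cong (trans (*-comm _ _) h)) σ.1-homo ⟩
            1#               ∎
          x₁x̄₂≈1 : x₁ * σ x₂ ≈ 1#
          x₁x̄₂≈1 = φ.injective (begin
            φ (x₁ * σ x₂)               ≈⟨ φ.*-homo _ _ ⟩
            φ x₁ * φ (σ x₂)             ≈⟨ *-cong φx₁≈ (trans (sym (σφ x₂)) (σ.cong φx₂≈)) ⟩
            root s * σ (root (s + 1#))  ≈⟨ conjugate-roots as (trans (σ.+-homo _ _) (+-cong s̄≈s σ.1-homo)) ⟩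
            1#                          ≈⟨ φ.1-homo ⟨
            φ 1#                        ∎)

        x∈μ : ∀ {s} → ArtinSchreier s → σ s ≈ s + 1# → ∀ {x} → φ x ≈ root s → Norm1 x
        x∈μ as s̄≈s+1 h = Norm1-φ⁻¹ (trans (*-cong h (σ.cong h)) (conjugate-roots as s̄≈s+1))

        x∉μ : ∀ {s} → ArtinSchreier s → σ s ≈ s → ∀ {x} → φ x ≈ root s → ¬ Norm1 x
        x∉μ as s̄≈s h x∈μ = rational-root as s̄≈s (trans (*-cong (sym h) (σ.cong (sym h))) (Norm1-φ x∈μ))

        σ[s+1]≈ : ∀ {r} → σ s ≈ r → σ (s + 1#) ≈ r + 1#
        σ[s+1]≈ h = trans (σ.+-homo _ _) (+-cong h σ.1-homo)

        shifted : ∀ {s′ s″ d x} → φ x ≈ root s″ → s″ ≈ s′ + 1# + d → δ s′ ≈ d → φ x ≈ root (s′ + 1# + δ s′)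
        shifted h eq δ≈d = trans h (root-cong (trans eq (+-congˡ (sym δ≈d))))

      module Power (δ≈1 : δ s ≈ 1#) where
        private
          h₁ : φ x₁ ≈ root (s + 1# + δ s)
          h₁ = shifted φx₁≈ (solve 1 (λ s → s := s :+ :1 :+ :1) refl s) δ≈1
          h₂ : φ x₂ ≈ root (s + 1# + 1# + δ (s + 1#))
          h₂ = shifted φx₂≈ (solve 1 (λ s → s :+ :1 := s :+ :1 :+ :1 :+ :1) refl s) (trans (shift-+1 balanced s) δ≈1)
          factor₁ = refactor φx₁≈ (V₁.factor h₁)
          factor₂ = refactor φx₂≈ (V₂.factor h₂)

        sufficient : (∀ {x y} → ¬ x ≈ 0# → ¬ y ≈ 0# → (σ s ≈ s → x * σ x ≈ y * σ y) → x * φ x ≈ y * φ y → x ≈ y) →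
                     Injective-μ
        sufficient cancel = power-map⇒injective x₁ x₂ x₁≉x₂ factor₁ factor₂
          (λ X∈μ Y∈μ p q → cancel p q (λ s̄≈s →
             Ratio-norm x₁ x₂ (proj₁ (rational-conjugates s̄≈s)) (proj₂ (rational-conjugates s̄≈s)) X∈μ Y∈μ))

        ¬injective : σ s ≈ s + 1# → ∀ {r} → σ r ≈ r → r * φ r ≈ 1# → ¬ r ≈ 1# → ¬ Injective-μ
        ¬injective s̄≈s+1 r̄≈r rφr≈1 r≉1 inj =
          let _ , _ , X∈μ , Y∈μ , ratio , ratio≉0 = ratio-between-circle-points
                (x∈μ as s̄≈s+1 φx₁≈) (x∈μ as₂ (σ[s+1]≈ s̄≈s+1) φx₂≈) x₁≉x₂ r̄≈r
          in r≉1 (power-map-collision x₁ x₂ x₁≉x₂ factor₁ factor₂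
               (levels-differ x₁≉x₂ (V₁.y≈c̄+tyb h₁) (V₂.y≈c̄+tyb h₂)) inj X∈μ Y∈μ ratio rφr≈1 ratio≉0)

      module Quotient (δ≈0 : δ s ≈ 0#) where
        private
          h₁ : φ x₂ ≈ root (s + 1# + δ s)
          h₁ = shifted φx₂≈ (sym (+-identityʳ _)) δ≈0
          h₂ : φ x₁ ≈ root (s + 1# + 1# + δ (s + 1#))
          h₂ = shifted φx₁≈ (solve 1 (λ s → s := s :+ :1 :+ :1 :+ :0) refl s) (trans (shift-+1 balanced s) δ≈0)
          factor₁ = refactor φx₁≈ (V₁.factor h₁)
          factor₂ = refactor φx₂≈ (V₂.factor h₂)

        sufficient : σ s ≈ s →
          (∀ {x y} → ¬ x ≈ 0# → ¬ y ≈ 0# → x * σ x ≈ y * σ y → φ x * y ≈ φ y * x → x ≈ y) → Injective-μ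
        sufficient s̄≈s cancel = quotient-map⇒injective x₁ x₂ x₁≉x₂ factor₁ factor₂
          (x∉μ as s̄≈s φx₁≈) (x∉μ as₂ (σ[s+1]≈ s̄≈s) φx₂≈)
          (λ X∈μ Y∈μ p q → cancel p q
             (Ratio-norm x₁ x₂ (proj₁ (rational-conjugates s̄≈s)) (proj₂ (rational-conjugates s̄≈s)) X∈μ Y∈μ))

        ¬injective : σ s ≈ s → ∀ {r} → Norm1 r → φ r ≈ r → ¬ r ≈ 1# → ¬ Injective-μ
        ¬injective s̄≈s r∈μ φr≈r r≉1 inj =
          let _ , _ , X∈μ , Y∈μ , ratio , ratio≉0 = ratio-between-conjugate-points
                (x∉μ as s̄≈s φx₁≈) (proj₁ (rational-conjugates s̄≈s)) x₁≉x₂ r∈μ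
          in r≉1 (quotient-map-collision x₁ x₂ x₁≉x₂ factor₁ factor₂
               (levels-differ (x₁≉x₂ ∘ sym) (V₁.y≈c̄+tyb h₁) (V₂.y≈c̄+tyb h₂)) inj X∈μ Y∈μ ratio φr≈r ratio≉0)

        -- Injectivity makes the ramification point x₁ on the circle its own second fibre point,
        -- while δ = 0 makes that point x₂.
        ¬injective′ : σ s ≈ s + 1# → ¬ Injective-μ
        ¬injective′ s̄≈s+1 inj = x₁≉x₂ (*-cancelˡ V₁.1+bt≉0 (begin
          (1# + b * root s) * x₁   ≈⟨ *-comm _ _ ⟩
          x₁ * (1# + b * root s)   ≈⟨ Ramified.x[1+bt]≈c̄ inj (conjugate-roots as s̄≈s+1) (isRoot as) φx₁≈ ⟩
          σ c                      ≈⟨ V₁.y[1+bt]≈c̄ h₁ ⟨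
          x₂ * (1# + b * root s)   ≈⟨ *-comm _ _ ⟩
          (1# + b * root s) * x₂   ∎))

-- Finite fields: pigeonhole, Fermat, power sums, Frobenius maps.

Fin-injective⇒surjective : ∀ {n} {f : Fin n → Fin n} → Injective _≡_ _≡_ f → ∀ y → ∃[ x ] f x ≡ y
Fin-injective⇒surjective {suc n} {f} f-inj y with Fin.any? (λ x → f x Fin.≟ y)
... | yes hit = hit
... | no miss = contradiction (Fin.injective⇒≤ {f = λ x → punchOut (y≢f x)}
        (f-inj ∘ Fin.punchOut-injective (y≢f _) (y≢f _))) (ℕ.<⇒≱ (ℕ.n<1+n n))
  where
  y≢f : ∀ x → y ≢ f x
  y≢f x y≡fx = miss (x , ≡.sym y≡fx)

Fin-injective⇒permutation : ∀ {n} (f : Fin n → Fin n) → Injective _≡_ _≡_ f → Permutation′ n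
Fin-injective⇒permutation f f-inj = permutation f (proj₁ ∘ onto)
  (proj₂ ∘ onto) (λ x → f-inj (proj₂ (onto (f x))))
  where onto = Fin-injective⇒surjective f-inj

module FiniteField {a r s} (F : HeytingField a r s) {n j}
  (card : HasCardinality F (suc n)) (size : suc n ≡ 2 ℕ.^ j) where

  open FieldNotation F
  open CommutativeRing commutativeRing hiding (Carrier; _≈_; _+_; _*_; 0#; 1#; zero)
  open HeytingField F using (#⇒invertible; tight)
  open import Relation.Binary.Reasoning.Setoid setoid
  open Exp commutativeSemiring using (^-congˡ; ^-congʳ; ^-homo-*; ^-assocʳ; ^-distrib-*)
  open Mult semiring using (×1-homo-*)
  private
    module card = Bijection card
    module HCR = HCRProperties heytingCommutativeRing

  elem : Fin (suc n) → Carrier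
  elem i = proj₁ (card.surjective i)

  index : Carrier → Fin (suc n)
  index = card.to

  index-elem : ∀ i → index (elem i) ≡ i
  index-elem i = proj₂ (card.surjective i) refl

  elem-index : ∀ x → elem (index x) ≈ x
  elem-index x = card.injective (index-elem (index x))

  elem-injective : ∀ {i j} → elem i ≈ elem j → i ≡ j
  elem-injective {i} {j} h = ≡.trans (≡.sym (index-elem i)) (≡.trans (card.cong h) (index-elem j))

  infix 4 _≟_
  abstract
    _≟_ : Decidable _≈_
    x ≟ y = map′ card.injective card.cong (index x Fin.≟ index y)

    1≉0 : ¬ 1# ≈ 0#
    1≉0 1≈0 = proj₂ (tight 1# 0#) 1≈0 HCR.1#0

  invertible⇒#0 : ∀ {x y} → x * y ≈ 1# → x # 0#
  invertible⇒#0 {x} {y} xy≈1 = HCR.invertibleʳ⇒# (y , trans (*-congʳ (HCR.x-0≈x x)) xy≈1)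

  abstract
    -- Apartness supplies inverses only from x # 0. Finiteness lets a search decide whether an
    -- inverse exists, and tightness turns its failure into x ≈ 0.
    inverse : ∀ {x} → ¬ x ≈ 0# → ∃ λ y → x * y ≈ 1#
    inverse {x} x≉0 with Fin.any? (λ i → x * elem i ≟ 1#)
    ... | yes (i , h) = elem i , h
    ... | no ¬inv     = contradiction (proj₁ (tight x 0#) λ x#0 → ¬inv
            (index (1/ x#0) , trans (*-congˡ (elem-index _)) (1/-inverse x#0))) x≉0

  ≉0⇒#0 : ∀ {x} → ¬ x ≈ 0# → x # 0#
  ≉0⇒#0 x≉0 = invertible⇒#0 (proj₂ (inverse x≉0))

  private
    transport : (H : Carrier → Carrier) → Fin (suc n) → Fin (suc n)
    transport H i = index (H (elem i))

    transport-injective : ∀ {H} → Injective _≈_ _≈_ H → Injective _≡_ _≡_ (transport H)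
    transport-injective H-inj h = elem-injective (H-inj (card.injective h))

  injective⇒surjective : ∀ {H} → (∀ {x y} → x ≈ y → H x ≈ H y) → Injective _≈_ _≈_ H → Surjective _≈_ _≈_ H
  injective⇒surjective H-cong H-inj y with i , h ← Fin-injective⇒surjective (transport-injective H-inj) (index y) =
    elem i , λ z≈ → trans (H-cong z≈) (card.injective h)

  module Reindexing {c ℓ} (M : CommutativeMonoid c ℓ) where
    private module M = CommutativeMonoid M
    open CommutativeMonoidSum M

    reindex : ∀ {g : Carrier → M.Carrier} → (∀ {x y} → x ≈ y → g x M.≈ g y) →
              ∀ {H} → Injective _≈_ _≈_ H → sum (g ∘ elem) M.≈ sum (g ∘ H ∘ elem)
    reindex {g} g-cong {H} H-inj = M.trans
      (sum-permute (g ∘ elem) (Fin-injective⇒permutation _ (transport-injective H-inj)))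
      (sum-cong-≋ (λ i → g-cong (elem-index (H (elem i)))))

  private
    module Σ = SemiringSum semiring
    module Π = CommutativeMonoidSum *-commutativeMonoid

  abstract
    ∑ : (Carrier → Carrier) → Carrier
    ∑ g = Σ.sum (g ∘ elem)

    ∑-def : ∀ g → ∑ g ≈ Σ.sum (g ∘ elem)
    ∑-def g = refl

    ∑-cong : ∀ {g h} → (∀ x → g x ≈ h x) → ∑ g ≈ ∑ h
    ∑-cong g≈h = Σ.sum-cong-≋ (λ i → g≈h (elem i))

    ∑-+ : ∀ g h → ∑ (λ x → g x + h x) ≈ ∑ g + ∑ h
    ∑-+ g h = Σ.∑-distrib-+ (g ∘ elem) (h ∘ elem)

    ∑-* : ∀ k g → ∑ (λ x → k * g x) ≈ k * ∑ g
    ∑-* k g = sym (Σ.*-distribˡ-sum k (g ∘ elem))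

    ∑-reindex : ∀ {g} → (∀ {x y} → x ≈ y → g x ≈ g y) → ∀ {H} → Injective _≈_ _≈_ H → ∑ g ≈ ∑ (g ∘ H)
    ∑-reindex g-cong H-inj = Reindexing.reindex +-commutativeMonoid g-cong H-inj

  -- Translation by 1 permutes the field, so the sum of all elements does not change when
  -- `suc n · 1#` is added to it.
  cardinality·1≈0 : suc n · 1# ≈ 0#
  cardinality·1≈0 = begin
    suc n · 1#                          ≈⟨ +-identityˡ _ ⟨
    0# + suc n · 1#                     ≈⟨ +-congʳ (-‿inverseˡ (∑ id)) ⟨
    - ∑ id + ∑ id + suc n · 1#          ≈⟨ +-assoc _ _ _ ⟩
    - ∑ id + (∑ id + suc n · 1#)        ≈⟨ +-congˡ (+-congˡ (trans (∑-def _) (Σ.sum-replicate (suc n)))) ⟨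
    - ∑ id + (∑ id + ∑ (λ _ → 1#))      ≈⟨ +-congˡ (∑-+ id (λ _ → 1#)) ⟨
    - ∑ id + ∑ (_+ 1#)                  ≈⟨ +-congˡ (∑-reindex id (+-cancelʳ 1# _ _)) ⟨
    - ∑ id + ∑ id                       ≈⟨ -‿inverseˡ (∑ id) ⟩
    0#                                  ∎
    where open import Algebra.Properties.AbelianGroup +-abelianGroup renaming (∙-cancelʳ to +-cancelʳ)

  abstract
    -- Were 2 invertible, 1 = (2 · ½)^j = 2^j · ½^j would be 0.
    1+1≈0 : 1# + 1# ≈ 0#
    1+1≈0 with 1# + 1# ≟ 0#
    ... | yes h = h
    ... | no  h = contradiction (begin
        1#                           ≈⟨ ^-one j ⟨
        1# ^ j                       ≈⟨ ^-congˡ j (proj₂ (inverse h)) ⟨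
        ((1# + 1#) * ½) ^ j          ≈⟨ ^-distrib-* (1# + 1#) ½ j ⟩
        (1# + 1#) ^ j * ½ ^ j        ≈⟨ *-congʳ (2^j·1≈[1+1]^j j) ⟨
        (2 ℕ.^ j) · 1# * ½ ^ j       ≈⟨ *-congʳ (reflexive (≡.cong (_· 1#) size)) ⟨
        suc n · 1# * ½ ^ j           ≈⟨ *-congʳ cardinality·1≈0 ⟩
        0# * ½ ^ j                   ≈⟨ zeroˡ _ ⟩
        0#                           ∎) 1≉0
      where
      ½ : Carrier
      ½ = proj₁ (inverse h)
      ^-one : ∀ i → 1# ^ i ≈ 1#
      ^-one zero    = refl
      ^-one (suc i) = trans (*-identityˡ _) (^-one i)
      2^j·1≈[1+1]^j : ∀ i → (2 ℕ.^ i) · 1# ≈ (1# + 1#) ^ i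
      2^j·1≈[1+1]^j zero    = +-identityʳ 1#
      2^j·1≈[1+1]^j (suc i) = trans (×1-homo-* 2 (2 ℕ.^ i))
        (*-cong (+-congˡ (+-identityʳ 1#)) (2^j·1≈[1+1]^j i))

  discreteChar2Field : DiscreteChar2Field a r
  discreteChar2Field = record
    { commutativeRing = commutativeRing ; 1+1≈0 = 1+1≈0 ; 1≉0 = 1≉0 ; inverse = inverse ; _≟_ = _≟_ }

  open Char2Field discreteChar2Field public
  open Char2Solver discreteChar2Field

  ^-≉0 : ∀ {x} → ¬ x ≈ 0# → ∀ j → ¬ x ^ j ≈ 0#
  ^-≉0 x≉0 zero    = 1≉0
  ^-≉0 x≉0 (suc j) = *-≉0 x≉0 (^-≉0 x≉0 j)

  -- Multiplication by x permutes the units and fixes their product. To multiply over the whole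
  -- field, `units` and `weight` take the value 1 at 0.
  fermat : ∀ {x} → ¬ x ≈ 0# → x ^ n ≈ 1#
  fermat {x} x≉0 = trans (trans (sym (Π.sum-replicate n)) (sym ∏weight)) (*-cancelˡ ∏units≉0 (begin
    Π.sum (units ∘ elem) * Π.sum (weight ∘ elem)        ≈⟨ Π.∑-distrib-+ (units ∘ elem) (weight ∘ elem) ⟨
    Π.sum (λ i → units (elem i) * weight (elem i))      ≈⟨ Π.sum-cong-≋ (λ i → units-* (elem i)) ⟨
    Π.sum (units ∘ (x *_) ∘ elem)                       ≈⟨ Reindexing.reindex *-commutativeMonoid units-cong (*-cancelˡ x≉0) ⟨
    Π.sum (units ∘ elem)                                ≈⟨ *-identityʳ _ ⟨
    Π.sum (units ∘ elem) * 1#                           ∎))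
    where
    unless-zero : ∀ y → Carrier → Dec (y ≈ 0#) → Carrier
    unless-zero y w (yes _) = 1#
    unless-zero y w (no _)  = w
    units weight : Carrier → Carrier
    units  y = unless-zero y y (y ≟ 0#)
    weight y = unless-zero y x (y ≟ 0#)
    units-cong : ∀ {y z} → y ≈ z → units y ≈ units z
    units-cong {y} {z} y≈z with y ≟ 0# | z ≟ 0#
    ... | yes _   | yes _   = refl
    ... | yes y≈0 | no z≉0  = contradiction (trans (sym y≈z) y≈0) z≉0
    ... | no y≉0  | yes z≈0 = contradiction (trans y≈z z≈0) y≉0
    ... | no _    | no _    = y≈z
    units-* : ∀ y → units (x * y) ≈ units y * weight y
    units-* y with y ≟ 0# | x * y ≟ 0#
    ... | yes _   | yes _    = sym (*-identityˡ 1#)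
    ... | yes y≈0 | no xy≉0  = contradiction (trans (*-congˡ y≈0) (zeroʳ x)) xy≉0
    ... | no y≉0  | yes xy≈0 = contradiction xy≈0 (*-≉0 x≉0 y≉0)
    ... | no _    | no _     = *-comm x y
    units≉0 : ∀ y → ¬ units y ≈ 0#
    units≉0 y with y ≟ 0#
    ... | yes _  = 1≉0
    ... | no y≉0 = y≉0
    ∏≉0 : ∀ {j} (t : Fin j → Carrier) → (∀ i → ¬ t i ≈ 0#) → ¬ Π.sum t ≈ 0#
    ∏≉0 {zero}  t t≉0 = 1≉0
    ∏≉0 {suc j} t t≉0 = *-≉0 (t≉0 zero) (∏≉0 (t ∘ suc) (t≉0 ∘ suc))
    ∏units≉0 : ¬ Π.sum (units ∘ elem) ≈ 0#
    ∏units≉0 = ∏≉0 (units ∘ elem) (units≉0 ∘ elem)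
    weight-0 : weight (elem (index 0#)) ≈ 1#
    weight-0 with elem (index 0#) ≟ 0#
    ... | yes _ = refl
    ... | no h  = contradiction (elem-index 0#) h
    weight-≉0 : ∀ {y} → ¬ y ≈ 0# → weight y ≈ x
    weight-≉0 {y} y≉0 with y ≟ 0#
    ... | yes y≈0 = contradiction y≈0 y≉0
    ... | no _    = refl
    ∏weight : Π.sum (weight ∘ elem) ≈ Π.sum {n} (λ _ → x)
    ∏weight = trans (Π.sum-remove {i = index 0#} (weight ∘ elem)) (trans (*-congʳ weight-0) (trans (*-identityˡ _)
      (Π.sum-cong-≋ (λ i → weight-≉0 (λ h → Fin.punchInᵢ≢i (index 0#) i
        (elem-injective (trans h (sym (elem-index 0#)))))))))

  frobenius-id : ∀ x → x ^ suc n ≈ x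
  frobenius-id x with x ≟ 0#
  ... | yes x≈0 = trans (trans (*-congʳ x≈0) (zeroˡ _)) (sym x≈0)
  ... | no x≉0  = trans (*-congˡ (fermat x≉0)) (*-identityʳ x)

  ^-≈1 : ∀ {x} → x ≈ 1# → ∀ i → x ^ i ≈ 1#
  ^-≈1 h zero    = refl
  ^-≈1 h (suc i) = trans (*-cong h (^-≈1 h i)) (*-identityˡ 1#)

  -- Otherwise X + X^(i+1), of degree at most n, would vanish at all n + 1 elements. This replaces a
  -- primitive element.
  ∃^≉1 : ∀ {i} → .{{NonZero i}} → i ℕ.< n → ∃[ x ] ¬ x ≈ 0# × ¬ x ^ i ≈ 1#
  ∃^≉1 {suc i} 1+i<n with Fin.any? (λ k → ¬? (elem k ≟ 0#) ×-dec ¬? (elem k ^ suc i ≟ 1#))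
  ... | yes (k , p) = elem k , p
  ... | no  none    = contradiction (all-roots ∘ elem ∘ (λ k → inject≤ k (ℕ.s≤s 1+i<n)))
      (too-many-roots x+x^[2+i] _ (Fin.inject≤-injective _ _ _ _ ∘ elem-injective))
    where
    x^_ : ∀ i → Vec Carrier i
    x^ i = Vec.replicate i 0#
    eval-x^ : ∀ i x → eval (x^ i) x ≈ x ^ i
    eval-x^ zero    x = refl
    eval-x^ (suc i) x = trans (+-identityˡ _) (*-congˡ (eval-x^ i x))
    x+x^[2+i] : Vec Carrier (suc (suc i))
    x+x^[2+i] = 0# ∷ 1# ∷ x^ i
    ^≈1 : ∀ x → ¬ x ≈ 0# → x ^ suc i ≈ 1#
    ^≈1 x x≉0 with x ^ suc i ≟ 1#
    ... | yes h = h
    ... | no  h = contradiction (index x , (λ e≈0 → x≉0 (trans (sym (elem-index x)) e≈0)) ,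
                    (λ e^≈1 → h (trans (^-congˡ (suc i) (sym (elem-index x))) e^≈1))) none
    all-roots : ∀ x → eval x+x^[2+i] x ≈ 0#
    all-roots x with x ≟ 0#
    ... | yes x≈0 = trans (+-identityˡ _) (trans (*-congʳ x≈0) (zeroˡ _))
    ... | no  x≉0 = begin
      0# + x * (1# + x * eval (x^ i) x)   ≈⟨ +-identityˡ _ ⟩
      x * (1# + x * eval (x^ i) x)        ≈⟨ *-congˡ (+-congˡ (*-congˡ (eval-x^ i x))) ⟩
      x * (1# + x ^ suc i)                ≈⟨ *-congˡ (trans (+-congˡ (^≈1 x x≉0)) 1+1≈0) ⟩
      x * 0#                              ≈⟨ zeroʳ x ⟩
      0#                                  ∎

  module _ .{{_ : NonZero n}} where

    -- Reindexing by x ↦ z x scales the sum by z^i; reducing i modulo n, `∃^≉1` provides a z with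
    -- z^i ≠ 1.
    ∑^≈0 : ∀ {i} → ¬ n ∣ i → ∑ (_^ i) ≈ 0#
    ∑^≈0 {i} n∤i = x*y≈0⇒y≈0 (z^i≉1 ∘ +≈0⇒≈) (trans
      (trans (distribʳ _ _ _) (+-congˡ (*-identityˡ _)))
      (≈⇒+≈0 (begin
        z ^ i * ∑ (_^ i)              ≈⟨ ∑-* (z ^ i) (_^ i) ⟨
        ∑ (λ x → z ^ i * x ^ i)       ≈⟨ ∑-cong (λ x → ^-distrib-* z x i) ⟨
        ∑ (λ x → (z * x) ^ i)         ≈⟨ ∑-reindex (^-congˡ i) (*-cancelˡ z≉0) ⟨
        ∑ (_^ i)                      ∎)))
      where
      instance
        r≢0 : NonZero (i % n)
        r≢0 = ℕ.≢-nonZero (n∤i ∘ m%n≡0⇒n∣m i n)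
      nonroot = ∃^≉1 (m%n<n i n)
      z = proj₁ nonroot
      z≉0 = proj₁ (proj₂ nonroot)
      z^i≉1 : ¬ z ^ i ≈ 1#
      z^i≉1 h = proj₂ (proj₂ nonroot) (begin
        z ^ (i % n)                              ≈⟨ *-identityʳ _ ⟨
        z ^ (i % n) * 1#                         ≈⟨ *-congˡ (^-≈1 (fermat z≉0) (i / n)) ⟨
        z ^ (i % n) * (z ^ n) ^ (i / n)          ≈⟨ *-congˡ (^-assocʳ z n (i / n)) ⟩
        z ^ (i % n) * z ^ (n ℕ.* (i / n))        ≈⟨ ^-homo-* z (i % n) (n ℕ.* (i / n)) ⟨
        z ^ (i % n ℕ.+ n ℕ.* (i / n))            ≡⟨ ≡.cong (λ j → z ^ (i % n ℕ.+ j)) (ℕ.*-comm n (i / n)) ⟩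
        z ^ (i % n ℕ.+ (i / n) ℕ.* n)            ≡⟨ ≡.cong (z ^_) (m≡m%n+[m/n]*n i n) ⟨
        z ^ i                                    ≈⟨ h ⟩
        1#                                       ∎)

  -- The units contribute 1 each and 0 contributes 0, as i is positive; n · 1 = 1 because (n + 1) ·
  -- 1 = 0.
  ∑^≈1 : ∀ {i} .{{_ : NonZero i}} → n ∣ i → ∑ (_^ i) ≈ 1#
  ∑^≈1 {i = i} (divides t ≡.refl) = begin
    ∑ (_^ i)                    ≈⟨ trans (∑-def (_^ i)) (Σ.sum-remove {i = index 0#} ((_^ i) ∘ elem)) ⟩
    elem (index 0#) ^ i + Σ.sum (λ k → elem (punchIn (index 0#) k) ^ i)
                                ≈⟨ +-cong (trans (^-congˡ i (elem-index 0#)) (0^ i)) (Σ.sum-cong-≋ (λ k → ^i≈1 (nonzero k))) ⟩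
    0# + Σ.sum {n} (λ _ → 1#)   ≈⟨ +-identityˡ _ ⟩
    Σ.sum {n} (λ _ → 1#)        ≈⟨ Σ.sum-replicate n ⟩
    n · 1#                      ≈⟨ +≈0⇒≈ (trans (+-comm _ _) cardinality·1≈0) ⟩
    1#                          ∎
    where
    0^ : ∀ i .{{_ : NonZero i}} → 0# ^ i ≈ 0#
    0^ (suc i) = zeroˡ _
    nonzero : ∀ k → ¬ elem (punchIn (index 0#) k) ≈ 0#
    nonzero k h = Fin.punchInᵢ≢i (index 0#) k (elem-injective (trans h (sym (elem-index 0#))))
    ^i≈1 : ∀ {x} → ¬ x ≈ 0# → x ^ i ≈ 1#
    ^i≈1 {x} x≉0 = trans (^-congʳ x (ℕ.*-comm t n)) (trans (sym (^-assocʳ x n t)) (^-≈1 (fermat x≉0) t))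

  ^2^-+-homo : ∀ i x y → (x + y) ^ (2 ℕ.^ i) ≈ x ^ (2 ℕ.^ i) + y ^ (2 ℕ.^ i)
  ^2^-+-homo zero    x y = trans (*-identityʳ _) (+-cong (sym (*-identityʳ x)) (sym (*-identityʳ y)))
  ^2^-+-homo (suc i) x y = begin
    (x + y) ^ (2 ℕ.* 2 ℕ.^ i)                      ≈⟨ ^-assocʳ (x + y) 2 (2 ℕ.^ i) ⟨
    ((x + y) ^ 2) ^ (2 ℕ.^ i)                      ≈⟨ ^-congˡ (2 ℕ.^ i) (solve 2 (λ x y →
      (x :+ y) :* ((x :+ y) :* :1) := x :* (x :* :1) :+ y :* (y :* :1)) refl x y) ⟩
    (x ^ 2 + y ^ 2) ^ (2 ℕ.^ i)                    ≈⟨ ^2^-+-homo i (x ^ 2) (y ^ 2) ⟩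
    (x ^ 2) ^ (2 ℕ.^ i) + (y ^ 2) ^ (2 ℕ.^ i)      ≈⟨ +-cong (^-assocʳ x 2 (2 ℕ.^ i)) (^-assocʳ y 2 (2 ℕ.^ i)) ⟩
    x ^ (2 ℕ.* 2 ℕ.^ i) + y ^ (2 ℕ.* 2 ℕ.^ i)      ∎

  frobenius : ℕ → Endomorphism
  frobenius i = record
    { ⟦_⟧    = _^ (2 ℕ.^ i)
    ; cong   = ^-congˡ (2 ℕ.^ i)
    ; +-homo = ^2^-+-homo i
    ; *-homo = λ x y → ^-distrib-* x y (2 ℕ.^ i)
    ; 1-homo = ^-≈1 refl (2 ℕ.^ i)
    }

  endomorphism-surjective : ∀ (f : Endomorphism) → let open Endomorphism f in ∀ y → ∃[ x ] ⟦ x ⟧ ≈ y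
  endomorphism-surjective f y =
    let x , h = injective⇒surjective (Endomorphism.cong f) (Endomorphism.injective f) y in x , h refl

-- Arithmetic of the parities of k/m and ℓ/m.

Even Odd : ℕ → Set
Even n = ∃[ j ] n ≡ j ℕ.+ j
Odd  n = ∃[ j ] n ≡ suc (j ℕ.+ j)

even⊎odd : ∀ n → Even n ⊎ Odd n
even⊎odd zero = inj₁ (0 , ≡.refl)
even⊎odd (suc n) with even⊎odd n
... | inj₁ (j , ≡.refl) = inj₂ (j , ≡.refl)
... | inj₂ (j , ≡.refl) = inj₁ (suc j , ≡.cong suc (≡.sym (ℕ.+-suc j j)))

-- With a = x + 1, the base a is -1 modulo a + 1. The witness in the step comes from a² = 1 + x (a +
-- 1).
even-power≡1 : ∀ x j → ∃[ t ] suc x ℕ.^ (j ℕ.+ j) ≡ 1 ℕ.+ t ℕ.* (2 ℕ.+ x)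
even-power≡1 x zero = 0 , ≡.refl
even-power≡1 x (suc j) with t , eq ← even-power≡1 x j = x ℕ.+ suc x ℕ.* suc x ℕ.* t , (begin
  suc x ℕ.* suc x ℕ.^ (j ℕ.+ suc j)              ≡⟨ ≡.cong (λ i → suc x ℕ.* suc x ℕ.^ i) (ℕ.+-suc j j) ⟩
  suc x ℕ.* (suc x ℕ.* suc x ℕ.^ (j ℕ.+ j))      ≡⟨ ≡.cong (λ y → suc x ℕ.* (suc x ℕ.* y)) eq ⟩
  suc x ℕ.* (suc x ℕ.* (1 ℕ.+ t ℕ.* (2 ℕ.+ x)))  ≡⟨ solve 2 (λ x t →
    (con 1 :+ x) :* ((con 1 :+ x) :* (con 1 :+ t :* (con 2 :+ x))) :=
    con 1 :+ (x :+ (con 1 :+ x) :* (con 1 :+ x) :* t) :* (con 2 :+ x)) ≡.refl x t ⟩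
  1 ℕ.+ (x ℕ.+ suc x ℕ.* suc x ℕ.* t) ℕ.* (2 ℕ.+ x) ∎)
  where
  open ≡.≡-Reasoning
  open +-*-Solver

x+1∣x^odd+1 : ∀ {x n} .{{_ : NonZero x}} → Odd n → x ℕ.+ 1 ∣ x ℕ.^ n ℕ.+ 1
x+1∣x^odd+1 {suc x} (j , ≡.refl) with t , eq ← even-power≡1 x j = divides (suc x ℕ.* t ℕ.+ 1) (begin
  suc x ℕ.* suc x ℕ.^ (j ℕ.+ j) ℕ.+ 1        ≡⟨ ≡.cong (λ y → suc x ℕ.* y ℕ.+ 1) eq ⟩
  suc x ℕ.* (1 ℕ.+ t ℕ.* (2 ℕ.+ x)) ℕ.+ 1    ≡⟨ solve 2 (λ x t →
    (con 1 :+ x) :* (con 1 :+ t :* (con 2 :+ x)) :+ con 1 :=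
    ((con 1 :+ x) :* t :+ con 1) :* (con 1 :+ x :+ con 1)) ≡.refl x t ⟩
  (suc x ℕ.* t ℕ.+ 1) ℕ.* (suc x ℕ.+ 1)      ∎)
  where
  open ≡.≡-Reasoning
  open +-*-Solver

module _ {k ℓ} .{{_ : NonZero k}} .{{_ : NonZero ℓ}} where

  private
    m = 2 ℕ.^ ord₂ (gcd k ℓ)

  -- Otherwise 2 m, the next power of 2, would divide k and ℓ and hence their gcd.
  ¬both-even : ∀ {k′ ℓ′} → k ≡ k′ ℕ.* m → ℓ ≡ ℓ′ ℕ.* m → Even k′ → ¬ Even ℓ′
  ¬both-even k≡ ℓ≡ even-k′ even-ℓ′ = ℕ.1+n≰n (ord₂-greatest (gcd k ℓ) {{gcd≢0}}
    (gcd-greatest (2m∣ k≡ even-k′) (2m∣ ℓ≡ even-ℓ′)))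
    where
    gcd≢0 : NonZero (gcd k ℓ)
    gcd≢0 = ℕ.≢-nonZero (gcd[m,n]≢0 k ℓ (inj₁ (ℕ.≢-nonZero⁻¹ k)))
    2m∣ : ∀ {n n′} → n ≡ n′ ℕ.* m → Even n′ → 2 ℕ.* m ∣ n
    2m∣ n≡ (j , ≡.refl) = divides j (≡.trans n≡ (solve 2 (λ j m → (j :+ j) :* m := j :* (con 2 :* m)) ≡.refl j m))
      where open +-*-Solver

  -- For odd n, P + 1 divides P^n + 1; so 2^m + 1 would be a common divisor of Q + 1 and q + 1.
  ¬both-odd : ∀ {k′ ℓ′} → k ≡ k′ ℕ.* m → ℓ ≡ ℓ′ ℕ.* m → gcd (2 ℕ.^ ℓ ℕ.+ 1) (2 ℕ.^ k ℕ.+ 1) ≡ 1 → Odd k′ → ¬ Odd ℓ′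
  ¬both-odd k≡ ℓ≡ coprime odd-k′ odd-ℓ′ = ℕ.<⇒≢ (ℕ.m^n>0 2 m) (≡.sym (ℕ.+-cancelʳ-≡ 1 (2 ℕ.^ m) 0
    (∣1⇒≡1 (∣-trans (gcd-greatest (P+1∣ ℓ≡ odd-ℓ′) (P+1∣ k≡ odd-k′)) (∣-reflexive coprime)))))
    where
    P+1∣ : ∀ {n n′} → n ≡ n′ ℕ.* m → Odd n′ → 2 ℕ.^ m ℕ.+ 1 ∣ 2 ℕ.^ n ℕ.+ 1
    P+1∣ {n} {n′} n≡ odd = ≡.subst (λ y → 2 ℕ.^ m ℕ.+ 1 ∣ y ℕ.+ 1)
      (≡.trans (ℕ.^-*-assoc 2 m n′) (≡.cong (2 ℕ.^_) (≡.trans (ℕ.*-comm m n′) (≡.sym n≡))))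
      (x+1∣x^odd+1 {{ℕ.m^n≢0 2 m}} odd)

∣⇒∤+ : ∀ {d m} t .{{_ : NonZero t}} → t ℕ.< d → d ∣ m → ¬ d ∣ m ℕ.+ t
∣⇒∤+ t t<d d∣m d∣m+t = ℕ.<⇒≱ t<d (∣⇒≤ (∣m+n∣m⇒∣n d∣m+t d∣m))

∣+⇒∤ : ∀ {d m} t .{{_ : NonZero t}} → t ℕ.< d → d ∣ m ℕ.+ t → ¬ d ∣ m
∣+⇒∤ t t<d d∣m+t d∣m = ∣⇒∤+ t t<d d∣m d∣m+t

[1+m]²≡ : ∀ m → suc m ℕ.^ 2 ≡ suc (m ℕ.* (suc m ℕ.+ 1))
[1+m]²≡ = solve 1 (λ m → (con 1 :+ m) :* ((con 1 :+ m) :* con 1) := con 1 :+ m :* (con 1 :+ m :+ con 1)) ≡.refl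
  where open +-*-Solver

-- The field with q² elements: its circle, Hilbert 90, sums over the circle.

module QuadraticExtension (k ℓ : ℕ) .{{_ : NonZero k}}
  {a r s} (F : HeytingField a r s) (card : HasCardinality F ((2 ℕ.^ k) ℕ.^ 2)) where

  q Q q-1 n : ℕ
  q = 2 ℕ.^ k
  Q = 2 ℕ.^ ℓ
  q-1 = q ℕ.∸ 1
  n = q-1 ℕ.* (q ℕ.+ 1)

  2≤q : 2 ℕ.≤ q
  2≤q = ℕ.≤-trans (ℕ.≤-reflexive (≡.sym (ℕ.^-identityʳ 2))) (ℕ.^-monoʳ-≤ 2 (ℕ.>-nonZero⁻¹ k))

  q≡1+[q-1] : q ≡ suc q-1
  q≡1+[q-1] = ≡.sym (ℕ.m+[n∸m]≡n (ℕ.m^n>0 2 k))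

  q²≡1+n : q ℕ.^ 2 ≡ suc n
  q²≡1+n = ≡.trans (≡.cong (ℕ._^ 2) q≡1+[q-1])
    (≡.trans ([1+m]²≡ q-1) (≡.cong (λ r → suc (q-1 ℕ.* (r ℕ.+ 1))) (≡.sym q≡1+[q-1])))

  instance
    q-1≢0 : NonZero q-1
    q-1≢0 = ℕ.>-nonZero (ℕ.m<n⇒0<n∸m 2≤q)
    q+1≢0 : NonZero (q ℕ.+ 1)
    q+1≢0 = ℕ.>-nonZero (ℕ.m≤n+m 1 q)
    n≢0 : NonZero n
    n≢0 = ℕ.m*n≢0 q-1 (q ℕ.+ 1)

  q-1<n : q-1 ℕ.< n
  q-1<n = ℕ.m<m*n q-1 (q ℕ.+ 1) (ℕ.+-monoˡ-< 1 (ℕ.<⇒≤ 2≤q))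

  abstract
    cardinality : HasCardinality F (suc n)
    cardinality = ≡.subst (HasCardinality F) q²≡1+n card

    1+n≡2^[2k] : suc n ≡ 2 ℕ.^ (k ℕ.* 2)
    1+n≡2^[2k] = ≡.trans (≡.sym q²≡1+n) (ℕ.^-*-assoc 2 k 2)

  open FiniteField F {j = k ℕ.* 2} cardinality 1+n≡2^[2k] public

  open FieldNotation F
  open CommutativeRing commutativeRing hiding (Carrier; _≈_; _+_; _*_; 0#; 1#; zero)
  open import Relation.Binary.Reasoning.Setoid setoid
  open Exp commutativeSemiring using (^-congˡ; ^-congʳ; ^-homo-*; ^-assocʳ; ^-distrib-*)

  open Char2Solver discreteChar2Field

  conj frob : Endomorphism
  conj = frobenius k
  frob = frobenius ℓ

  σ φ : Carrier → Carrier
  σ = _^ q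
  φ = _^ Q

  private
    module σ = Endomorphism conj
    module φ = Endomorphism frob

  σσ : ∀ x → σ (σ x) ≈ x
  σσ x = begin
    (x ^ q) ^ q      ≈⟨ ^-assocʳ x q q ⟩
    x ^ (q ℕ.* q)    ≡⟨ ≡.cong (λ j → x ^ (q ℕ.* j)) (ℕ.*-identityʳ q) ⟨
    x ^ (q ℕ.^ 2)    ≡⟨ ≡.cong (x ^_) q²≡1+n ⟩
    x ^ suc n        ≈⟨ frobenius-id x ⟩
    x                ∎

  σφ : ∀ x → σ (φ x) ≈ φ (σ x)
  σφ x = trans (^-assocʳ x Q q) (trans (^-congʳ x (ℕ.*-comm Q q)) (sym (^-assocʳ x q Q)))

  open UnitCircle discreteChar2Field conj frob σσ σφ public

  x^[q+1]≈xσx : ∀ x → x ^ (q ℕ.+ 1) ≈ x * σ x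
  x^[q+1]≈xσx x = ^-congʳ x (ℕ.+-comm q 1)

  Z*Z^[q-1]≈σZ : ∀ Z → Z * Z ^ q-1 ≈ σ Z
  Z*Z^[q-1]≈σZ Z = ^-congʳ Z (≡.sym q≡1+[q-1])

  0^[q-1]≈0 : ∀ {Z} → Z ≈ 0# → Z ^ q-1 ≈ 0#
  0^[q-1]≈0 {Z} Z≈0 = trans (^-congʳ Z (≡.sym (ℕ.suc-pred q-1))) (trans (*-congʳ Z≈0) (zeroˡ _))

  Z^[q-1]∈μ : ∀ {Z} → ¬ Z ≈ 0# → Norm1 (Z ^ q-1)
  Z^[q-1]∈μ {Z} Z≉0 = trans (sym (x^[q+1]≈xσx _)) (trans (^-assocʳ Z q-1 (q ℕ.+ 1)) (fermat Z≉0))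

  μ-^-cong : ∀ {x} i j → Norm1 x → i ≡ j [mod q ℕ.+ 1 ] → x ^ i ≈ x ^ j
  μ-^-cong {x} i j x∈μ i≡j = [ (λ i≤j → sym (drop i≤j (≡.subst (q ℕ.+ 1 ∣_) (ℕ.m≤n⇒∣m-n∣≡n∸m i≤j) i≡j)))
                                 , (λ j≤i → drop j≤i (≡.subst (q ℕ.+ 1 ∣_) (ℕ.m≤n⇒∣n-m∣≡n∸m j≤i) i≡j)) ]′ (ℕ.≤-total i j)
    where
    drop : ∀ {i j} → i ℕ.≤ j → q ℕ.+ 1 ∣ j ℕ.∸ i → x ^ j ≈ x ^ i
    drop {i} {j} i≤j (divides t eq) = begin
      x ^ j                              ≡⟨ ≡.cong (x ^_) (ℕ.m+[n∸m]≡n i≤j) ⟨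
      x ^ (i ℕ.+ (j ℕ.∸ i))              ≈⟨ ^-homo-* x i (j ℕ.∸ i) ⟩
      x ^ i * x ^ (j ℕ.∸ i)              ≡⟨ ≡.cong (λ d → x ^ i * x ^ d) (≡.trans eq (ℕ.*-comm t (q ℕ.+ 1))) ⟩
      x ^ i * x ^ ((q ℕ.+ 1) ℕ.* t)      ≈⟨ *-congˡ (^-assocʳ x (q ℕ.+ 1) t) ⟨
      x ^ i * (x ^ (q ℕ.+ 1)) ^ t        ≈⟨ *-congˡ (^-≈1 (trans (x^[q+1]≈xσx x) x∈μ) t) ⟩
      x ^ i * 1#                         ≈⟨ *-identityʳ _ ⟩
      x ^ i                              ∎

  -- Hilbert 90: every w of norm 1 is σ Z / Z for some Z ≠ 0, namely Z = 1 + w̄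
  -- unless that vanishes.
  hilbert90 : Carrier → Carrier
  hilbert90 w with w ≟ 1#
  ... | yes _ = 1#
  ... | no  _ = 1# + σ w

  hilbert90-cong : ∀ {w w′} → w ≈ w′ → hilbert90 w ≈ hilbert90 w′
  hilbert90-cong {w} {w′} h with w ≟ 1# | w′ ≟ 1#
  ... | yes _   | yes _    = refl
  ... | yes w≈1 | no w′≉1  = contradiction (trans (sym h) w≈1) w′≉1
  ... | no w≉1  | yes w′≈1 = contradiction (trans h w′≈1) w≉1
  ... | no _    | no _     = +-congˡ (σ.cong h)

  hilbert90-≉0 : ∀ w → ¬ hilbert90 w ≈ 0#
  hilbert90-≉0 w with w ≟ 1#
  ... | yes _  = 1≉0
  ... | no w≉1 = λ h → w≉1 (σ.injective (trans (sym (+≈0⇒≈ h)) (sym σ.1-homo)))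

  hilbert90-σ : ∀ {w} → Norm1 w → σ (hilbert90 w) ≈ w * hilbert90 w
  hilbert90-σ {w} w∈μ with w ≟ 1#
  ... | yes w≈1 = trans σ.1-homo (trans (sym w≈1) (sym (*-identityʳ w)))
  ... | no _    = begin
    σ (1# + σ w)      ≈⟨ trans (σ.+-homo _ _) (+-cong σ.1-homo (σσ w)) ⟩
    1# + w            ≈⟨ combine₁ 1# w∈μ (solve 2 (λ w w̄ → :1 :+ w :+ w :* (:1 :+ w̄) := :1 :* (w :* w̄ :+ :1)) refl w (σ w)) ⟩
    w * (1# + σ w)    ∎

  σZ≈wZ⇒Z^[q-1]≈w : ∀ {Z w} → ¬ Z ≈ 0# → σ Z ≈ w * Z → Z ^ q-1 ≈ w
  σZ≈wZ⇒Z^[q-1]≈w {Z} {w} Z≉0 h = *-cancelˡ Z≉0 (trans (Z*Z^[q-1]≈σZ Z) (trans h (*-comm w Z)))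

  ∃μ≉1 : ∃[ x ] Norm1 x × ¬ x ≈ 1#
  ∃μ≉1 = let z , z≉0 , h = ∃^≉1 q-1<n in z ^ q-1 , Z^[q-1]∈μ z≉0 , h

  -- If q + 1 divided Q, the injective map `φ` would send the whole circle to 1, but the circle has
  -- a point other than 1.
  q+1∤Q : ¬ q ℕ.+ 1 ∣ Q
  q+1∤Q q+1∣Q = let x , x∈μ , x≉1 = ∃μ≉1 in x≉1 (φ.injective (trans
    (μ-^-cong Q 0 x∈μ (≡.subst (q ℕ.+ 1 ∣_) (≡.sym (ℕ.∣-∣-identityʳ Q)) q+1∣Q)) (sym φ.1-homo)))

  -- Q + 1 + i is the exponent at which the power sum over the circle is 1. The strict bound, due to
  -- `q+1∤Q`, keeps i + 1 below q + 1.
  ∃q+1∣Q+1+i : ∃[ i ] i ℕ.< q × q ℕ.+ 1 ∣ Q ℕ.+ 1 ℕ.+ i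
  ∃q+1∣Q+1+i = i , ℕ.∸-monoʳ-< {q} {r₀} {0} 0<r r≤q , ≡.subst (q ℕ.+ 1 ∣_) (≡.sym eq) (∣m∣n⇒∣m+n ∣-refl (n∣m*n (Q / (q ℕ.+ 1))))
    where
    r₀ i : ℕ
    r₀ = Q % (q ℕ.+ 1)
    i = q ℕ.∸ r₀
    r≤q : r₀ ℕ.≤ q
    r≤q = ℕ.≤-pred (ℕ.≤-trans (m%n<n Q (q ℕ.+ 1)) (ℕ.≤-reflexive (ℕ.+-comm q 1)))
    0<r : 0 ℕ.< r₀
    0<r = ℕ.n≢0⇒n>0 (q+1∤Q ∘ m%n≡0⇒n∣m Q (q ℕ.+ 1))
    eq : Q ℕ.+ 1 ℕ.+ i ≡ q ℕ.+ 1 ℕ.+ Q / (q ℕ.+ 1) ℕ.* (q ℕ.+ 1)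
    eq = ≡.trans (≡.cong (λ j → j ℕ.+ 1 ℕ.+ i) (m≡m%n+[m/n]*n Q (q ℕ.+ 1)))
      (≡.trans (NS.solve 3 (λ r i t → r NS.:+ t NS.:+ NS.con 1 NS.:+ i NS.:= r NS.:+ i NS.:+ NS.con 1 NS.:+ t) ≡.refl r₀ i _)
        (≡.cong (λ j → j ℕ.+ 1 ℕ.+ Q / (q ℕ.+ 1) ℕ.* (q ℕ.+ 1)) (ℕ.m+[n∸m]≡n r≤q)))
      where module NS = +-*-Solver

  abstract
    -- Each circle point is Z^(q-1) for q - 1 units Z, an odd number, so in characteristic 2 this is
    -- g 0 plus the sum over the circle, with no enumeration of the circle.
    ∑μ : (Carrier → Carrier) → Carrier
    ∑μ g = ∑ (λ Z → g (Z ^ q-1))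

    ∑μ-def : ∀ g → ∑μ g ≈ ∑ (λ Z → g (Z ^ q-1))
    ∑μ-def g = refl

    ∑μ-+ : ∀ g h → ∑μ (λ x → g x + h x) ≈ ∑μ g + ∑μ h
    ∑μ-+ g h = ∑-+ _ _

    ∑μ-* : ∀ l g → ∑μ (λ x → l * g x) ≈ l * ∑μ g
    ∑μ-* l g = ∑-* l _

  ∑μ^≈0 : ∀ {i} → ¬ q ℕ.+ 1 ∣ i → ∑μ (_^ i) ≈ 0#
  ∑μ^≈0 {i} q+1∤i = trans (∑μ-def _) (trans (∑-cong (λ Z → ^-assocʳ Z q-1 i)) (∑^≈0 (q+1∤i ∘ *-cancelˡ-∣ q-1)))

  ∑μ^≈1 : ∀ {i} .{{_ : NonZero i}} → q ℕ.+ 1 ∣ i → ∑μ (_^ i) ≈ 1#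
  ∑μ^≈1 {i} q+1∣i = trans (∑μ-def _) (trans (∑-cong (λ Z → ^-assocʳ Z q-1 i)) (∑^≈1 {{ℕ.m*n≢0 q-1 i}} (*-monoʳ-∣ q-1 q+1∣i)))

  OnCircle₀ : Carrier → Set r
  OnCircle₀ x = Norm1 x ⊎ x ≈ 0#

  Z^[q-1]-onCircle₀ : ∀ Z → OnCircle₀ (Z ^ q-1)
  Z^[q-1]-onCircle₀ Z = cases (Z ≟ 0#)
    where
    cases : Dec (Z ≈ 0#) → OnCircle₀ (Z ^ q-1)
    cases (yes Z≈0) = inj₂ (0^[q-1]≈0 Z≈0)
    cases (no  Z≉0) = inj₁ (Z^[q-1]∈μ Z≉0)

  ∑μ-cong : ∀ {g h} → (∀ {x} → OnCircle₀ x → g x ≈ h x) → ∑μ g ≈ ∑μ h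
  ∑μ-cong g≈h = trans (∑μ-def _) (trans (∑-cong (λ Z → g≈h (Z^[q-1]-onCircle₀ Z))) (sym (∑μ-def _)))

  -- A self-map h of the circle lifts to Z ↦ Z · hilbert90 (h x / x) with x = Z ^ (q - 1).
  ∑μ-injective≈0 : ∀ {h} → (∀ {x} → Norm1 x → Norm1 (h x)) → (∀ {x} → x ≈ 0# → h x ≈ 0#) →
    (∀ {x y} → Norm1 x → Norm1 y → h x ≈ h y → x ≈ y) → ∑μ h ≈ 0#
  ∑μ-injective≈0 {h} h∈μ h-0 h-inj = begin
    ∑μ h                        ≈⟨ trans (∑μ-def h) (∑-cong (λ Z → sym (H^[q-1] Z))) ⟩
    ∑ (λ Z → H Z ^ q-1)         ≈⟨ ∑-reindex (^-congˡ q-1) (H-injective _ _) ⟨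
    ∑ (_^ q-1)                  ≈⟨ ∑^≈0 (λ n∣q-1 → ℕ.<⇒≱ q-1<n (∣⇒≤ n∣q-1)) ⟩
    0#                          ∎
    where
    w H : Carrier → Carrier
    w x = h x * σ x
    H Z = Z * hilbert90 (w (Z ^ q-1))
    H-≉0 : ∀ {Z} → ¬ Z ≈ 0# → ¬ H Z ≈ 0#
    H-≉0 Z≉0 = *-≉0 Z≉0 (hilbert90-≉0 _)
    σH : ∀ {Z} → ¬ Z ≈ 0# → σ (H Z) ≈ h (Z ^ q-1) * H Z
    σH {Z} Z≉0 = begin
      σ (Z * k′)                  ≈⟨ σ.*-homo _ _ ⟩
      σ Z * σ k′                  ≈⟨ *-cong (sym (Z*Z^[q-1]≈σZ Z)) (hilbert90-σ (Norm1-* (h∈μ x∈μ) (Norm1-σ x∈μ))) ⟩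
      Z * x * (h x * σ x * k′)    ≈⟨ combine₁ (h x * (Z * k′)) x∈μ
        (solve 5 (λ Z x x̄ h k → Z :* x :* (h :* x̄ :* k) :+ h :* (Z :* k) := h :* (Z :* k) :* (x :* x̄ :+ :1)) refl Z x (σ x) (h x) k′) ⟩
      h x * (Z * k′)              ∎
      where
      x = Z ^ q-1
      x∈μ = Z^[q-1]∈μ Z≉0
      k′ = hilbert90 (w x)
    H^[q-1] : ∀ Z → H Z ^ q-1 ≈ h (Z ^ q-1)
    H^[q-1] Z = cases (Z ≟ 0#)
      where
      cases : Dec (Z ≈ 0#) → H Z ^ q-1 ≈ h (Z ^ q-1)
      cases (yes Z≈0) = trans (0^[q-1]≈0 (trans (*-congʳ Z≈0) (zeroˡ _))) (sym (h-0 (0^[q-1]≈0 Z≈0)))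
      cases (no  Z≉0) = σZ≈wZ⇒Z^[q-1]≈w (H-≉0 Z≉0) (σH Z≉0)
    -- The (q - 1)-th power of H Z is h x, which determines x and hence the factor
    -- `hilbert90 (w x)`; that nonzero factor then cancels.
    H-injective : ∀ Z Z′ → H Z ≈ H Z′ → Z ≈ Z′
    H-injective Z Z′ eq = cases (Z ≟ 0#) (Z′ ≟ 0#)
      where
      hx≈hx′ : h (Z ^ q-1) ≈ h (Z′ ^ q-1)
      hx≈hx′ = trans (sym (H^[q-1] Z)) (trans (^-congˡ q-1 eq) (H^[q-1] Z′))
      cases : Dec (Z ≈ 0#) → Dec (Z′ ≈ 0#) → Z ≈ Z′
      cases (yes Z≈0) (yes Z′≈0) = trans Z≈0 (sym Z′≈0)
      cases (yes Z≈0) (no Z′≉0)  = contradiction (trans (sym eq) (trans (*-congʳ Z≈0) (zeroˡ _))) (H-≉0 Z′≉0)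
      cases (no Z≉0)  (yes Z′≈0) = contradiction (trans eq (trans (*-congʳ Z′≈0) (zeroˡ _))) (H-≉0 Z≉0)
      cases (no Z≉0)  (no Z′≉0)  = *-cancelˡ (hilbert90-≉0 _)
        (trans (*-comm _ _) (trans eq (trans (*-congˡ (hilbert90-cong (*-cong (sym hx≈hx′) (σ.cong (sym x≈x′))))) (*-comm _ _))))
        where
        x≈x′ : Z ^ q-1 ≈ Z′ ^ q-1
        x≈x′ = h-inj (Z^[q-1]∈μ Z≉0) (Z^[q-1]∈μ Z′≉0) hx≈hx′

  -- Let h X = X^Q (A X + C) / (C̄ X + Ā) and S j = Σ X^j h X over the circle.
  -- The power sums of the circle turn the definition of h into a recurrence for
  -- S with two inhomogeneous steps, at j = i and j = i + 1.  If S 0 = 0, running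
  -- it up from 0 and down from q + 1 gives C̄ S (i + 1) = A and Ā S (i + 1) = C.
  obstruction : PowerSumObstruction
  obstruction {A} {C} A≉0 C≉0 AĀ≉CC̄ inj = AĀ≉CC̄ (begin
    A * σ A                          ≈⟨ combine₂ (σ A) (sym C̄S≈A) (σ C) ĀS≈C
      (solve 5 (λ A Ā C C̄ S → A :* Ā :+ C :* C̄ := Ā :* (A :+ C̄ :* S) :+ C̄ :* (Ā :* S :+ C)) refl A (σ A) C (σ C) (S (suc i))) ⟩
    C * σ C                          ∎)
    where
    denominator : Carrier → Carrier
    denominator X = σ C * X + σ A
    -- C̄ X = Ā with X of norm 1 would equate the norms of A and C.
    denominator≉0 : ∀ {X} → Norm1 X → ¬ denominator X ≈ 0#
    denominator≉0 {X} X∈μ h = AĀ≉CC̄ (begin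
      A * σ A                    ≈⟨ *-cong (σσ A) C̄X≈Ā ⟨
      σ (σ A) * (σ C * X)        ≈⟨ *-congʳ (trans (σ.cong (sym C̄X≈Ā)) (trans (σ.*-homo _ _) (*-congʳ (σσ C)))) ⟩
      C * σ X * (σ C * X)        ≈⟨ combine₁ (C * σ C) X∈μ (solve 4 (λ C C̄ X X̄ → C :* X̄ :* (C̄ :* X) :+ C :* C̄ := C :* C̄ :* (X :* X̄ :+ :1))
                                      refl C (σ C) X (σ X)) ⟩
      C * σ C                    ∎)
      where
      C̄X≈Ā : σ C * X ≈ σ A
      C̄X≈Ā = +≈0⇒≈ h
    reciprocal : Carrier → Carrier
    reciprocal y with y ≟ 0#
    ... | yes _  = 0#
    ... | no y≉0 = proj₁ (inverse y≉0)
    reciprocal-inverse : ∀ {y} → ¬ y ≈ 0# → y * reciprocal y ≈ 1#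
    reciprocal-inverse {y} y≉0 with y ≟ 0#
    ... | yes y≈0 = contradiction y≈0 y≉0
    ... | no y≉0′ = proj₂ (inverse y≉0′)
    h : Carrier → Carrier
    h X = φ X * (A * X + C) * reciprocal (denominator X)
    h-0 : ∀ {X} → X ≈ 0# → h X ≈ 0#
    h-0 X≈0 = trans (*-congʳ (trans (*-congʳ (trans (φ.cong X≈0) φ.0-homo)) (zeroˡ _))) (zeroˡ _)
    h-def : ∀ {X} → OnCircle₀ X → h X * denominator X ≈ φ X * (A * X + C)
    h-def {X} (inj₁ X∈μ) = combine₁ (φ X * (A * X + C)) (reciprocal-inverse (denominator≉0 X∈μ))
      (solve 3 (λ a i d → a :* i :* d :+ a := a :* (d :* i :+ :1)) refl (φ X * (A * X + C)) (reciprocal (denominator X)) (denominator X))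
    h-def {X} (inj₂ X≈0) = trans (trans (*-congʳ (h-0 X≈0)) (zeroˡ _))
      (sym (trans (*-congʳ (trans (φ.cong X≈0) φ.0-homo)) (zeroˡ _)))
    h∈μ : ∀ {X} → Norm1 X → Norm1 (h X)
    h∈μ {X} X∈μ = *-cancelˡ (*-≉0 (denominator≉0 X∈μ) (σ.≉0 (denominator≉0 X∈μ))) (begin
      denominator X * σ (denominator X) * (h X * σ (h X))
        ≈⟨ solve 4 (λ d d̄ h h̄ → d :* d̄ :* (h :* h̄) := h :* d :* (h̄ :* d̄)) refl (denominator X) (σ (denominator X)) (h X) (σ (h X)) ⟩
      h X * denominator X * (σ (h X) * σ (denominator X))
        ≈⟨ *-cong (h-def (inj₁ X∈μ)) (trans (sym (σ.*-homo _ _)) (trans (σ.cong (h-def (inj₁ X∈μ))) (σ.*-homo _ _))) ⟩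
      φ X * (A * X + C) * (σ (φ X) * σ (A * X + C))
        ≈⟨ *-congˡ (*-congˡ (trans (σ.+-homo _ _) (+-congʳ (σ.*-homo _ _)))) ⟩
      φ X * (A * X + C) * (σ (φ X) * (σ A * σ X + σ C))
        ≈⟨ combine₂ ((A * X + C) * (σ A * σ X + σ C)) (Norm1-φ X∈μ) (A * σ A + C * σ C) X∈μ
          (solve 8 (λ A Ā C C̄ X X̄ Y Ȳ → Y :* (A :* X :+ C) :* (Ȳ :* (Ā :* X̄ :+ C̄)) :+ (C̄ :* X :+ Ā) :* (C :* X̄ :+ A) :=
             (A :* X :+ C) :* (Ā :* X̄ :+ C̄) :* (Y :* Ȳ :+ :1) :+ (A :* Ā :+ C :* C̄) :* (X :* X̄ :+ :1))
            refl A (σ A) C (σ C) X (σ X) (φ X) (σ (φ X))) ⟩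
      denominator X * (C * σ X + A)
        ≈⟨ *-congˡ (trans (σ.+-homo _ _) (+-cong (trans (σ.*-homo _ _) (*-congʳ (σσ C))) (σσ A))) ⟨
      denominator X * σ (denominator X)       ≈⟨ *-identityʳ _ ⟨
      denominator X * σ (denominator X) * 1#  ∎)
    h-inj : ∀ {X Y} → Norm1 X → Norm1 Y → h X ≈ h Y → X ≈ Y
    h-inj {X} {Y} X∈μ Y∈μ hX≈hY = inj X∈μ Y∈μ (begin
      φ X * (A * X + C) * denominator Y          ≈⟨ *-congʳ (h-def (inj₁ X∈μ)) ⟨
      h X * denominator X * denominator Y        ≈⟨ *-congʳ (*-congʳ hX≈hY) ⟩
      h Y * denominator X * denominator Y        ≈⟨ solve 3 (λ h d d′ → h :* d :* d′ := h :* d′ :* d) refl (h Y) (denominator X) (denominator Y) ⟩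
      h Y * denominator Y * denominator X        ≈⟨ *-congʳ (h-def (inj₁ Y∈μ)) ⟩
      φ Y * (A * Y + C) * denominator X          ∎)

    S p : ℕ → Carrier
    S j = ∑μ (λ X → X ^ j * h X)
    p j = ∑μ (_^ j)
    S-cong : ∀ {j j′} → j ≡ j′ → S j ≈ S j′
    S-cong = reflexive ∘ ≡.cong S
    p-cong : ∀ {j j′} → j ≡ j′ → p j ≈ p j′
    p-cong = reflexive ∘ ≡.cong p
    recurrence : ∀ j → σ A * S j + σ C * S (suc j) ≈ A * p (Q ℕ.+ 1 ℕ.+ j) + C * p (Q ℕ.+ j)
    recurrence j = begin
      σ A * S j + σ C * S (suc j)
        ≈⟨ trans (∑μ-+ _ _) (+-cong (∑μ-* (σ A) _) (∑μ-* (σ C) _)) ⟨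
      ∑μ (λ X → σ A * (X ^ j * h X) + σ C * (X ^ suc j * h X))
        ≈⟨ ∑μ-cong step ⟩
      ∑μ (λ X → A * X ^ (Q ℕ.+ 1 ℕ.+ j) + C * X ^ (Q ℕ.+ j))
        ≈⟨ trans (∑μ-+ _ _) (+-cong (∑μ-* A _) (∑μ-* C _)) ⟩
      A * p (Q ℕ.+ 1 ℕ.+ j) + C * p (Q ℕ.+ j) ∎
      where
      step : ∀ {X} → OnCircle₀ X → σ A * (X ^ j * h X) + σ C * (X ^ suc j * h X) ≈ A * X ^ (Q ℕ.+ 1 ℕ.+ j) + C * X ^ (Q ℕ.+ j)
      step {X} X∈ = begin
        σ A * (X ^ j * h X) + σ C * (X ^ suc j * h X)
          ≈⟨ solve 5 (λ Ā C̄ X Xʲ h → Ā :* (Xʲ :* h) :+ C̄ :* (X :* Xʲ :* h) := Xʲ :* (h :* (C̄ :* X :+ Ā))) refl (σ A) (σ C) X (X ^ j) (h X) ⟩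
        X ^ j * (h X * denominator X)
          ≈⟨ *-congˡ (h-def X∈) ⟩
        X ^ j * (φ X * (A * X + C))
          ≈⟨ solve 5 (λ A C X Xʲ Y → Xʲ :* (Y :* (A :* X :+ C)) := A :* (Y :* (X :* :1) :* Xʲ) :+ C :* (Y :* Xʲ)) refl A C X (X ^ j) (φ X) ⟩
        A * (φ X * X ^ 1 * X ^ j) + C * (φ X * X ^ j)
          ≈⟨ +-cong (*-congˡ (trans (^-homo-* X (Q ℕ.+ 1) j) (*-congʳ (^-homo-* X Q 1)))) (*-congˡ (^-homo-* X Q j)) ⟨
        A * X ^ (Q ℕ.+ 1 ℕ.+ j) + C * X ^ (Q ℕ.+ j) ∎

    i : ℕ
    i = proj₁ ∃q+1∣Q+1+i
    i<q : i ℕ.< q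
    i<q = proj₁ (proj₂ ∃q+1∣Q+1+i)
    q+1∣Q+1+i : q ℕ.+ 1 ∣ Q ℕ.+ 1 ℕ.+ i
    q+1∣Q+1+i = proj₂ (proj₂ ∃q+1∣Q+1+i)

    homogeneous : ∀ j → ¬ q ℕ.+ 1 ∣ Q ℕ.+ 1 ℕ.+ j → ¬ q ℕ.+ 1 ∣ Q ℕ.+ j → σ A * S j ≈ σ C * S (suc j)
    homogeneous j h₁ h₂ = +≈0⇒≈ (trans (recurrence j) (trans
      (+-cong (trans (*-congˡ (∑μ^≈0 h₁)) (zeroʳ A)) (trans (*-congˡ (∑μ^≈0 h₂)) (zeroʳ C))) (+-identityˡ 0#)))

    S0≈0 : S 0 ≈ 0#
    S0≈0 = trans (∑μ-cong (λ _ → *-identityˡ _)) (∑μ-injective≈0 h∈μ h-0 h-inj)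
    -- X^(q+1) = 1 on the circle, and at the extra point 0 both summands vanish because h 0 = 0.
    S[q+1]≈0 : S (q ℕ.+ 1) ≈ 0#
    S[q+1]≈0 = trans (∑μ-cong (λ { (inj₁ X∈μ) → *-congʳ (trans (x^[q+1]≈xσx _) X∈μ)
                                 ; (inj₂ X≈0) → trans (*-congˡ (h-0 X≈0)) (trans (zeroʳ _) (sym (trans (*-congˡ (h-0 X≈0)) (zeroʳ _)))) })) S0≈0

    module NS = +-*-Solver
    open +-*-Solver using () renaming (_:+_ to _⊕_; con to ‵_; _:=_ to _≐_)

    -- `t` is the distance to i. In the step, Q + 1 + j and Q + j fall short of the multiple Q + 1 +
    -- i by 1 + t and 2 + t, both at most q, so neither is a multiple of q + 1.
    ascend : ∀ j t → j ℕ.+ t ≡ i → S j ≈ 0#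
    ascend zero    t _    = S0≈0
    ascend (suc j) t j+1+t≡i = x*y≈0⇒y≈0 (σ.≉0 C≉0) (trans (sym (homogeneous j
      (∣+⇒∤ (suc t) 1+t<q+1 (≡.subst (q ℕ.+ 1 ∣_) (≡.trans (≡.cong (Q ℕ.+ 1 ℕ.+_) (≡.sym j+1+t≡i))
        (NS.solve 3 (λ Q j t → Q ⊕ ‵ 1 ⊕ (‵ 1 ⊕ j ⊕ t) ≐ Q ⊕ ‵ 1 ⊕ j ⊕ (‵ 1 ⊕ t)) ≡.refl Q j t)) q+1∣Q+1+i))
      (∣+⇒∤ (2 ℕ.+ t) 2+t<q+1 (≡.subst (q ℕ.+ 1 ∣_) (≡.trans (≡.cong (Q ℕ.+ 1 ℕ.+_) (≡.sym j+1+t≡i))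
        (NS.solve 3 (λ Q j t → Q ⊕ ‵ 1 ⊕ (‵ 1 ⊕ j ⊕ t) ≐ Q ⊕ j ⊕ (‵ 2 ⊕ t)) ≡.refl Q j t)) q+1∣Q+1+i))))
      (trans (*-congˡ (ascend j (suc t) (≡.trans (ℕ.+-suc j t) j+1+t≡i))) (zeroʳ _)))
      where
      1+t≤i : suc t ℕ.≤ i
      1+t≤i = ℕ.≤-trans (ℕ.s≤s (ℕ.m≤n+m t j)) (ℕ.≤-reflexive j+1+t≡i)
      2+t<q+1 : 2 ℕ.+ t ℕ.< q ℕ.+ 1
      2+t<q+1 = ℕ.≤-trans (ℕ.s≤s (ℕ.≤-trans (ℕ.s≤s 1+t≤i) i<q)) (ℕ.≤-reflexive (ℕ.+-comm 1 q))
      1+t<q+1 : suc t ℕ.< q ℕ.+ 1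
      1+t<q+1 = ℕ.<-trans (ℕ.n<1+n _) 2+t<q+1

    -- Here the two exponents exceed the multiple Q + 1 + i by 2 + j and 1 + j, both again below q +
    -- 1.
    descend : ∀ t j → i ℕ.+ 2 ℕ.+ j ℕ.+ t ≡ q ℕ.+ 1 → S (i ℕ.+ 2 ℕ.+ j) ≈ 0#
    descend zero    j eq = trans (S-cong (≡.trans (≡.sym (ℕ.+-identityʳ _)) eq)) S[q+1]≈0
    descend (suc t) j eq = x*y≈0⇒y≈0 (σ.≉0 A≉0) (trans (homogeneous (i ℕ.+ 2 ℕ.+ j)
      (≡.subst (λ x → ¬ q ℕ.+ 1 ∣ x) (NS.solve 3 (λ Q i j → Q ⊕ ‵ 1 ⊕ i ⊕ (‵ 2 ⊕ j) ≐ Q ⊕ ‵ 1 ⊕ (i ⊕ ‵ 2 ⊕ j)) ≡.refl Q i j)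
        (∣⇒∤+ (2 ℕ.+ j) 2+j<q+1 q+1∣Q+1+i))
      (≡.subst (λ x → ¬ q ℕ.+ 1 ∣ x) (NS.solve 3 (λ Q i j → Q ⊕ ‵ 1 ⊕ i ⊕ (‵ 1 ⊕ j) ≐ Q ⊕ (i ⊕ ‵ 2 ⊕ j)) ≡.refl Q i j)
        (∣⇒∤+ (1 ℕ.+ j) (ℕ.<-trans (ℕ.n<1+n _) 2+j<q+1) q+1∣Q+1+i)))
      (trans (*-congˡ (trans (S-cong (≡.sym (ℕ.+-suc (i ℕ.+ 2) j)))
        (descend t (suc j) (≡.trans (NS.solve 3 (λ i j t → i ⊕ ‵ 2 ⊕ (‵ 1 ⊕ j) ⊕ t ≐ i ⊕ ‵ 2 ⊕ j ⊕ (‵ 1 ⊕ t)) ≡.refl i j t) eq)))) (zeroʳ _)))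
      where
      2+j<q+1 : 2 ℕ.+ j ℕ.< q ℕ.+ 1
      2+j<q+1 = ℕ.≤-trans (ℕ.m≤m+n (3 ℕ.+ j) (i ℕ.+ t)) (ℕ.≤-reflexive (≡.trans
        (NS.solve 3 (λ i j t → ‵ 3 ⊕ j ⊕ (i ⊕ t) ≐ i ⊕ ‵ 2 ⊕ j ⊕ (‵ 1 ⊕ t)) ≡.refl i j t) eq))

    1<q+1 : 1 ℕ.< q ℕ.+ 1
    1<q+1 = ℕ.≤-trans 2≤q (ℕ.m≤m+n q 1)

    instance
      Q+1+i≢0 : NonZero (Q ℕ.+ 1 ℕ.+ i)
      Q+1+i≢0 = ℕ.>-nonZero (ℕ.≤-trans (ℕ.m≤n+m 1 Q) (ℕ.m≤m+n (Q ℕ.+ 1) i))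

    C̄S≈A : σ C * S (suc i) ≈ A
    C̄S≈A = begin
      σ C * S (suc i)                              ≈⟨ +-identityˡ _ ⟨
      0# + σ C * S (suc i)                         ≈⟨ +-congʳ (trans (*-congˡ (ascend i 0 (ℕ.+-identityʳ i))) (zeroʳ _)) ⟨
      σ A * S i + σ C * S (suc i)                  ≈⟨ recurrence i ⟩
      A * p (Q ℕ.+ 1 ℕ.+ i) + C * p (Q ℕ.+ i)      ≈⟨ +-cong (*-congˡ (∑μ^≈1 q+1∣Q+1+i)) (*-congˡ (∑μ^≈0
        (∣+⇒∤ 1 1<q+1 (≡.subst (q ℕ.+ 1 ∣_) (NS.solve 2 (λ Q i → Q ⊕ ‵ 1 ⊕ i ≐ Q ⊕ i ⊕ ‵ 1) ≡.refl Q i) q+1∣Q+1+i)))) ⟩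
      A * 1# + C * 0#                              ≈⟨ trans (+-cong (*-identityʳ A) (zeroʳ C)) (+-identityʳ A) ⟩
      A                                            ∎

    ĀS≈C : σ A * S (suc i) ≈ C
    ĀS≈C = begin
      σ A * S (suc i)                              ≈⟨ +-identityʳ _ ⟨
      σ A * S (suc i) + 0#                         ≈⟨ +-congˡ (trans (*-congˡ S[i+2]≈0) (zeroʳ _)) ⟨
      σ A * S (suc i) + σ C * S (suc (suc i))      ≈⟨ recurrence (suc i) ⟩
      A * p (Q ℕ.+ 1 ℕ.+ suc i) + C * p (Q ℕ.+ suc i) ≈⟨ +-cong
        (*-congˡ (∑μ^≈0 (≡.subst (λ x → ¬ q ℕ.+ 1 ∣ x) (NS.solve 2 (λ Q i → Q ⊕ ‵ 1 ⊕ i ⊕ ‵ 1 ≐ Q ⊕ ‵ 1 ⊕ (‵ 1 ⊕ i)) ≡.refl Q i)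
          (∣⇒∤+ 1 1<q+1 q+1∣Q+1+i))))
        (*-congˡ (trans (p-cong (NS.solve 2 (λ Q i → Q ⊕ (‵ 1 ⊕ i) ≐ Q ⊕ ‵ 1 ⊕ i) ≡.refl Q i)) (∑μ^≈1 q+1∣Q+1+i))) ⟩
      A * 0# + C * 1#                              ≈⟨ trans (+-cong (zeroʳ A) (*-identityʳ C)) (+-identityˡ C) ⟩
      C                                            ∎
      where
      S[i+2]≈0 : S (suc (suc i)) ≈ 0#
      S[i+2]≈0 = trans (S-cong (NS.solve 1 (λ i → ‵ 2 ⊕ i ≐ i ⊕ ‵ 2 ⊕ ‵ 0) ≡.refl i))
        (descend (q ℕ.∸ suc i) 0 (≡.trans (NS.solve 2 (λ i t → i ⊕ ‵ 2 ⊕ ‵ 0 ⊕ t ≐ ‵ 1 ⊕ i ⊕ t ⊕ ‵ 1) ≡.refl i (q ℕ.∸ suc i))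
          (≡.cong (ℕ._+ 1) (ℕ.m+[n∸m]≡n i<q))))

  -- Traces, Artin-Schreier equations, iterated Frobenius maps.

  private
    module Σ = SemiringSum semiring

  -- The sum in `Tr` with its number d of terms explicit. It is applied also to elements outside
  -- GF(q), where it is only an additive map.
  trace : ℕ → ℕ → Carrier → Carrier
  trace m d x = Σ.sum {d} (λ i → x ^ ((2 ℕ.^ m) ℕ.^ toℕ i))

  module Trace (m : ℕ) where
    private
      P = 2 ℕ.^ m
      module π = Endomorphism (frobenius m)

    trace-cong : ∀ d {x y} → x ≈ y → trace m d x ≈ trace m d y
    trace-cong d x≈y = Σ.sum-cong-≋ {d} (λ i → ^-congˡ (P ℕ.^ toℕ i) x≈y)

    trace-suc : ∀ d x → trace m (suc d) x ≈ x + trace m d (x ^ P)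
    trace-suc d x = +-cong (*-identityʳ x) (Σ.sum-cong-≋ {d} (λ i → sym (^-assocʳ x P (P ℕ.^ toℕ i))))

    trace-+ : ∀ d x y → trace m d (x + y) ≈ trace m d x + trace m d y
    trace-+ zero    x y = sym (+-identityˡ 0#)
    trace-+ (suc d) x y = begin
      trace m (suc d) (x + y)                                 ≈⟨ trace-suc d (x + y) ⟩
      x + y + trace m d ((x + y) ^ P)                         ≈⟨ +-congˡ (trans (trace-cong d (π.+-homo x y)) (trace-+ d (x ^ P) (y ^ P))) ⟩
      x + y + (trace m d (x ^ P) + trace m d (y ^ P))         ≈⟨ solve 4 (λ x y u v → x :+ y :+ (u :+ v) := (x :+ u) :+ (y :+ v)) refl x y _ _ ⟩
      x + trace m d (x ^ P) + (y + trace m d (y ^ P))         ≈⟨ +-cong (trace-suc d x) (trace-suc d y) ⟨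
      trace m (suc d) x + trace m (suc d) y                   ∎

    trace-frobenius : ∀ i d x → trace m d x ^ (2 ℕ.^ i) ≈ trace m d (x ^ (2 ℕ.^ i))
    trace-frobenius i zero    x = Endomorphism.0-homo (frobenius i)
    trace-frobenius i (suc d) x = begin
      trace m (suc d) x ^ (2 ℕ.^ i)                           ≈⟨ ^-congˡ (2 ℕ.^ i) (trace-suc d x) ⟩
      (x + trace m d (x ^ P)) ^ (2 ℕ.^ i)                     ≈⟨ ^2^-+-homo i x (trace m d (x ^ P)) ⟩
      x ^ (2 ℕ.^ i) + trace m d (x ^ P) ^ (2 ℕ.^ i)           ≈⟨ +-congˡ (trans (trace-frobenius i d (x ^ P)) (trace-cong d
          (trans (^-assocʳ x P (2 ℕ.^ i)) (trans (^-congʳ x (ℕ.*-comm P (2 ℕ.^ i))) (sym (^-assocʳ x (2 ℕ.^ i) P)))))) ⟩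
      x ^ (2 ℕ.^ i) + trace m d ((x ^ (2 ℕ.^ i)) ^ P)         ≈⟨ trace-suc d (x ^ (2 ℕ.^ i)) ⟨
      trace m (suc d) (x ^ (2 ℕ.^ i))                         ∎

    trace-x^P+x : ∀ d x → trace m d (x ^ P + x) ≈ x ^ (P ℕ.^ d) + x
    trace-x^P+x zero    x = sym (trans (+-congʳ (*-identityʳ x)) (x+x≈0 x))
    trace-x^P+x (suc d) x = begin
      trace m (suc d) (x ^ P + x)                             ≈⟨ trace-suc d (x ^ P + x) ⟩
      x ^ P + x + trace m d ((x ^ P + x) ^ P)                 ≈⟨ +-congˡ (trans (trace-cong d (π.+-homo (x ^ P) x)) (trace-x^P+x d (x ^ P))) ⟩
      x ^ P + x + ((x ^ P) ^ (P ℕ.^ d) + x ^ P)               ≈⟨ solve 3 (λ p x y → p :+ x :+ (y :+ p) := y :+ x) refl (x ^ P) x _ ⟩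
      (x ^ P) ^ (P ℕ.^ d) + x                                 ≈⟨ +-congʳ (^-assocʳ x P (P ℕ.^ d)) ⟩
      x ^ (P ℕ.^ suc d) + x                                   ∎

    fixed-iterate : ∀ {x} → x ^ P ≈ x → ∀ j → x ^ (P ℕ.^ j) ≈ x
    fixed-iterate {x} h zero    = *-identityʳ x
    fixed-iterate {x} h (suc j) = trans (sym (^-assocʳ x P (P ℕ.^ j))) (trans (^-congˡ (P ℕ.^ j) h) (fixed-iterate h j))

    -- x^(P^j) + x is the sum of the first j conjugates of x^P + x, and each has the same trace y
    -- because y is fixed by the P-th power.
    trace-x^P^j+x : ∀ d {x y} → trace m d (x ^ P + x) ≈ y → y ^ P ≈ y → ∀ j → trace m d (x ^ (P ℕ.^ j) + x) ≈ j · y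
    trace-x^P^j+x d {x} h yᴾ≈y zero = trans (trace-cong d (≈⇒+≈0 (*-identityʳ x))) (trace-0 d)
      where
      trace-0 : ∀ d → trace m d 0# ≈ 0#
      trace-0 zero    = refl
      trace-0 (suc d) = trans (trace-suc d 0#) (trans (+-identityˡ _) (trans (trace-cong d π.0-homo) (trace-0 d)))
    trace-x^P^j+x d {x} {y} h yᴾ≈y (suc j) = begin
      trace m d (x ^ (P ℕ.^ suc j) + x)
        ≈⟨ trace-cong d (trans (+-congʳ (sym (^-assocʳ x P (P ℕ.^ j))))
             (solve 3 (λ x p z → z :+ x := p :+ x :+ (z :+ p)) refl x (x ^ P) ((x ^ P) ^ (P ℕ.^ j)))) ⟩
      trace m d (x ^ P + x + ((x ^ P) ^ (P ℕ.^ j) + x ^ P))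
        ≈⟨ trace-+ d _ _ ⟩
      trace m d (x ^ P + x) + trace m d ((x ^ P) ^ (P ℕ.^ j) + x ^ P)
        ≈⟨ +-cong h (trace-x^P^j+x d h′ yᴾ≈y j) ⟩
      y + j · y ∎
      where
      h′ : trace m d ((x ^ P) ^ P + x ^ P) ≈ y
      h′ = begin
        trace m d ((x ^ P) ^ P + x ^ P)    ≈⟨ trace-cong d (π.+-homo _ _) ⟨
        trace m d ((x ^ P + x) ^ P)        ≈⟨ trace-frobenius m d _ ⟨
        trace m d (x ^ P + x) ^ P          ≈⟨ trans (π.cong h) yᴾ≈y ⟩
        y                                  ∎

    trace-fixed : ∀ d {x} → x ^ P ≈ x → trace m d x ≈ d · x
    trace-fixed zero    h = refl
    trace-fixed (suc d) h = trans (trace-suc d _) (+-congˡ (trans (trace-cong d h) (trace-fixed d h)))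

  even·≈0 : ∀ {d} → Even d → ∀ x → d · x ≈ 0#
  even·≈0 (j , ≡.refl) x = trans (×-homo-+ x j j) (x+x≈0 (j · x))
    where open import Algebra.Properties.Monoid.Mult +-monoid using (×-homo-+)

  odd·≈ : ∀ {d} → Odd d → ∀ x → d · x ≈ x
  odd·≈ (j , ≡.refl) x = trans (+-congˡ (even·≈0 (j , ≡.refl) x)) (+-identityʳ x)

  -- The solution is Σ_{i<k} (z θ)^{2^i} with θ + θ̄ = 1.
  artinSchreier-solution : ∀ {z} → σ z ≈ z → ∃[ s ] s * s + s ≈ z
  artinSchreier-solution {z} z̄≈z = trace 1 k y , (begin
    trace 1 k y * trace 1 k y + trace 1 k y    ≈⟨ +-congʳ (*-congˡ (*-identityʳ _)) ⟨
    trace 1 k y ^ 2 + trace 1 k y              ≈⟨ +-congʳ (trace-frobenius 1 k y) ⟩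
    trace 1 k (y ^ 2) + trace 1 k y            ≈⟨ trace-+ k _ _ ⟨
    trace 1 k (y ^ 2 + y)                      ≈⟨ trace-x^P+x k y ⟩
    y ^ ((2 ℕ.^ 1) ℕ.^ k) + y                  ≡⟨⟩
    σ (z * θ) + z * θ                          ≈⟨ +-congʳ (trans (σ.*-homo _ _) (*-congʳ z̄≈z)) ⟩
    z * σ θ + z * θ                            ≈⟨ distribˡ _ _ _ ⟨
    z * (σ θ + θ)                              ≈⟨ trans (*-congˡ θ̄+θ≈1) (*-identityʳ z) ⟩
    z                                          ∎)
    where
    open Trace 1
    -- ω^(q-1) ≠ 1 means ω̄ ≠ ω, so ω + ω̄ is invertible and θ = ω / (ω + ω̄).
    ω : Carrier
    ω = proj₁ (∃^≉1 q-1<n)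
    ω≉0 = proj₁ (proj₂ (∃^≉1 q-1<n))
    ω+ω̄≉0 : ¬ ω + σ ω ≈ 0#
    ω+ω̄≉0 h = proj₂ (proj₂ (∃^≉1 q-1<n)) (σZ≈wZ⇒Z^[q-1]≈w ω≉0 (trans (sym (+≈0⇒≈ h)) (sym (*-identityˡ ω))))
    i θ y : Carrier
    i = proj₁ (inverse ω+ω̄≉0)
    θ = ω * i
    y = z * θ
    ī≈i : σ i ≈ i
    ī≈i = *-cancelˡ ω+ω̄≉0 (begin
      (ω + σ ω) * σ i              ≈⟨ *-congʳ (trans (σ.+-homo _ _) (trans (+-congˡ (σσ ω)) (+-comm _ _))) ⟨
      σ (ω + σ ω) * σ i            ≈⟨ σ.*-homo _ _ ⟨
      σ ((ω + σ ω) * i)            ≈⟨ trans (σ.cong (proj₂ (inverse ω+ω̄≉0))) σ.1-homo ⟩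
      1#                           ≈⟨ proj₂ (inverse ω+ω̄≉0) ⟨
      (ω + σ ω) * i                ∎)
    θ̄+θ≈1 : σ θ + θ ≈ 1#
    θ̄+θ≈1 = begin
      σ (ω * i) + ω * i            ≈⟨ +-congʳ (trans (σ.*-homo _ _) (*-congˡ ī≈i)) ⟩
      σ ω * i + ω * i              ≈⟨ solve 3 (λ ω ω̄ i → ω̄ :* i :+ ω :* i := (ω :+ ω̄) :* i) refl ω (σ ω) i ⟩
      (ω + σ ω) * i                ≈⟨ proj₂ (inverse ω+ω̄≉0) ⟩
      1#                           ∎

  -- s and σ s solve the same equation, so their sum is a root of X² + X.
  artinSchreier-conjugate : ∀ {s z} → σ z ≈ z → s * s + s ≈ z → σ s ≈ s + 1# ⊎ σ s ≈ s
  artinSchreier-conjugate {s} {z} z̄≈z h = cases (σ s + s ≟ 1#)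
    where
    cases : Dec (σ s + s ≈ 1#) → _
    cases (yes p) = inj₁ (combine₁ 1# p (solve 2 (λ s s̄ → s̄ :+ (s :+ :1) := :1 :* (s̄ :+ s :+ :1)) refl s (σ s)))
    cases (no  p) = inj₂ (+≈0⇒≈ (x²+x≈0⇒x∈𝔽₂ (combine₂ 1# h̄ 1# h (solve 3 (λ s s̄ z →
      (s̄ :+ s) :* (s̄ :+ s) :+ (s̄ :+ s) :+ :0 := :1 :* (s̄ :* s̄ :+ s̄ :+ z) :+ :1 :* (s :* s :+ s :+ z)) refl s (σ s) z)) p))
      where
      h̄ : σ s * σ s + σ s ≈ z
      h̄ = trans (trans (+-congʳ (sym (σ.*-homo s s))) (sym (σ.+-homo _ _))) (trans (σ.cong h) z̄≈z)

  module _ {x : Carrier} {i : ℕ} where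
    private
      module g = Endomorphism (frobenius i)

    involution-even : g.⟦ g.⟦ x ⟧ ⟧ ≈ x → ∀ {d} → Even d → x ^ ((2 ℕ.^ i) ℕ.^ d) ≈ x
    involution-even h (zero , ≡.refl)  = *-identityʳ x
    involution-even h (suc j , ≡.refl) = begin
      x ^ (P ℕ.* P ℕ.^ (j ℕ.+ suc j))      ≡⟨ ≡.cong (λ d → x ^ (P ℕ.* P ℕ.^ d)) (ℕ.+-suc j j) ⟩
      x ^ (P ℕ.* (P ℕ.* P ℕ.^ (j ℕ.+ j)))  ≈⟨ trans (sym (^-assocʳ x P _)) (sym (^-assocʳ (x ^ P) P _)) ⟩
      ((x ^ P) ^ P) ^ (P ℕ.^ (j ℕ.+ j))    ≈⟨ ^-congˡ (P ℕ.^ (j ℕ.+ j)) h ⟩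
      x ^ (P ℕ.^ (j ℕ.+ j))                ≈⟨ involution-even h (j , ≡.refl) ⟩
      x                                    ∎
      where P = 2 ℕ.^ i

    involution-odd : g.⟦ g.⟦ x ⟧ ⟧ ≈ x → ∀ {d} → Odd d → x ^ ((2 ℕ.^ i) ℕ.^ d) ≈ g.⟦ x ⟧
    involution-odd h (j , ≡.refl) = begin
      x ^ (P ℕ.* P ℕ.^ (j ℕ.+ j))    ≡⟨ ≡.cong (x ^_) (ℕ.*-comm P (P ℕ.^ (j ℕ.+ j))) ⟩
      x ^ (P ℕ.^ (j ℕ.+ j) ℕ.* P)    ≈⟨ ^-assocʳ x (P ℕ.^ (j ℕ.+ j)) P ⟨
      (x ^ (P ℕ.^ (j ℕ.+ j))) ^ P    ≈⟨ ^-congˡ P (involution-even h (j , ≡.refl)) ⟩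
      x ^ P                          ∎
      where P = 2 ℕ.^ i

    inverting⇒involution : x * g.⟦ x ⟧ ≈ 1# → g.⟦ g.⟦ x ⟧ ⟧ ≈ x
    inverting⇒involution h = *-cancelˡ (*-≉0ˡ (≉0-resp (trans (sym h) (*-comm _ _)) 1≉0))
      (trans (sym (g.*-homo _ _)) (trans (trans (g.cong h) g.1-homo) (trans (sym h) (*-comm _ _))))

  -- Passage between f on the field and N / D on the circle.

  module Quadrinomial (b c : Carrier) (u v : ℕ)
    (u[Q+1]≡1 : u ℕ.* (Q ℕ.+ 1) ≡ 1 [mod q ℕ.+ 1 ]) (v[Q+1]≡Q : v ℕ.* (Q ℕ.+ 1) ≡ Q [mod q ℕ.+ 1 ]) where
    open Trinomial discreteChar2Field conj frob σσ σφ b c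

    f : Carrier → Carrier
    f Z = Z * (1# + b * (Z ^ q-1) ^ v + c * (Z ^ q-1) ^ u)

    f-cong : ∀ {Z Z′} → Z ≈ Z′ → f Z ≈ f Z′
    f-cong h = *-cong h (+-cong (+-congˡ (*-congˡ (^-congˡ v (^-congˡ q-1 h)))) (*-congˡ (^-congˡ u (^-congˡ q-1 h))))

    [x^[Q+1]]^ : ∀ {x i} j → Norm1 x → j ℕ.* (Q ℕ.+ 1) ≡ i [mod q ℕ.+ 1 ] → (x ^ (Q ℕ.+ 1)) ^ j ≈ x ^ i
    [x^[Q+1]]^ {x} {i} j x∈μ j≡ = trans (^-assocʳ x (Q ℕ.+ 1) j)
      (trans (^-congʳ x (ℕ.*-comm (Q ℕ.+ 1) j)) (μ-^-cong (j ℕ.* (Q ℕ.+ 1)) i x∈μ j≡))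

    [x^[Q+1]]^u≈x : ∀ {x} → Norm1 x → (x ^ (Q ℕ.+ 1)) ^ u ≈ x
    [x^[Q+1]]^u≈x x∈μ = trans ([x^[Q+1]]^ u x∈μ u[Q+1]≡1) (*-identityʳ _)

    module _ {Z x} (x∈μ : Norm1 x) (Z^[q-1]≈x^[Q+1] : Z ^ q-1 ≈ x ^ (Q ℕ.+ 1)) where

      -- On the circle the congruences for u and v say (x^(Q+1))^u = x and (x^(Q+1))^v = x^Q.
      -- Together with `σ-f-value` this gives f(Z)^(q-1) = N x / D x wherever f(Z) ≠ 0.
      f-value : f Z ≈ Z * D x
      f-value = *-congˡ (+-cong
        (+-congˡ (*-congˡ (trans (^-congˡ v Z^[q-1]≈x^[Q+1]) ([x^[Q+1]]^ v x∈μ v[Q+1]≡Q))))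
        (*-congˡ (trans (^-congˡ u Z^[q-1]≈x^[Q+1]) ([x^[Q+1]]^u≈x x∈μ))))

      σ-f-value : σ (f Z) ≈ Z * N x
      σ-f-value = begin
        σ (f Z)                       ≈⟨ trans (σ.cong f-value) (σ.*-homo _ _) ⟩
        σ Z * σ (D x)                 ≈⟨ *-congʳ (trans (sym (Z*Z^[q-1]≈σZ Z)) (*-congˡ Z^[q-1]≈x^[Q+1])) ⟩
        Z * x ^ (Q ℕ.+ 1) * σ (D x)   ≈⟨ *-congʳ (*-congˡ (^-congʳ x (ℕ.+-comm Q 1))) ⟩
        Z * (x * φ x) * σ (D x)       ≈⟨ *-assoc _ _ _ ⟩
        Z * (x * φ x * σ (D x))       ≈⟨ *-congˡ (N≈xφxσD x∈μ) ⟨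
        Z * N x                       ∎

    lift : ∀ {x} → Norm1 x → ∃[ Z ] ¬ Z ≈ 0# × Z ^ q-1 ≈ x ^ (Q ℕ.+ 1)
    lift {x} x∈μ = hilbert90 w , hilbert90-≉0 w , σZ≈wZ⇒Z^[q-1]≈w (hilbert90-≉0 w) (hilbert90-σ w∈μ)
      where
      w : Carrier
      w = x ^ (Q ℕ.+ 1)
      w∈μ : Norm1 w
      w∈μ = trans (*-cong w≈ (σ.cong w≈)) (Norm1-* x∈μ (Norm1-φ x∈μ))
        where
        w≈ : w ≈ x * φ x
        w≈ = ^-congʳ x (ℕ.+-comm Q 1)

    project : ∀ {Z} → ¬ Z ≈ 0# → ∃[ x ] Norm1 x × Z ^ q-1 ≈ x ^ (Q ℕ.+ 1)
    project {Z} Z≉0 = (Z ^ q-1) ^ u , Norm1-^u , sym (begin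
      ((Z ^ q-1) ^ u) ^ (Q ℕ.+ 1)     ≈⟨ ^-assocʳ _ u (Q ℕ.+ 1) ⟩
      (Z ^ q-1) ^ (u ℕ.* (Q ℕ.+ 1))   ≈⟨ μ-^-cong (u ℕ.* (Q ℕ.+ 1)) 1 (Z^[q-1]∈μ Z≉0) u[Q+1]≡1 ⟩
      (Z ^ q-1) ^ 1                   ≈⟨ *-identityʳ _ ⟩
      Z ^ q-1                         ∎)
      where
      Norm1-^u : Norm1 ((Z ^ q-1) ^ u)
      Norm1-^u = trans (sym (x^[q+1]≈xσx _)) (trans (^-assocʳ _ u (q ℕ.+ 1)) (trans (^-congʳ _ (ℕ.*-comm u (q ℕ.+ 1)))
        (trans (sym (^-assocʳ _ (q ℕ.+ 1) u)) (^-≈1 (trans (x^[q+1]≈xσx _) (Z^[q-1]∈μ Z≉0)) u))))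

    f0≈0 : f 0# ≈ 0#
    f0≈0 = zeroˡ _

    -- If x and y have the same image under N / D, then l = f Z / f Y is fixed by `σ`. As f is
    -- homogeneous under such scalars, f (l Y) = f Z, so Z = l Y, and Z and Y have the same (q -
    -- 1)-th power.
    injective⇒injective-μ : Injective _≈_ _≈_ f → Injective-μ
    injective⇒injective-μ f-inj = record { D≉0 = D≉0′ ; injective = injective′ }
      where
      D≉0′ : ∀ {x} → Norm1 x → ¬ D x ≈ 0#
      D≉0′ {x} x∈μ Dx≈0 =
        let Z , Z≉0 , h = lift x∈μ
        in Z≉0 (f-inj (trans (f-value x∈μ h) (trans (*-congˡ Dx≈0) (trans (zeroʳ _) (sym f0≈0)))))
      injective′ : ∀ {x y} → Norm1 x → Norm1 y → N x * D y ≈ N y * D x → x ≈ y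
      injective′ {x} {y} x∈μ y∈μ NxDy≈NyDx = trans (sym ([x^[Q+1]]^u≈x x∈μ))
        (trans (^-congˡ u (trans (sym hZ) (trans (^-congˡ q-1 Z≈lY) hlY))) ([x^[Q+1]]^u≈x y∈μ))
        where
        Z = proj₁ (lift x∈μ)
        Y = proj₁ (lift y∈μ)
        hZ = proj₂ (proj₂ (lift x∈μ))
        hY = proj₂ (proj₂ (lift y∈μ))
        fY≉0 : ¬ f Y ≈ 0#
        fY≉0 = ≉0-resp (sym (f-value y∈μ hY)) (*-≉0 (proj₁ (proj₂ (lift y∈μ))) (D≉0′ y∈μ))
        fZ≉0 : ¬ f Z ≈ 0#
        fZ≉0 = ≉0-resp (sym (f-value x∈μ hZ)) (*-≉0 (proj₁ (proj₂ (lift x∈μ))) (D≉0′ x∈μ))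
        l : Carrier
        l = f Z * proj₁ (inverse fY≉0)
        lfY≈fZ : l * f Y ≈ f Z
        lfY≈fZ = combine₁ (f Z) (proj₂ (inverse fY≉0))
          (solve 3 (λ a i y → a :* i :* y :+ a := a :* (y :* i :+ :1)) refl (f Z) (proj₁ (inverse fY≉0)) (f Y))
        σfZfY≈σfYfZ : σ (f Z) * f Y ≈ σ (f Y) * f Z
        σfZfY≈σfYfZ = begin
          σ (f Z) * f Y              ≈⟨ *-cong (σ-f-value x∈μ hZ) (f-value y∈μ hY) ⟩
          Z * N x * (Y * D y)        ≈⟨ solve 4 (λ z n y d → z :* n :* (y :* d) := z :* y :* (n :* d)) refl Z (N x) Y (D y) ⟩
          Z * Y * (N x * D y)        ≈⟨ *-congˡ NxDy≈NyDx ⟩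
          Z * Y * (N y * D x)        ≈⟨ solve 4 (λ z n y d → z :* y :* (n :* d) := y :* n :* (z :* d)) refl Z (N y) Y (D x) ⟩
          Y * N y * (Z * D x)        ≈⟨ *-cong (σ-f-value y∈μ hY) (f-value x∈μ hZ) ⟨
          σ (f Y) * f Z              ∎
        l̄≈l : σ l ≈ l
        l̄≈l = *-cancelˡ (*-≉0 (σ.≉0 fY≉0) fY≉0) (combine₃ (f Y) (trans (sym (σ.*-homo _ _)) (σ.cong lfY≈fZ)) 1# σfZfY≈σfYfZ (σ (f Y)) lfY≈fZ
          (solve 6 (λ l l̄ y ȳ z z̄ → ȳ :* y :* l̄ :+ ȳ :* y :* l := y :* (l̄ :* ȳ :+ z̄) :+ :1 :* (z̄ :* y :+ ȳ :* z) :+ ȳ :* (l :* y :+ z))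
            refl l (σ l) (f Y) (σ (f Y)) (f Z) (σ (f Z))))
        l≉0 : ¬ l ≈ 0#
        l≉0 = *-≉0ˡ (≉0-resp (sym lfY≈fZ) fZ≉0)
        hlY : (l * Y) ^ q-1 ≈ y ^ (Q ℕ.+ 1)
        hlY = trans (^-distrib-* l Y q-1) (trans (*-cong (σZ≈wZ⇒Z^[q-1]≈w l≉0 (trans l̄≈l (sym (*-identityˡ l)))) hY) (*-identityˡ _))
        Z≈lY : Z ≈ l * Y
        Z≈lY = f-inj (begin
          f Z              ≈⟨ lfY≈fZ ⟨
          l * f Y          ≈⟨ *-congˡ (f-value y∈μ hY) ⟩
          l * (Y * D y)    ≈⟨ *-assoc _ _ _ ⟨
          l * Y * D y      ≈⟨ f-value y∈μ hlY ⟨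
          f (l * Y)        ∎)

    injective-μ⇒injective : Injective-μ → Injective _≈_ _≈_ f
    injective-μ⇒injective inj {Z} {Y} fZ≈fY = cases (Z ≟ 0#) (Y ≟ 0#)
      where
      module inj = Injective-μ inj
      f≉0 : ∀ {Z} → ¬ Z ≈ 0# → ¬ f Z ≈ 0#
      f≉0 Z≉0 = let x , x∈μ , h = project Z≉0 in ≉0-resp (sym (f-value x∈μ h)) (*-≉0 Z≉0 (inj.D≉0 x∈μ))
      cases : Dec (Z ≈ 0#) → Dec (Y ≈ 0#) → Z ≈ Y
      cases (yes Z≈0) (yes Y≈0) = trans Z≈0 (sym Y≈0)
      cases (yes Z≈0) (no Y≉0)  = contradiction (trans (sym fZ≈fY) (trans (f-cong Z≈0) f0≈0)) (f≉0 Y≉0)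
      cases (no Z≉0)  (yes Y≈0) = contradiction (trans fZ≈fY (trans (f-cong Y≈0) f0≈0)) (f≉0 Z≉0)
      cases (no Z≉0)  (no Y≉0)  = *-cancelˡ (inj.D≉0 y∈μ) (begin
        D y * Z    ≈⟨ trans (*-comm _ _) (*-congˡ D-cong) ⟩
        Z * D x    ≈⟨ f-value x∈μ hx ⟨
        f Z        ≈⟨ fZ≈fY ⟩
        f Y        ≈⟨ f-value y∈μ hy ⟩
        Y * D y    ≈⟨ *-comm _ _ ⟩
        D y * Y    ∎)
        where
        x y : Carrier
        x = proj₁ (project Z≉0)
        y = proj₁ (project Y≉0)
        x∈μ = proj₁ (proj₂ (project Z≉0))
        y∈μ = proj₁ (proj₂ (project Y≉0))
        hx = proj₂ (proj₂ (project Z≉0))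
        hy = proj₂ (proj₂ (project Y≉0))
        x≈y : x ≈ y
        x≈y = inj.injective x∈μ y∈μ (*-cancelˡ (*-≉0 Z≉0 Y≉0) (begin
          Z * Y * (N x * D y)      ≈⟨ solve 4 (λ z n y d → z :* y :* (n :* d) := z :* n :* (y :* d)) refl Z (N x) Y (D y) ⟩
          Z * N x * (Y * D y)      ≈⟨ *-cong (σ-f-value x∈μ hx) (f-value y∈μ hy) ⟨
          σ (f Z) * f Y            ≈⟨ *-cong (σ.cong fZ≈fY) (sym fZ≈fY) ⟩
          σ (f Y) * f Z            ≈⟨ *-cong (σ-f-value y∈μ hy) (f-value x∈μ hx) ⟩
          Y * N y * (Z * D x)      ≈⟨ solve 4 (λ z n y d → y :* n :* (z :* d) := z :* y :* (n :* d)) refl Z (N y) Y (D x) ⟩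
          Z * Y * (N y * D x)      ∎))
        D-cong : D y ≈ D x
        D-cong = +-cong (+-congˡ (*-congˡ (φ.cong (sym x≈y)))) (*-congˡ (sym x≈y))

    -- Parity, the trace condition and the equivalence.

    module Criterion-on-μ {m k′ ℓ′} (k≡k′m : k ≡ k′ ℕ.* m) (ℓ≡ℓ′m : ℓ ≡ ℓ′ ℕ.* m)
      (parity : Odd k′ × Even ℓ′ ⊎ Even k′ × Odd ℓ′) where

      private
        P : ℕ
        P = 2 ℕ.^ m

        P^≡ : ∀ {n} n′ → n ≡ n′ ℕ.* m → P ℕ.^ n′ ≡ 2 ℕ.^ n
        P^≡ {n} n′ n≡ = ≡.trans (ℕ.^-*-assoc 2 m n′) (≡.cong (2 ℕ.^_) (≡.trans (ℕ.*-comm m n′) (≡.sym n≡)))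

        P^k′≡q : P ℕ.^ k′ ≡ q
        P^k′≡q = P^≡ k′ k≡k′m

        P^ℓ′≡Q : P ℕ.^ ℓ′ ≡ Q
        P^ℓ′≡Q = P^≡ ℓ′ ℓ≡ℓ′m

        -- Both are P^(k′ ℓ′): the k′-fold iterate of `φ` is the ℓ′-fold iterate of `σ`, which plays
        -- the two parities against each other.
        Q^k′≡q^ℓ′ : Q ℕ.^ k′ ≡ q ℕ.^ ℓ′
        Q^k′≡q^ℓ′ = ≡.trans (≡.cong (ℕ._^ k′) (≡.sym P^ℓ′≡Q)) (≡.trans (ℕ.^-*-assoc P ℓ′ k′)
          (≡.trans (≡.cong (P ℕ.^_) (ℕ.*-comm ℓ′ k′)) (≡.trans (≡.sym (ℕ.^-*-assoc P k′ ℓ′)) (≡.cong (ℕ._^ ℓ′) P^k′≡q))))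

      open Trace m

      -- P + 1 divides n = P^(2k′) - 1 with quotient t < n, so z^t ≠ 1 for some unit z, while
      -- (z^t)^(P+1) = z^n = 1.
      ∃x^[P+1]≈1 : ∃[ x ] ¬ x ≈ 1# × x * x ^ P ≈ 1#
      ∃x^[P+1]≈1 = z ^ t , proj₂ (proj₂ nonroot) , (begin
        (z ^ t) ^ suc P              ≈⟨ ^-assocʳ z t (suc P) ⟩
        z ^ (t ℕ.* suc P)            ≡⟨ ≡.cong (z ^_) n≡t[P+1] ⟨
        z ^ n                        ≈⟨ fermat (proj₁ (proj₂ nonroot)) ⟩
        1#                           ∎)
        where
        P≡1+ : P ≡ suc (ℕ.pred P)
        P≡1+ = ≡.sym (ℕ.suc-pred P {{ℕ.m^n≢0 2 m}})
        t : ℕ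
        t = proj₁ (even-power≡1 (ℕ.pred P) k′)
        n≡t[P+1] : n ≡ t ℕ.* suc P
        n≡t[P+1] = ℕ.suc-injective (≡.trans (≡.sym q²≡1+n) (≡.trans (≡.cong (ℕ._^ 2) (≡.sym P^k′≡q))
          (≡.trans (ℕ.^-*-assoc P k′ 2) (≡.trans (≡.cong (P ℕ.^_) (≡.trans (ℕ.*-comm k′ 2) (≡.cong (k′ ℕ.+_) (ℕ.+-identityʳ k′))))
          (≡.subst (λ p → p ℕ.^ (k′ ℕ.+ k′) ≡ 1 ℕ.+ t ℕ.* suc p) (≡.sym P≡1+) (proj₂ (even-power≡1 (ℕ.pred P) k′)))))))
        instance
          t≢0 : NonZero t
          t≢0 = ℕ.≢-nonZero (λ t≡0 → ℕ.≢-nonZero⁻¹ n (≡.trans n≡t[P+1] (≡.cong (ℕ._* suc P) t≡0)))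
        nonroot = ∃^≉1 {t} (≡.subst (t ℕ.<_) (≡.sym n≡t[P+1]) (ℕ.m<m*n t (suc P) (ℕ.s≤s (ℕ.m^n>0 2 m))))
        z = proj₁ nonroot

      private
        ζ : Carrier
        ζ = proj₁ ∃x^[P+1]≈1

        ζ≉1 : ¬ ζ ≈ 1#
        ζ≉1 = proj₁ (proj₂ ∃x^[P+1]≈1)

        ζζ^P≈1 : ζ * ζ ^ P ≈ 1#
        ζζ^P≈1 = proj₂ (proj₂ ∃x^[P+1]≈1)

        ζ^even : ∀ {n n′} → P ℕ.^ n′ ≡ n → Even n′ → ζ ^ n ≈ ζ
        ζ^even ≡.refl even = involution-even {i = m} (inverting⇒involution {i = m} ζζ^P≈1) even

        ζ^odd : ∀ {n n′} → P ℕ.^ n′ ≡ n → Odd n′ → ζ * ζ ^ n ≈ 1#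
        ζ^odd ≡.refl odd = trans (*-congˡ (involution-odd {i = m} (inverting⇒involution {i = m} ζζ^P≈1) odd)) ζζ^P≈1

        self-inverse : ∀ {x y} → x * y ≈ 1# → y ≈ x → x ≈ 1#
        self-inverse xy≈1 y≈x = x²≈1⇒x≈1 (trans (*-congˡ (sym y≈x)) xy≈1)

        -- As `φ` inverts x, an odd iterate of it gives φ x, and the equal even iterate of the
        -- involution `σ` gives x. So x is its own inverse, hence 1. The two lemmas that follow
        -- compare the same iterates, now concluding σ x = x.
        xφx≈1⇒x≈1 : Odd k′ → Even ℓ′ → ∀ {x} → x * φ x ≈ 1# → x ≈ 1#
        xφx≈1⇒x≈1 odd-k′ even-ℓ′ {x} h = self-inverse h (begin
          φ x              ≈⟨ involution-odd {i = ℓ} (inverting⇒involution {i = ℓ} h) odd-k′ ⟨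
          x ^ (Q ℕ.^ k′)   ≡⟨ ≡.cong (x ^_) Q^k′≡q^ℓ′ ⟩
          x ^ (q ℕ.^ ℓ′)   ≈⟨ involution-even {i = k} (σσ x) even-ℓ′ ⟩
          x                ∎)

        circle-xφx≈1⇒x≈1 : Even k′ → Odd ℓ′ → ∀ {x} → Norm1 x → x * φ x ≈ 1# → x ≈ 1#
        circle-xφx≈1⇒x≈1 even-k′ odd-ℓ′ {x} x∈μ h = self-inverse x∈μ (begin
          σ x              ≈⟨ involution-odd {i = k} (σσ x) odd-ℓ′ ⟨
          x ^ (q ℕ.^ ℓ′)   ≡⟨ ≡.cong (x ^_) Q^k′≡q^ℓ′ ⟨
          x ^ (Q ℕ.^ k′)   ≈⟨ involution-even {i = ℓ} (inverting⇒involution {i = ℓ} h) even-k′ ⟩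
          x                ∎)

        circle-φx≈x⇒x≈1 : Odd ℓ′ → ∀ {x} → Norm1 x → φ x ≈ x → x ≈ 1#
        circle-φx≈x⇒x≈1 odd-ℓ′ {x} x∈μ h = self-inverse x∈μ (begin
          σ x              ≈⟨ involution-odd {i = k} (σσ x) odd-ℓ′ ⟨
          x ^ (q ℕ.^ ℓ′)   ≡⟨ ≡.cong (x ^_) Q^k′≡q^ℓ′ ⟨
          x ^ (Q ℕ.^ k′)   ≈⟨ Trace.fixed-iterate ℓ h k′ ⟩
          x                ∎)

        module Fraction {x y : Carrier} (y≉0 : ¬ y ≈ 0#) where
          x/y : Carrier
          x/y = x * proj₁ (inverse y≉0)

          x/y*y≈x : x/y * y ≈ x
          x/y*y≈x = combine₁ x (proj₂ (inverse y≉0)) (solve 3 (λ x i y → x :* i :* y :+ x := x :* (y :* i :+ :1)) refl x _ y)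

          x/y≈1⇒x≈y : x/y ≈ 1# → x ≈ y
          x/y≈1⇒x≈y h = trans (sym x/y*y≈x) (trans (*-congʳ h) (*-identityˡ y))

          module _ (g : Endomorphism) where
            private module g = Endomorphism g

            g[x/y]g[y]≈g[x] : g.⟦ x/y ⟧ * g.⟦ y ⟧ ≈ g.⟦ x ⟧
            g[x/y]g[y]≈g[x] = trans (sym (g.*-homo _ _)) (g.cong x/y*y≈x)

            twisted-norm : x * g.⟦ x ⟧ ≈ y * g.⟦ y ⟧ → x/y * g.⟦ x/y ⟧ ≈ 1#
            twisted-norm h = *-cancelˡ (*-≉0 y≉0 (g.≉0 y≉0)) (begin
              y * g.⟦ y ⟧ * (x/y * g.⟦ x/y ⟧)    ≈⟨ solve 4 (λ y y′ z z′ → y :* y′ :* (z :* z′) := z :* y :* (z′ :* y′)) refl _ _ _ _ ⟩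
              x/y * y * (g.⟦ x/y ⟧ * g.⟦ y ⟧)    ≈⟨ *-cong x/y*y≈x g[x/y]g[y]≈g[x] ⟩
              x * g.⟦ x ⟧                        ≈⟨ h ⟩
              y * g.⟦ y ⟧                        ≈⟨ *-identityʳ _ ⟨
              y * g.⟦ y ⟧ * 1#                   ∎)

            fixed : g.⟦ x ⟧ * y ≈ g.⟦ y ⟧ * x → g.⟦ x/y ⟧ ≈ x/y
            fixed h = *-cancelˡ (*-≉0 y≉0 (g.≉0 y≉0)) (begin
              y * g.⟦ y ⟧ * g.⟦ x/y ⟧      ≈⟨ solve 3 (λ y y′ z′ → y :* y′ :* z′ := z′ :* y′ :* y) refl _ _ _ ⟩
              g.⟦ x/y ⟧ * g.⟦ y ⟧ * y      ≈⟨ *-congʳ g[x/y]g[y]≈g[x] ⟩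
              g.⟦ x ⟧ * y                  ≈⟨ h ⟩
              g.⟦ y ⟧ * x                  ≈⟨ *-congˡ x/y*y≈x ⟨
              g.⟦ y ⟧ * (x/y * y)          ≈⟨ solve 3 (λ y y′ z → y′ :* (z :* y) := y :* y′ :* z) refl _ _ _ ⟩
              y * g.⟦ y ⟧ * x/y            ∎)

      φ-onto : ∀ y → ∃[ x ] φ x ≈ y
      φ-onto = endomorphism-surjective frob

      sqrt : ∀ y → ∃[ x ] x * x ≈ y
      sqrt y = let x , h = endomorphism-surjective (frobenius 1) y in x , trans (*-congˡ (sym (*-identityʳ x))) h

      module _ {w} (ew≈1 : e * w ≈ 1#) where

        private
          e≉0 : ¬ e ≈ 0#
          e≉0 = *-≉0ˡ (≉0-resp (sym ew≈1) 1≉0)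

          w̄≈w : σ w ≈ w
          w̄≈w = *-cancelˡ e≉0 (begin
            e * σ w        ≈⟨ *-congʳ σ-e ⟨
            σ e * σ w      ≈⟨ σ.*-homo _ _ ⟨
            σ (e * w)      ≈⟨ trans (σ.cong ew≈1) σ.1-homo ⟩
            1#             ≈⟨ ew≈1 ⟨
            e * w          ∎)

          z : Carrier
          z = b * σ b * (w * w)

          z̄≈z : σ z ≈ z
          z̄≈z = begin
            σ (b * σ b * (w * w))        ≈⟨ trans (σ.*-homo _ _) (*-cong (σ.*-homo _ _) (σ.*-homo _ _)) ⟩
            σ b * σ (σ b) * (σ w * σ w)  ≈⟨ *-cong (trans (*-congˡ (σσ b)) (*-comm _ _)) (*-cong w̄≈w w̄≈w) ⟩
            b * σ b * (w * w)            ∎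

          s₀ : Carrier
          s₀ = proj₁ (artinSchreier-solution z̄≈z)

          as : s₀ * s₀ + s₀ ≈ z
          as = proj₂ (artinSchreier-solution z̄≈z)

          s̄ : σ s₀ ≈ s₀ + 1# ⊎ σ s₀ ≈ s₀
          s̄ = artinSchreier-conjugate z̄≈z as

        -- The trace of w lies in GF(P), so `φ` fixes it and w may be replaced by φ w = φ s₀ + s₀ +
        -- δ. The trace of s₀^P + s₀ telescopes to ε, and φ s₀ + s₀ collects ℓ′ conjugates of that
        -- element.
        trace-w : ∀ {ε δ} → φ w ≈ φ s₀ + s₀ + δ → σ s₀ + s₀ ≈ ε → ε ^ P ≈ ε → δ ^ P ≈ δ →
                  trace m k′ w ≈ ℓ′ · ε + k′ · δ
        trace-w {ε} {δ} φw≈ h εᴾ≈ε δᴾ≈δ = begin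
          trace m k′ w                                      ≈⟨ fixed-iterate Trw-fixed ℓ′ ⟨
          trace m k′ w ^ (P ℕ.^ ℓ′)                         ≡⟨ ≡.cong (trace m k′ w ^_) P^ℓ′≡Q ⟩
          trace m k′ w ^ Q                                  ≈⟨ trace-frobenius ℓ k′ w ⟩
          trace m k′ (φ w)                                  ≈⟨ trace-cong k′ (trans φw≈ (+-congʳ (+-congʳ (^-congʳ s₀ (≡.sym P^ℓ′≡Q))))) ⟩
          trace m k′ (s₀ ^ (P ℕ.^ ℓ′) + s₀ + δ)             ≈⟨ trace-+ k′ _ _ ⟩
          trace m k′ (s₀ ^ (P ℕ.^ ℓ′) + s₀) + trace m k′ δ  ≈⟨ +-cong (trace-x^P^j+x k′ h′ εᴾ≈ε ℓ′) (trace-fixed k′ δᴾ≈δ) ⟩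
          ℓ′ · ε + k′ · δ                                   ∎
          where
          trace-x^P+x′ : ∀ x → trace m k′ (x ^ P + x) ≈ σ x + x
          trace-x^P+x′ x = trans (trace-x^P+x k′ x) (+-congʳ (^-congʳ x P^k′≡q))
          h′ : trace m k′ (s₀ ^ P + s₀) ≈ ε
          h′ = trans (trace-x^P+x′ s₀) h
          Trw-fixed : trace m k′ w ^ P ≈ trace m k′ w
          Trw-fixed = trans (trace-frobenius m k′ w) (+≈0⇒≈ (trans (sym (trace-+ k′ _ _))
            (trans (trace-x^P+x′ w) (≈⇒+≈0 w̄≈w))))

        private
          1^ : ∀ i → 1# ^ i ≈ 1#
          1^ = ^-≈1 refl

          0^P : 0# ^ P ≈ 0#
          0^P = Endomorphism.0-homo (frobenius m)

          ε=0 : σ s₀ ≈ s₀ → σ s₀ + s₀ ≈ 0#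
          ε=0 = ≈⇒+≈0

          ε=1 : σ s₀ ≈ s₀ + 1# → σ s₀ + s₀ ≈ 1#
          ε=1 h = trans (+-congʳ h) (solve 1 (λ s → s :+ :1 :+ s := :1) refl s₀)

          module Balanced-case (b≉0 : ¬ b ≈ 0#) (balanced : Balanced) where
            open Criterion b≉0 ew≈1 balanced φ-onto hiding (e≉0) public

            φw≈ : ∀ {d} → δ s₀ ≈ d → φ w ≈ φ s₀ + s₀ + d
            φw≈ {d} h = combine₁ 1# h (solve 4 (λ w s S d → w :+ (S :+ s :+ d) := :1 :* (w :+ S :+ s :+ d)) refl (φ w) s₀ (φ s₀) d)

            δ∈𝔽₂ : δ s₀ ≈ 1# ⊎ δ s₀ ≈ 0#
            δ∈𝔽₂ = cases (δ s₀ ≟ 1#)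
              where
              cases : Dec (δ s₀ ≈ 1#) → _
              cases (yes h) = inj₁ h
              cases (no h)  = inj₂ (x²+x≈0⇒x∈𝔽₂ (shift²+shift≈0 balanced as) h)

            trace-odd-k′ : Odd k′ → Even ℓ′ → ∀ {ε δ′} → δ s₀ ≈ δ′ → σ s₀ + s₀ ≈ ε → ε ^ P ≈ ε → δ′ ^ P ≈ δ′ → trace m k′ w ≈ δ′
            trace-odd-k′ odd-k′ even-ℓ′ hδ hε εᴾ δᴾ = trans (trace-w (φw≈ hδ) hε εᴾ δᴾ)
              (trans (+-cong (even·≈0 even-ℓ′ _) (odd·≈ odd-k′ _)) (+-identityˡ _))

            trace-even-k′ : Even k′ → Odd ℓ′ → ∀ {ε δ′} → δ s₀ ≈ δ′ → σ s₀ + s₀ ≈ ε → ε ^ P ≈ ε → δ′ ^ P ≈ δ′ → trace m k′ w ≈ ε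
            trace-even-k′ even-k′ odd-ℓ′ hδ hε εᴾ δᴾ = trans (trace-w (φw≈ hδ) hε εᴾ δᴾ)
              (trans (+-cong (odd·≈ odd-ℓ′ _) (even·≈0 even-k′ _)) (+-identityʳ _))

            -- (3) reads δ = 1 if k′ is odd and ε = 0 if k′ is even; the other cases contradict the
            -- value of the trace. For odd k′ the power map is injective on all units, for even k′
            -- only on elements of equal norm, which ε = 0 provides.
            sufficient : trace m k′ w ≈ k′ · 1# → Injective-μ
            sufficient Trw≈ = cases parity δ∈𝔽₂ s̄
              where
              cases : Odd k′ × Even ℓ′ ⊎ Even k′ × Odd ℓ′ → δ s₀ ≈ 1# ⊎ δ s₀ ≈ 0# → σ s₀ ≈ s₀ + 1# ⊎ σ s₀ ≈ s₀ → Injective-μ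
              cases (inj₁ (odd-k′ , even-ℓ′)) (inj₁ δ≈1) _ = Power.sufficient as δ≈1
                (λ x≉0 y≉0 _ h → let open Fraction y≉0 in x/y≈1⇒x≈y (xφx≈1⇒x≈1 odd-k′ even-ℓ′ (twisted-norm frob h)))
              cases (inj₁ (odd-k′ , even-ℓ′)) (inj₂ δ≈0) (inj₁ ε) = contradiction
                (trans (sym (odd·≈ odd-k′ 1#)) (trans (sym Trw≈) (trace-odd-k′ odd-k′ even-ℓ′ δ≈0 (ε=1 ε) (1^ P) 0^P))) 1≉0
              cases (inj₁ (odd-k′ , even-ℓ′)) (inj₂ δ≈0) (inj₂ ε) = contradiction
                (trans (sym (odd·≈ odd-k′ 1#)) (trans (sym Trw≈) (trace-odd-k′ odd-k′ even-ℓ′ δ≈0 (ε=0 ε) 0^P 0^P))) 1≉0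
              cases (inj₂ (even-k′ , odd-ℓ′)) (inj₁ δ≈1) (inj₁ ε) = contradiction
                (trans (sym (trace-even-k′ even-k′ odd-ℓ′ δ≈1 (ε=1 ε) (1^ P) (1^ P))) (trans Trw≈ (even·≈0 even-k′ 1#))) 1≉0
              cases (inj₂ (even-k′ , odd-ℓ′)) (inj₂ δ≈0) (inj₁ ε) = contradiction
                (trans (sym (trace-even-k′ even-k′ odd-ℓ′ δ≈0 (ε=1 ε) (1^ P) 0^P)) (trans Trw≈ (even·≈0 even-k′ 1#))) 1≉0
              cases (inj₂ (even-k′ , odd-ℓ′)) (inj₁ δ≈1) (inj₂ ε) = Power.sufficient as δ≈1
                (λ x≉0 y≉0 norms h → let open Fraction y≉0 in x/y≈1⇒x≈y
                  (circle-xφx≈1⇒x≈1 even-k′ odd-ℓ′ (twisted-norm conj (norms ε)) (twisted-norm frob h)))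
              cases (inj₂ (even-k′ , odd-ℓ′)) (inj₂ δ≈0) (inj₂ ε) = Quotient.sufficient as δ≈0 ε
                (λ x≉0 y≉0 norms h → let open Fraction y≉0 in x/y≈1⇒x≈y
                  (circle-φx≈x⇒x≈1 odd-ℓ′ (twisted-norm conj norms) (fixed frob h)))

            -- Ramification points on the circle exclude δ = 0. The other two cases violating (3)
            -- are refuted by `ζ`: for odd k′ it has norm 1 and is fixed by `φ`, for even k′ it is
            -- fixed by `σ` and inverted by `φ`.
            necessary : Injective-μ → trace m k′ w ≈ k′ · 1#
            necessary inj = cases parity δ∈𝔽₂ s̄
              where
              cases : Odd k′ × Even ℓ′ ⊎ Even k′ × Odd ℓ′ → δ s₀ ≈ 1# ⊎ δ s₀ ≈ 0# → σ s₀ ≈ s₀ + 1# ⊎ σ s₀ ≈ s₀ →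
                      trace m k′ w ≈ k′ · 1#
              cases _ (inj₂ δ≈0) (inj₁ ε) = contradiction inj (Quotient.¬injective′ as δ≈0 ε)
              cases (inj₁ (odd-k′ , even-ℓ′)) (inj₁ δ≈1) (inj₁ ε) =
                trans (trace-odd-k′ odd-k′ even-ℓ′ δ≈1 (ε=1 ε) (1^ P) (1^ P)) (sym (odd·≈ odd-k′ 1#))
              cases (inj₁ (odd-k′ , even-ℓ′)) (inj₁ δ≈1) (inj₂ ε) =
                trans (trace-odd-k′ odd-k′ even-ℓ′ δ≈1 (ε=0 ε) 0^P (1^ P)) (sym (odd·≈ odd-k′ 1#))
              cases (inj₁ (odd-k′ , even-ℓ′)) (inj₂ δ≈0) (inj₂ ε) = contradiction inj
                (Quotient.¬injective as δ≈0 ε (ζ^odd P^k′≡q odd-k′) (ζ^even P^ℓ′≡Q even-ℓ′) ζ≉1)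
              cases (inj₂ (even-k′ , odd-ℓ′)) (inj₁ δ≈1) (inj₁ ε) = contradiction inj
                (Power.¬injective as δ≈1 ε (ζ^even P^k′≡q even-k′) (ζ^odd P^ℓ′≡Q odd-ℓ′) ζ≉1)
              cases (inj₂ (even-k′ , odd-ℓ′)) (inj₁ δ≈1) (inj₂ ε) =
                trans (trace-even-k′ even-k′ odd-ℓ′ δ≈1 (ε=0 ε) 0^P (1^ P)) (sym (even·≈0 even-k′ 1#))
              cases (inj₂ (even-k′ , odd-ℓ′)) (inj₂ δ≈0) (inj₂ ε) =
                trans (trace-even-k′ even-k′ odd-ℓ′ δ≈0 (ε=0 ε) 0^P 0^P) (sym (even·≈0 even-k′ 1#))

        module _ (b≈0 : b ≈ 0#) (c≈0 : c ≈ 0#) where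

          -- Without roots to work with, N / D is x^(Q+1) itself, undone on the circle by the u-th
          -- power.
          b≈c≈0⇒injective : Injective-μ
          b≈c≈0⇒injective = record
            { D≉0       = λ {x} _ → ≉0-resp (sym (D≈1 x)) 1≉0
            ; injective = λ {x} {y} x∈μ y∈μ h → begin
                x                        ≈⟨ [x^[Q+1]]^u≈x x∈μ ⟨
                (x ^ (Q ℕ.+ 1)) ^ u      ≈⟨ ^-congˡ u (trans (power x) (trans (sym (*-identityʳ _)) (trans (*-cong (sym (N≈xφx x)) (sym (D≈1 y)))
                  (trans h (trans (*-cong (N≈xφx y) (D≈1 x)) (trans (*-identityʳ _) (sym (power y)))))))) ⟩
                (y ^ (Q ℕ.+ 1)) ^ u      ≈⟨ [x^[Q+1]]^u≈x y∈μ ⟩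
                y                        ∎
            }
            where
            power : ∀ x → x ^ (Q ℕ.+ 1) ≈ x * φ x
            power x = ^-congʳ x (ℕ.+-comm Q 1)
            D≈1 : ∀ x → D x ≈ 1#
            D≈1 x = combine₂ (φ x) b≈0 x c≈0 (solve 4 (λ b c x X → :1 :+ b :* X :+ c :* x :+ :1 := X :* (b :+ :0) :+ x :* (c :+ :0))
              refl b c x (φ x))
            N≈xφx : ∀ x → N x ≈ x * φ x
            N≈xφx x = combine₂ x (trans (σ.cong b≈0) σ.0-homo) (φ x) (trans (σ.cong c≈0) σ.0-homo)
              (solve 4 (λ b̄ c̄ x X → x :* X :+ b̄ :* x :+ c̄ :* X :+ x :* X := x :* (b̄ :+ :0) :+ X :* (c̄ :+ :0))
                refl (σ b) (σ c) x (φ x))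

          b≈c≈0⇒trace : trace m k′ w ≈ k′ · 1#
          b≈c≈0⇒trace = trans (trace-cong k′ w≈1) (trace-fixed k′ (1^ P))
            where
            w≈1 : w ≈ 1#
            w≈1 = combine₃ 1# ew≈1 (w * σ b) b≈0 (w * σ c) c≈0 (solve 5 (λ b b̄ c c̄ w →
              w :+ :1 := :1 :* ((:1 :+ b :* b̄ :+ c :* c̄) :* w :+ :1) :+ w :* b̄ :* (b :+ :0) :+ w :* c̄ :* (c :+ :0))
              refl b (σ b) c (σ c) w)

        injective-μ⇒balanced : Injective-μ → Balanced
        injective-μ⇒balanced inj = cases (b ≟ 0#) s̄
          where
          open Balancing inj φ-onto obstruction
          cases : Dec (b ≈ 0#) → σ s₀ ≈ s₀ + 1# ⊎ σ s₀ ≈ s₀ → Balanced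
          cases (yes b≈0) _ = trans (trans (*-congʳ (trans (φ.cong (b≈0⇒c≈0 b≈0)) φ.0-homo)) (zeroˡ e))
                                    (sym (trans (*-congˡ b≈0) (zeroʳ _)))
          cases (no b≉0) (inj₁ ε) = ramified²⇒balanced inj φ-onto e≉0
              (conjugate-roots as ε) (conjugate-roots (artinSchreier-+1 as) (trans (σ.+-homo _ _) (+-cong ε σ.1-homo)))
              (isRoot as) (isRoot (artinSchreier-+1 as)) (root+root s₀)
            where open RamificationPoints b≉0 ew≈1 hiding (e≉0)
          cases (no b≉0) (inj₂ ε) = unramified⇒balanced (isRoot as) t≉0 (rational-root as ε) (b≉0 ∘ c≈0⇒b≈0 e≉0)
            where
            open RamificationPoints b≉0 ew≈1 hiding (e≉0)
            t≉0 : ¬ root s₀ ≈ 0#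
            t≉0 t≈0 = *-≉0 e≉0 (artinSchreier-≉0 as) (trans (sym (b*root≈es s₀)) (trans (*-congˡ t≈0) (zeroʳ b)))

        injective-μ⇒trace : Injective-μ → trace m k′ w ≈ k′ · 1#
        injective-μ⇒trace inj = cases (b ≟ 0#)
          where
          open Balancing inj φ-onto obstruction
          cases : Dec (b ≈ 0#) → trace m k′ w ≈ k′ · 1#
          cases (yes b≈0) = b≈c≈0⇒trace b≈0 (b≈0⇒c≈0 b≈0)
          cases (no b≉0)  = Balanced-case.necessary b≉0 (injective-μ⇒balanced inj) inj

        balanced∧trace⇒injective-μ : Balanced → trace m k′ w ≈ k′ · 1# → Injective-μ
        balanced∧trace⇒injective-μ balanced Trw≈ = cases (b ≟ 0#)
          where
          cases : Dec (b ≈ 0#) → Injective-μ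
          cases (yes b≈0) = b≈c≈0⇒injective b≈0 (φ.≈0 (x*y≈0⇒y≈0 e≉0 (trans (*-comm _ _) (trans balanced (trans (*-congˡ b≈0) (zeroʳ _))))))
          cases (no b≉0)  = Balanced-case.sufficient b≉0 balanced Trw≈

      injective-μ⇒e≉0 : Injective-μ → ¬ e ≈ 0#
      injective-μ⇒e≉0 = injective⇒e≉0 φ-onto sqrt

      private
        e′ : Carrier
        e′ = 1# + b ^ (q ℕ.+ 1) + c ^ (q ℕ.+ 1)

        e′≈e : e′ ≈ e
        e′≈e = +-cong (+-congˡ (x^[q+1]≈xσx b)) (x^[q+1]≈xσx c)

        e*1/e′≈1 : (e′#0 : e′ # 0#) → e * 1/ e′#0 ≈ 1#
        e*1/e′≈1 e′#0 = trans (*-congʳ (sym e′≈e)) (1/-inverse e′#0)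

        -- Since Q is positive, multiplying (2) by the nonzero e absorbs the truncated exponent and
        -- gives `Balanced`.
        e[e′^[Q-1]b]≈φeb : e * (e′ ^ (Q ℕ.∸ 1) * b) ≈ φ e * b
        e[e′^[Q-1]b]≈φeb = begin
          e * (e′ ^ (Q ℕ.∸ 1) * b)     ≈⟨ *-assoc _ _ _ ⟨
          e * e′ ^ (Q ℕ.∸ 1) * b       ≈⟨ *-congʳ (*-congˡ (^-congˡ (Q ℕ.∸ 1) e′≈e)) ⟩
          e ^ suc (Q ℕ.∸ 1) * b        ≈⟨ *-congʳ (^-congʳ e (ℕ.m+[n∸m]≡n (ℕ.m^n>0 2 ℓ))) ⟩
          φ e * b                      ∎

      permutes⇔conditions : Permutes f ⇔
        (Σ[ e#0 ∈ e′ # 0# ] (c ^ Q ≈ e′ ^ (Q ℕ.∸ 1) * b) × (trace m k′ (1/ e#0) ≈ k′ · 1#))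
      permutes⇔conditions = mk⇔ (conditions ∘ injective⇒injective-μ ∘ proj₁) (permutes ∘ injective-μ)
        where
        Conditions : Set _
        Conditions = Σ[ e#0 ∈ e′ # 0# ] (c ^ Q ≈ e′ ^ (Q ℕ.∸ 1) * b) × (trace m k′ (1/ e#0) ≈ k′ · 1#)
        permutes : Injective-μ → Permutes f
        permutes inj = injective-μ⇒injective inj , injective⇒surjective f-cong (injective-μ⇒injective inj)
        injective-μ : Conditions → Injective-μ
        injective-μ (e′#0 , φc≈ , tr) = balanced∧trace⇒injective-μ (e*1/e′≈1 e′#0)
          (trans (*-comm _ _) (trans (*-congˡ φc≈) e[e′^[Q-1]b]≈φeb)) tr
        conditions : Injective-μ → Conditions
        conditions inj = e′#0
          , *-cancelˡ e≉0 (trans (*-comm _ _) (trans (injective-μ⇒balanced (e*1/e′≈1 e′#0) inj) (sym e[e′^[Q-1]b]≈φeb)))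
          , injective-μ⇒trace (e*1/e′≈1 e′#0) inj
          where
          e≉0 : ¬ e ≈ 0#
          e≉0 = injective-μ⇒e≉0 inj
          e′#0 : e′ # 0#
          e′#0 = ≉0⇒#0 (≉0-resp (sym e′≈e) e≉0)

-- Exactly one of k/m and ℓ/m is even; the theorem.

module _ (k ℓ : ℕ) .{{_ : NonZero k}} .{{_ : NonZero ℓ}} where

  2^ord₂[gcd]∣ʳ : 2 ℕ.^ ord₂ (gcd k ℓ) ∣ ℓ
  2^ord₂[gcd]∣ʳ = ∣-trans (2^ord₂∣ (gcd k ℓ)) (gcd[m,n]∣n k ℓ)

  private
    m∣k = 2^ord₂[gcd]∣ˡ k ℓ
    m∣ℓ = 2^ord₂[gcd]∣ʳ

  opposite-parity : gcd (2 ℕ.^ ℓ ℕ.+ 1) (2 ℕ.^ k ℕ.+ 1) ≡ 1 →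
    Odd (quotient m∣k) × Even (quotient m∣ℓ) ⊎ Even (quotient m∣k) × Odd (quotient m∣ℓ)
  opposite-parity coprime = cases (even⊎odd (quotient m∣k)) (even⊎odd (quotient m∣ℓ))
    where
    cases : Even (quotient m∣k) ⊎ Odd (quotient m∣k) → Even (quotient m∣ℓ) ⊎ Odd (quotient m∣ℓ) → _
    cases (inj₁ even-k′) (inj₁ even-ℓ′) = contradiction even-ℓ′ (¬both-even (_∣_.equality m∣k) (_∣_.equality m∣ℓ) even-k′)
    cases (inj₁ even-k′) (inj₂ odd-ℓ′)  = inj₂ (even-k′ , odd-ℓ′)
    cases (inj₂ odd-k′)  (inj₁ even-ℓ′) = inj₁ (odd-k′ , even-ℓ′)
    cases (inj₂ odd-k′)  (inj₂ odd-ℓ′)  = contradiction odd-ℓ′ (¬both-odd (_∣_.equality m∣k) (_∣_.equality m∣ℓ) coprime odd-k′)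

corollary9p4 :
    ∀ (k ℓ : ℕ) .{{_ : NonZero k}} .{{_ : NonZero ℓ}} →
    let m = 2 ℕ.^ ord₂ (gcd k ℓ)
        m∣k : m ∣ k
        m∣k = 2^ord₂[gcd]∣ˡ k ℓ
        k/m = quotient m∣k
        q = 2 ℕ.^ k
        Q = 2 ℕ.^ ℓ
    in
    gcd (Q ℕ.+ 1) (q ℕ.+ 1) ≡ 1 →
    ∀ {a r s} (F : HeytingField a r s) → HasCardinality F (q ℕ.^ 2) →
    let open FieldNotation F in
    ∀ (b c : Carrier) (u v : ℕ) .{{_ : NonZero u}} .{{_ : NonZero v}} →
    u ℕ.* (Q ℕ.+ 1) ≡ 1 [mod q ℕ.+ 1 ] →
    v ℕ.* (Q ℕ.+ 1) ≡ Q [mod q ℕ.+ 1 ] →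
    let A : Carrier → Carrier
        A x = 1# + b * x ^ v + c * x ^ u
        f : Carrier → Carrier
        f x = x * A (x ^ (q ℕ.∸ 1))
        e = 1# + b ^ (q ℕ.+ 1) + c ^ (q ℕ.+ 1)
    in
    Permutes f ⇔
      (Σ[ e#0 ∈ e # 0# ]
        (c ^ Q ≈ e ^ (Q ℕ.∸ 1) * b) ×
        (Tr m∣k (1/ e#0) ≈ k/m · 1#))
corollary9p4 k ℓ coprime F card b c u v u[Q+1]≡1 v[Q+1]≡Q =
  QuadraticExtension.Quadrinomial.Criterion-on-μ.permutes⇔conditions k ℓ F card b c u v u[Q+1]≡1 v[Q+1]≡Q
    (_∣_.equality (2^ord₂[gcd]∣ˡ k ℓ)) (_∣_.equality (2^ord₂[gcd]∣ʳ k ℓ)) (opposite-parity k ℓ coprime)
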